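{- Let $1<\ell<m$, let $\delta=\ell(m-\ell)$, and let $\eta=(m-\ell,\,m-\ell+2,\,m-\ell+3,\dots,m)$. Then the higher weights of the Schubert code $C_\eta(\ell,m)$ are $$d_r(C_\eta(\ell,m))=q^{\delta-1}+q^{\delta-2}+\dots+q^{\delta-r}\quad\text{for } 1\le r\le\max\{\ell,m-\ell\}.$$ In particular, the minimum distance is $d_1(C_\eta(\ell,m))=q^{\delta-1}=q^{\delta_\eta}$, where $\delta_\eta=\sum_{i=1}^\ell(\eta_i-i)$.
   Context: $\mathbb{F}_q$ is the finite field with $q$ elements, $V=\mathbb{F}_q^m$ with standard basis $e_1,\dots,e_m$, $A_j=\mathrm{span}(e_1,\dots,e_j)$. $G_{\ell,m}$ is the Grassmannian of $\ell$-dimensional subspaces of $V$; for $\alpha=(\alpha_1<\dots<\alpha_\ell)$, $\Omega_\alpha=\{W\in G_{\ell,m}:\dim(W\cap A_{\alpha_i})\ge i,\ i=1,\dots,\ell\}$ ($\Omega_\eta$ is the Schubert divisor of $G_{\ell,m}$). The Schubert code $C_\alpha(\ell,m)$ is the nondegenerate linear code associated with the projective system $X$ of $\mathbb{F}_q$-rational points of $\Omega_\alpha$ under the Plücker embedding $W\mapsto[w_1\wedge\dots\wedge w_\ell]\in\mathbb{P}(\wedge^\ell V)$, viewed inside the projective linear span $\mathbb{P}^{k-1}$ of $X$. Its $r$-th higher weight is $d_r=|X|-\max\{|X\cap\Pi|:\Pi \text{ a linear subspace of } \mathbb{P}^{k-1} \text{ of codimension } r\}$, which coincides with the minimum, over $r$-dimensional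 subcodes $D$, of the number of coordinates at which some element of $D$ is nonzero; $d_1$ is the minimum distance. -}

module Defs where

open import Level using (Level; _⊔_) renaming (suc to lsuc)
open import Algebra.Bundles using (CommutativeRing)
open import Data.Nat as ℕ using (ℕ; zero; suc; _∸_; _^_; _≤_) renaming (_+_ to _+ℕ_)
open import Data.Fin using (Fin; zero; suc; toℕ; punchIn)
open import Data.Vec using (Vec; []; _∷_; lookup)
open import Data.List as List using (List; []; _∷_; _++_; length; filter)
open import Data.List.Relation.Unary.All using (All)
open import Data.List.Relation.Unary.Any using (Any)
open import Data.List.Relation.Unary.AllPairs using (AllPairs)
open import Data.Product using (Σ; ∃; _×_; _,_)
open import Relation.Nullary using (¬_; Dec; yes; no)
open import Relation.Binary using (Decidable)
open import Data.Bool using (Bool; true; false; _∨_; not)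
open import Relation.Nullary.Decidable using (⌊_⌋)

record FiniteField (c ℓ : Level) : Set (lsuc (c ⊔ ℓ)) where
  field
    commRing  : CommutativeRing c ℓ
  open CommutativeRing commRing public
  field
    0≉1       : ¬ (0# ≈ 1#)
    inverse   : ∀ x → ¬ (x ≈ 0#) → ∃ λ y → x * y ≈ 1#
    _≟_       : Decidable _≈_
    elements  : List Carrier
    complete  : ∀ x → Any (x ≈_) elements
    distinct  : AllPairs (λ x y → ¬ (x ≈ y)) elements

  q : ℕ
  q = length elements

sumℕ₁ : ℕ → (ℕ → ℕ) → ℕ
sumℕ₁ zero    f = 0
sumℕ₁ (suc r) f = sumℕ₁ r f +ℕ f (suc r)

-- ℓ-element subsets of {0,…,m-1}, as strictly increasing index tuples
-- (the index set of the standard basis e_I of ∧^ℓ V)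
increasingTuples : (m ℓ : ℕ) → List (Vec (Fin m) ℓ)
increasingTuples m       zero    = [] ∷ []
increasingTuples zero    (suc ℓ) = []
increasingTuples (suc m) (suc ℓ) =
  List.map (λ v → zero ∷ Data.Vec.map suc v) (increasingTuples m ℓ)
  ++ List.map (Data.Vec.map suc) (increasingTuples m (suc ℓ))

-- the Schubert divisor index η = (m-ℓ, m-ℓ+2, m-ℓ+3, …, m),
-- indexed 0-based: η 0 = m-ℓ, η k = m-ℓ+k+1 for k ≥ 1
etaDiv : (ℓ m : ℕ) → Fin ℓ → ℕ
etaDiv ℓ m zero    = m ∸ ℓ
etaDiv ℓ m (suc k) = (m ∸ ℓ) +ℕ suc (suc (toℕ k))

deltaOf : (ℓ : ℕ) → (Fin ℓ → ℕ) → ℕ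
deltaOf zero    α = 0
deltaOf (suc ℓ) α = (α zero ∸ 1) +ℕ deltaOf ℓ (λ k → α (suc k) ∸ 1)

module _ {c ℓ' : Level} (𝔽 : FiniteField c ℓ') where
  open FiniteField 𝔽 using (Carrier; _≈_; _+_; _*_; -_; 0#; 1#; _≟_)

  sumF : ∀ n → (Fin n → Carrier) → Carrier
  sumF zero    f = 0#
  sumF (suc n) f = f zero + sumF n (λ i → f (suc i))

  sumList : ∀ {a} {A : Set a} → List A → (A → Carrier) → Carrier
  sumList []       f = 0#
  sumList (x ∷ xs) f = f x + sumList xs f

  altSign : ℕ → Carrier
  altSign zero    = 1#
  altSign (suc k) = - altSign k

  det : ∀ n → (Fin n → Fin n → Carrier) → Carrier
  det zero    M = 1#
  det (suc n) M = sumF (suc n) λ j →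
    altSign (toℕ j) * (M zero j * det n (λ r s → M (suc r) (punchIn j s)))

  LinIndep : ∀ {t n} → (Fin t → Fin n → Carrier) → Set (c ⊔ ℓ')
  LinIndep {t} {n} u = ∀ (λc : Fin t → Carrier) →
    (∀ j → sumF t (λ k → λc k * u k j) ≈ 0#) → ∀ k → λc k ≈ 0#

  Matrix : ℕ → ℕ → Set c
  Matrix ℓ m = Fin ℓ → Fin m → Carrier

  InRowSpace : ∀ {ℓ m} → Matrix ℓ m → (Fin m → Carrier) → Set (c ⊔ ℓ')
  InRowSpace {ℓ} M v = ∃ λ (a : Fin ℓ → Carrier) →
    ∀ j → v j ≈ sumF ℓ (λ k → a k * M k j)

  -- v ∈ A_j = span(e_1,…,e_j): coordinates with (0-based) index ≥ j vanish
  InA : ∀ {m} → ℕ → (Fin m → Carrier) → Set ℓ'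
  InA j v = ∀ x → j ≤ toℕ x → v x ≈ 0#

  DimCapAtLeast : ∀ {ℓ m} → Matrix ℓ m → (j i : ℕ) → Set (c ⊔ ℓ')
  DimCapAtLeast {ℓ} {m} M j i = ∃ λ (u : Fin i → Fin m → Carrier) →
    (∀ k → InRowSpace M (u k)) × (∀ k → InA j (u k)) × LinIndep u

  InSchubert : ∀ {ℓ m} → (Fin ℓ → ℕ) → Matrix ℓ m → Set (c ⊔ ℓ')
  InSchubert {ℓ} α M =
    LinIndep M × (∀ (k : Fin ℓ) → DimCapAtLeast M (α k) (suc (toℕ k)))

  SameSpace : ∀ {ℓ m} → Matrix ℓ m → Matrix ℓ m → Set (c ⊔ ℓ')
  SameSpace M N = (∀ k → InRowSpace N (M k)) × (∀ k → InRowSpace M (N k))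

  -- reps lists exactly one spanning matrix for each F_q-rational point of Ω_α
  EnumeratesSchubert : ∀ {ℓ m} → (Fin ℓ → ℕ) → List (Matrix ℓ m) → Set (c ⊔ ℓ')
  EnumeratesSchubert {ℓ} {m} α reps =
    All (InSchubert α) reps ×
    AllPairs (λ M N → ¬ SameSpace M N) reps ×
    (∀ M → InSchubert α M → Any (SameSpace M) reps)

  plucker : ∀ {ℓ m} → Vec (Fin m) ℓ → Matrix ℓ m → Carrier
  plucker {ℓ} I M = det ℓ (λ r s → M r (lookup I s))

  -- the linear functional on ∧^ℓ V with coefficients a_I in the basis e_I
  evalFunctional : ∀ {ℓ m} → (Vec (Fin m) ℓ → Carrier) → Matrix ℓ m → Carrier
  evalFunctional {ℓ} {m} a M = sumList (increasingTuples m ℓ) (λ I → a I * plucker I M)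

  -- codewords of the code of the projective system {[∧ reps_j]}:
  -- (f(P_1),…,f(P_n)) for f a linear functional on ∧^ℓ V
  IsCodeword : ∀ {ℓ m} (reps : List (Matrix ℓ m)) → (Fin (length reps) → Carrier) → Set (c ⊔ ℓ')
  IsCodeword {ℓ} {m} reps w = ∃ λ (a : Vec (Fin m) ℓ → Carrier) →
    ∀ j → w j ≈ evalFunctional a (List.lookup reps j)

  -- number of coordinates j at which some w_i is nonzero
  -- (the support size of the subcode spanned by w_1,…,w_r)
  supportSize : ∀ {r n} → (Fin r → Fin n → Carrier) → ℕ
  supportSize {r} {n} w = countTrue n (λ j → anyNZ r (λ i → w i j))
    where
    anyNZ : ∀ t → (Fin t → Carrier) → Bool
    anyNZ zero    f = false
    anyNZ (suc t) f = not ⌊ f zero ≟ 0# ⌋ ∨ anyNZ t (λ i → f (suc i))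
    countTrue : ∀ n → (Fin n → Bool) → ℕ
    countTrue zero    b = 0
    countTrue (suc n) b = (if b zero then 1 else 0) +ℕ countTrue n (λ i → b (suc i))
      where open import Data.Bool using (if_then_else_)

  -- d is the r-th higher weight of the code with codeword predicate IsCW:
  -- the minimum over r-dimensional subcodes (spanned by r linearly
  -- independent codewords) of the support size
  IsHigherWeight : ∀ {n} → ((Fin n → Carrier) → Set (c ⊔ ℓ')) → ℕ → ℕ → Set (c ⊔ ℓ')
  IsHigherWeight {n} IsCW r d =
    (∃ λ (w : Fin r → Fin n → Carrier) →
        (∀ i → IsCW (w i)) × LinIndep w × supportSize w ≡ d)
    × (∀ (w : Fin r → Fin n → Carrier) →
        (∀ i → IsCW (w i)) → LinIndep w → d ≤ supportSize w)
    where open import Relation.Binary.PropositionalEquality using (_≡_)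

{-# OPTIONS --safe #-}
module Submission where

-- A functional on ∧^ℓ V is an alternating ℓ-form g on V = F_q^m.  Contracting with a first argument outside the
-- radical and inducting on ℓ shows that g ≠ 0 is nonzero on at least q^δ·|GL_ℓ(q)| of the ℓ-tuples of vectors
-- (the radical has at most q^(m-ℓ) elements), and on at most that many if the radical has q^(m-ℓ) elements.
-- The Schubert divisor is the zero locus of a single Plücker coordinate p, and the bases of its points
-- are the frames A·R with R a representative and A ∈ GL_ℓ(q).  For an r-dimensional subcode spanned by a₁, …, aᵣ,
-- averaging the count of nonzeros over all combinations of p, a₁, …, aᵣ bounds from below the number of ℓ-tuples
-- with p = 0 and some aᵢ ≠ 0; this is the Griesmer–Wei bound.  Equality holds if all these combinations have
-- a radical of size q^(m-ℓ).  For r ≤ m-ℓ, the minors on the last ℓ-1 columns and one more column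
-- have this property, and for r ≤ ℓ so do the minors that omit one of the last ℓ+1 columns.

open import Defs
open import Data.Nat using (ℕ; zero; suc; _<_; _≤_; _∸_; _^_; _⊔_; z≤n; s≤s)
open import Data.List using (List; []; _∷_; _++_; map; concatMap; length; lookup)
open import Data.Product using (∃; _×_; _,_; proj₁; proj₂; swap)
open import Relation.Binary.PropositionalEquality using (_≡_)

import Level
open import Data.Fin as Fin using (Fin; zero; suc; toℕ; fromℕ; inject≤; punchIn; punchOut; _↑ˡ_; _↑ʳ_)
import Data.Fin.Properties as Fin
import Data.List as List
open import Data.List.Membership.Propositional using (_∈_)
open import Data.List.Membership.Propositional.Properties using (∈-map⁺; ∈-map⁻; ∈-++⁺ˡ; ∈-++⁺ʳ)
open import Data.List.Relation.Unary.All as All using (All; []; _∷_)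
open import Data.List.Relation.Unary.AllPairs using (AllPairs; []; _∷_)
open import Data.List.Relation.Unary.Any as Any using (Any; here; there)
open import Data.List.Relation.Unary.Any.Properties using (lookup-index)
open import Data.List.Relation.Unary.Unique.Propositional using (Unique)
import Data.List.Relation.Unary.Unique.Propositional.Properties as Unique
import Data.Nat as ℕ
import Data.Nat.Properties as ℕ
import Data.Nat.Solver as ℕ
open import Data.Product.Relation.Binary.Pointwise.NonDependent using (×-decSetoid)
open import Data.Sum using (_⊎_; inj₁; inj₂)
open import Data.Unit.Polymorphic using (⊤; tt)
open import Data.Vec as Vec using (Vec)
import Data.Vec.Properties as Vec
open import Data.Vec.Functional using (tail) renaming (_∷_ to _◂_; [] to ⟨⟩)
open import Function using (_∘_)
open import Relation.Binary using (DecSetoid; tri<; tri≈; tri>)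
open import Relation.Binary.PropositionalEquality as ≡ using (_≢_)
open import Relation.Nullary using (¬_; Dec; yes; no; ¬?; contradiction)
open import Relation.Nullary.Decidable using (decidable-stable; _×-dec_)

-- Tuples of vectors are counted instead of points, so that sums run over all of `Mat ℓ m`; each
-- point of the divisor then counts |GL_ℓ(q)| times, and this factor cancels at the end. A codeword
-- sees its functional only on p = 0, so adding multiples of p to the functional does not change it.
-- For this reason p is adjoined to the aᵢ: a subcode of dimension r becomes r + 1 linearly
-- independent forms on the whole of V, to which the bound for nonzero forms applies. Let B =
-- q^δ·|GL_ℓ(q)| be that bound, attained by p, and let Y be the number of tuples with p = 0 and some
-- aᵢ ≠ 0. The sum of the counts over all combinations is (q - 1) q^r (B + Y), and it is at least
-- (q^(r+1) - 1) B, hence (q - 1) q^r Y ≥ (q^r - 1) B. Division by (q - 1) q^r |GL_ℓ(q)| produces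
-- q^(δ-1) + ... + q^(δ-r). The inequalities are kept in ℕ by moving negative terms to the other
-- side and multiplying out denominators.

module Counting where

  -- Finite setoids and counting

  open import Level using (Level; 0ℓ) renaming (suc to lsuc)
  open import Data.Nat using (ℕ; zero; suc; _+_; _*_; _^_; _≤_; z≤n)
  open import Data.Nat.Properties hiding (_≟_)
  open import Algebra.Properties.CommutativeSemigroup +-commutativeSemigroup using (interchange)
  open import Relation.Binary.PropositionalEquality using (_≡_; _≢_; refl; sym; trans; cong; cong₂; module ≡-Reasoning)

  private variable
    a b ℓ₁ ℓ₂ p r : Level
    A B C : Set a

  ⟦_⟧ : {P : Set p} → Dec P → ℕ
  ⟦ yes _ ⟧ = 1
  ⟦ no _ ⟧  = 0

  ⟦⟧-yes : {P : Set p} (P? : Dec P) → P → ⟦ P? ⟧ ≡ 1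
  ⟦⟧-yes (yes _) _ = refl
  ⟦⟧-yes (no ¬p) p = contradiction p ¬p

  ⟦⟧-no : {P : Set p} (P? : Dec P) → ¬ P → ⟦ P? ⟧ ≡ 0
  ⟦⟧-no (yes p) ¬p = contradiction p ¬p
  ⟦⟧-no (no _) _   = refl

  ⟦⟧-mono : {P : Set p} {R : Set r} (P? : Dec P) (R? : Dec R) → (P → R) → ⟦ P? ⟧ ≤ ⟦ R? ⟧
  ⟦⟧-mono (no _)  _  _ = z≤n
  ⟦⟧-mono (yes p) R? f = ≤-reflexive (sym (⟦⟧-yes R? (f p)))

  ⟦⟧-cong : {P : Set p} {R : Set r} (P? : Dec P) (R? : Dec R) → (P → R) → (R → P) → ⟦ P? ⟧ ≡ ⟦ R? ⟧
  ⟦⟧-cong P? R? f g = ≤-antisym (⟦⟧-mono P? R? f) (⟦⟧-mono R? P? g)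

  ⟦⟧-× : {P : Set p} {R : Set r} (P? : Dec P) (R? : Dec R) → ⟦ P? ×-dec R? ⟧ ≡ ⟦ P? ⟧ * ⟦ R? ⟧
  ⟦⟧-× (yes _) (yes _) = refl
  ⟦⟧-× (yes _) (no _)  = refl
  ⟦⟧-× (no _)  (yes _) = refl
  ⟦⟧-× (no _)  (no _)  = refl

  ⟦⟧+⟦¬⟧ : {P : Set p} (P? : Dec P) → ⟦ P? ⟧ + ⟦ ¬? P? ⟧ ≡ 1
  ⟦⟧+⟦¬⟧ (yes _) = refl
  ⟦⟧+⟦¬⟧ (no _)  = refl

  ⟦⟧-inv : {P : Set p} (P? : Dec P) → ⟦ P? ⟧ ≢ 0 → P
  ⟦⟧-inv (yes p) _ = p
  ⟦⟧-inv (no _)  h = contradiction refl h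

  ∑ : List A → (A → ℕ) → ℕ
  ∑ []       f = 0
  ∑ (x ∷ xs) f = f x + ∑ xs f

  ∑-cong : ∀ (xs : List A) {f g : A → ℕ} → (∀ x → f x ≡ g x) → ∑ xs f ≡ ∑ xs g
  ∑-cong []       h = refl
  ∑-cong (x ∷ xs) h = cong₂ _+_ (h x) (∑-cong xs h)

  ∑-mono : ∀ (xs : List A) {f g : A → ℕ} → (∀ x → f x ≤ g x) → ∑ xs f ≤ ∑ xs g
  ∑-mono []       h = z≤n
  ∑-mono (x ∷ xs) h = +-mono-≤ (h x) (∑-mono xs h)

  ∑-+ : ∀ (xs : List A) (f g : A → ℕ) → ∑ xs (λ x → f x + g x) ≡ ∑ xs f + ∑ xs g
  ∑-+ []       f g = refl
  ∑-+ (x ∷ xs) f g = trans (cong ((f x + g x) +_) (∑-+ xs f g)) (interchange (f x) (g x) (∑ xs f) (∑ xs g))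

  ∑-*ˡ : ∀ (xs : List A) k (f : A → ℕ) → ∑ xs (λ x → k * f x) ≡ k * ∑ xs f
  ∑-*ˡ []       k f = sym (*-zeroʳ k)
  ∑-*ˡ (x ∷ xs) k f = trans (cong (k * f x +_) (∑-*ˡ xs k f)) (sym (*-distribˡ-+ k (f x) (∑ xs f)))

  ∑-*ʳ : ∀ (xs : List A) k (f : A → ℕ) → ∑ xs (λ x → f x * k) ≡ ∑ xs f * k
  ∑-*ʳ xs k f = trans (∑-cong xs (λ x → *-comm (f x) k)) (trans (∑-*ˡ xs k f) (*-comm k _))

  ∑-0 : ∀ (xs : List A) → ∑ xs (λ _ → 0) ≡ 0
  ∑-0 []       = refl
  ∑-0 (_ ∷ xs) = ∑-0 xs

  ∑-swap : ∀ (xs : List A) (ys : List B) (f : A → B → ℕ) →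
           ∑ xs (λ x → ∑ ys (f x)) ≡ ∑ ys (λ y → ∑ xs (λ x → f x y))
  ∑-swap []       ys f = sym (∑-0 ys)
  ∑-swap (x ∷ xs) ys f = trans (cong (∑ ys (f x) +_) (∑-swap xs ys f)) (sym (∑-+ ys (f x) _))

  ∑-++ : ∀ (xs ys : List A) f → ∑ (xs ++ ys) f ≡ ∑ xs f + ∑ ys f
  ∑-++ []       ys f = refl
  ∑-++ (x ∷ xs) ys f = trans (cong (f x +_) (∑-++ xs ys f)) (sym (+-assoc (f x) _ _))

  ∑-map : ∀ (g : A → B) xs f → ∑ (map g xs) f ≡ ∑ xs (f ∘ g)
  ∑-map g []       f = refl
  ∑-map g (x ∷ xs) f = cong (f (g x) +_) (∑-map g xs f)

  pairWith : (A → B → C) → List A → List B → List C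
  pairWith g xs ys = concatMap (λ x → map (g x) ys) xs

  ∑-pairWith : ∀ (g : A → B → C) xs ys f → ∑ (pairWith g xs ys) f ≡ ∑ xs (λ x → ∑ ys (λ y → f (g x y)))
  ∑-pairWith g []       ys f = refl
  ∑-pairWith g (x ∷ xs) ys f =
    trans (∑-++ (map (g x) ys) _ f) (cong₂ _+_ (∑-map (g x) ys f) (∑-pairWith g xs ys f))

  ∑-nonzero : ∀ (xs : List A) f → ∑ xs f ≢ 0 → ∃ λ x → f x ≢ 0
  ∑-nonzero []       f h = contradiction refl h
  ∑-nonzero (x ∷ xs) f h with f x in eq
  ... | zero  = ∑-nonzero xs f h
  ... | suc k = x , λ e → 0≢1+n (trans (sym e) eq)

  -- The field and its vectors are setoids, with equality of vectors pointwise. Multiplicity one is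
  -- stated as a sum of indicators because this is the form in which `∑-⟦≟⟧*` evaluates a sum
  -- against a point mass.
  record FinSet a ℓ : Set (lsuc (a Level.⊔ ℓ)) where
    field
      decSetoid : DecSetoid a ℓ
    open DecSetoid decSetoid public
      renaming (refl to ≈-refl; sym to ≈-sym; trans to ≈-trans; reflexive to ≈-reflexive)
    field
      list : List Carrier
      -- list is complete and has no duplicates
      once : ∀ y → ∑ list (λ x → ⟦ x ≟ y ⟧) ≡ 1

    count : {P : Carrier → Set p} → (∀ x → Dec (P x)) → ℕ
    count P? = ∑ list (λ x → ⟦ P? x ⟧)

    card : ℕ
    card = ∑ list (λ _ → 1)

    ∑-⟦≟⟧* : ∀ {f : Carrier → ℕ} → (∀ {x y} → x ≈ y → f x ≡ f y) → ∀ y → ∑ list (λ x → ⟦ x ≟ y ⟧ * f x) ≡ f y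
    ∑-⟦≟⟧* {f} resp y = begin
      ∑ list (λ x → ⟦ x ≟ y ⟧ * f x) ≡⟨ ∑-cong list at ⟩
      ∑ list (λ x → ⟦ x ≟ y ⟧ * f y) ≡⟨ ∑-*ʳ list (f y) _ ⟩
      ∑ list (λ x → ⟦ x ≟ y ⟧) * f y ≡⟨ cong (_* f y) (once y) ⟩
      1 * f y                        ≡⟨ *-identityˡ (f y) ⟩
      f y                            ∎
      where
      open ≡-Reasoning
      at : ∀ x → ⟦ x ≟ y ⟧ * f x ≡ ⟦ x ≟ y ⟧ * f y
      at x with x ≟ y
      ... | yes e = cong (1 *_) (resp e)
      ... | no _  = refl

    ≤-∑ : ∀ {f : Carrier → ℕ} → (∀ {x y} → x ≈ y → f x ≡ f y) → ∀ y → f y ≤ ∑ list f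
    ≤-∑ {f} resp y = ≤-trans (≤-reflexive (sym (∑-⟦≟⟧* resp y))) (∑-mono list at)
      where
      at : ∀ x → ⟦ x ≟ y ⟧ * f x ≤ f x
      at x with x ≟ y
      ... | yes _ = ≤-reflexive (*-identityˡ (f x))
      ... | no _  = z≤n

    ∑-card : ∀ k → ∑ list (λ _ → k) ≡ card * k
    ∑-card k = trans (∑-cong list (λ _ → sym (*-identityˡ k))) (∑-*ʳ list k (λ _ → 1))

    count+count¬ : {P : Carrier → Set p} (P? : ∀ x → Dec (P x)) → count P? + count (¬? ∘ P?) ≡ card
    count+count¬ P? = trans (sym (∑-+ list _ _)) (∑-cong list (λ x → ⟦⟧+⟦¬⟧ (P? x)))

    count≡0⇒¬ : {P : Carrier → Set p} (P? : ∀ x → Dec (P x)) → (∀ {x y} → x ≈ y → P x → P y) →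
                count P? ≡ 0 → ∀ x → ¬ P x
    count≡0⇒¬ P? resp c≡0 x px = 1+n≰n (begin
      1        ≡⟨ sym (⟦⟧-yes (P? x) px) ⟩
      ⟦ P? x ⟧ ≤⟨ ≤-∑ (λ e → ⟦⟧-cong (P? _) (P? _) (resp e) (resp (≈-sym e))) x ⟩
      count P? ≡⟨ c≡0 ⟩
      0        ∎)
      where open ≤-Reasoning

    count≢0⇒∃ : {P : Carrier → Set p} (P? : ∀ x → Dec (P x)) → count P? ≢ 0 → ∃ P
    count≢0⇒∃ P? h with x , e ← ∑-nonzero list _ h = x , ⟦⟧-inv (P? x) e

    search : {P : Carrier → Set p} (P? : ∀ x → Dec (P x)) → (∀ {x y} → x ≈ y → P x → P y) →
             ∃ P ⊎ (∀ x → ¬ P x)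
    search P? resp with count P? in eq
    ... | zero  = inj₂ (count≡0⇒¬ P? resp eq)
    ... | suc _ = inj₁ (count≢0⇒∃ P? (λ e → 0≢1+n (trans (sym e) eq)))

    count-unique≤1 : {P : Carrier → Set p} (P? : ∀ x → Dec (P x)) → (∀ {x y} → P x → P y → x ≈ y) → count P? ≤ 1
    count-unique≤1 {P = P} P? uniq with count P? in eq
    ... | zero  = z≤n
    ... | suc _ with x₀ , px₀ ← count≢0⇒∃ P? (λ e → 0≢1+n (trans (sym e) eq)) =
      ≤-trans (≤-reflexive (sym eq))
        (≤-trans (∑-mono list (λ x → ⟦⟧-mono (P? x) (x ≟ x₀) (λ px → uniq px px₀)))
                 (≤-reflexive (once x₀)))

  module _ (X : FinSet a ℓ₁) (Y : FinSet b ℓ₂) where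
    private
      module X = FinSet X
      module Y = FinSet Y

    -- Double counting of related pairs: each x with `P` reaches some y with `Q`, and each y is
    -- reached from at most one such x. A relation in place of a function serves injections and
    -- surjections alike.
    count-rel≤ : ∀ {p q r} {P : X.Carrier → Set p} {Q : Y.Carrier → Set q} {R : X.Carrier → Y.Carrier → Set r}
      (P? : ∀ x → Dec (P x)) (Q? : ∀ y → Dec (Q y)) (R? : ∀ x y → Dec (R x y)) →
      (∀ {y y′} → y Y.≈ y′ → Q y → Q y′) → (∀ {x y y′} → y Y.≈ y′ → R x y → R x y′) →
      (∀ x → P x → ∃ λ y → Q y × R x y) →
      (∀ {x x′ y} → P x → P x′ → R x y → R x′ y → x X.≈ x′) →
      X.count P? ≤ Y.count Q?
    count-rel≤ {P = P} {Q} {R} P? Q? R? Q-resp R-resp total uniq = begin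
      X.count P?                                                      ≤⟨ ∑-mono X.list reach ⟩
      ∑ X.list (λ x → ∑ Y.list (λ y → ⟦ Q? y ×-dec (P? x ×-dec R? x y) ⟧)) ≡⟨ ∑-swap X.list Y.list _ ⟩
      ∑ Y.list (λ y → ∑ X.list (λ x → ⟦ Q? y ×-dec (P? x ×-dec R? x y) ⟧)) ≤⟨ ∑-mono Y.list fibre ⟩
      Y.count Q?                                                      ∎
      where
      open ≤-Reasoning
      reach : ∀ x → ⟦ P? x ⟧ ≤ ∑ Y.list (λ y → ⟦ Q? y ×-dec (P? x ×-dec R? x y) ⟧)
      reach x with P? x
      ... | no _   = z≤n
      ... | yes px with y , qy , rxy ← total x px =
        ≤-trans (≤-reflexive (sym (⟦⟧-yes (Q? y ×-dec (yes px ×-dec R? x y)) (qy , px , rxy))))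
          (Y.≤-∑ (λ {u} {v} e → ⟦⟧-cong (Q? u ×-dec (yes px ×-dec R? x u)) (Q? v ×-dec (yes px ×-dec R? x v))
                   (λ (c , d , f) → Q-resp e c , d , R-resp e f)
                   (λ (c , d , f) → Q-resp (Y.≈-sym e) c , d , R-resp (Y.≈-sym e) f)) y)
      fibre : ∀ y → ∑ X.list (λ x → ⟦ Q? y ×-dec (P? x ×-dec R? x y) ⟧) ≤ ⟦ Q? y ⟧
      fibre y with Q? y
      ... | yes qy = X.count-unique≤1 (λ x → yes qy ×-dec (P? x ×-dec R? x y))
                       (λ (_ , px , rx) (_ , px′ , rx′) → uniq px px′ rx rx′)
      ... | no ¬qy = ≤-reflexive (trans (∑-cong X.list (λ x → ⟦⟧-no (no ¬qy ×-dec (P? x ×-dec R? x y)) (¬qy ∘ proj₁))) (∑-0 X.list))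

    count-inj≤ : ∀ {p q} {P : X.Carrier → Set p} {Q : Y.Carrier → Set q}
      (P? : ∀ x → Dec (P x)) (Q? : ∀ y → Dec (Q y)) (φ : X.Carrier → Y.Carrier) →
      (∀ {y y′} → y Y.≈ y′ → Q y → Q y′) → (∀ x → P x → Q (φ x)) →
      (∀ {x x′} → P x → P x′ → φ x Y.≈ φ x′ → x X.≈ x′) →
      X.count P? ≤ Y.count Q?
    count-inj≤ P? Q? φ Q-resp maps inj = count-rel≤ P? Q? (λ x y → φ x Y.≟ y) Q-resp
      (λ e f → Y.≈-trans f e) (λ x px → φ x , maps x px , Y.≈-refl)
      (λ px px′ e e′ → inj px px′ (Y.≈-trans e (Y.≈-sym e′)))

  module _ (X : FinSet a ℓ₁) where
    open FinSet X

    -- Pigeonhole: if y were missed, φ would inject everything into the complement of y, which has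
    -- one element less.
    injective⇒surjective : (φ : Carrier → Carrier) → (∀ {x y} → x ≈ y → φ x ≈ φ y) → (∀ {x y} → φ x ≈ φ y → x ≈ y) →
                           ∀ y → ∃ λ x → φ x ≈ y
    injective⇒surjective φ φ-cong inj y with search (λ x → φ x ≟ y) (λ e e′ → ≈-trans (φ-cong (≈-sym e)) e′)
    ... | inj₁ found  = found
    ... | inj₂ missed = contradiction all≤others
        (<⇒≱ (≤-reflexive (trans (cong (_+ count (¬? ∘ (_≟ y))) (sym (once y))) (count+count¬ (_≟ y)))))
      where
      all≤others : card ≤ count (¬? ∘ (_≟ y))
      all≤others = count-inj≤ X X {P = λ _ → ⊤ {0ℓ}} (λ _ → yes tt) (¬? ∘ (_≟ y)) φ
        (λ e ≉y e′ → ≉y (≈-trans e e′)) (λ x _ → missed x) (λ _ _ → inj)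

  module _ (X : FinSet a ℓ₁) (Y : FinSet b ℓ₂) where
    private
      module X = FinSet X
      module Y = FinSet Y

    -- The graph of φ is read from `Y` to `X`: one x cannot be related to two different y.
    count-surj≤ : ∀ {p q} {P : X.Carrier → Set p} {Q : Y.Carrier → Set q}
      (P? : ∀ x → Dec (P x)) (Q? : ∀ y → Dec (Q y)) (φ : X.Carrier → Y.Carrier) →
      (∀ {x x′} → x X.≈ x′ → P x → P x′) → (∀ {x x′} → x X.≈ x′ → φ x Y.≈ φ x′) →
      (∀ y → Q y → ∃ λ x → P x × φ x Y.≈ y) →
      Y.count Q? ≤ X.count P?
    count-surj≤ P? Q? φ P-resp φ-cong onto = count-rel≤ Y X Q? P? (λ y x → φ x Y.≟ y) P-resp
      (λ e f → Y.≈-trans (φ-cong (X.≈-sym e)) f) onto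
      (λ _ _ e e′ → Y.≈-trans (Y.≈-sym e) e′)

    _×ᶠ_ : FinSet (a Level.⊔ b) (ℓ₁ Level.⊔ ℓ₂)
    _×ᶠ_ = record
      { decSetoid = ×-decSetoid X.decSetoid Y.decSetoid
      ; list = pairWith _,_ X.list Y.list
      ; once = once′
      }
      where
      _≟ₚ_ = DecSetoid._≟_ (×-decSetoid X.decSetoid Y.decSetoid)
      once′ : ∀ y → ∑ (pairWith _,_ X.list Y.list) (λ x → ⟦ x ≟ₚ y ⟧) ≡ 1
      once′ (u , v) = begin
        ∑ (pairWith _,_ X.list Y.list) (λ x → ⟦ x ≟ₚ (u , v) ⟧)         ≡⟨ ∑-pairWith _,_ X.list Y.list _ ⟩
        ∑ X.list (λ x → ∑ Y.list (λ y → ⟦ (x , y) ≟ₚ (u , v) ⟧))        ≡⟨ ∑-cong X.list (λ x → ∑-cong Y.list (λ y →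
            trans (⟦⟧-cong ((x , y) ≟ₚ (u , v)) ((x X.≟ u) ×-dec (y Y.≟ v)) (λ e → e) (λ e → e)) (⟦⟧-× (x X.≟ u) (y Y.≟ v)))) ⟩
        ∑ X.list (λ x → ∑ Y.list (λ y → ⟦ x X.≟ u ⟧ * ⟦ y Y.≟ v ⟧))     ≡⟨ ∑-cong X.list (λ x → ∑-*ˡ Y.list ⟦ x X.≟ u ⟧ _) ⟩
        ∑ X.list (λ x → ⟦ x X.≟ u ⟧ * ∑ Y.list (λ y → ⟦ y Y.≟ v ⟧))     ≡⟨ ∑-*ʳ X.list _ _ ⟩
        ∑ X.list (λ x → ⟦ x X.≟ u ⟧) * ∑ Y.list (λ y → ⟦ y Y.≟ v ⟧)     ≡⟨ cong₂ _*_ (X.once u) (Y.once v) ⟩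
        1                                                               ∎
        where open ≡-Reasoning

  module _ (X : FinSet a ℓ₁) where
    private module X = FinSet X

    Pointwise : ∀ n → DecSetoid a ℓ₁
    Pointwise n = record
      { Carrier = Fin n → X.Carrier
      ; _≈_ = λ u v → ∀ i → u i X.≈ v i
      ; isDecEquivalence = record
        { isEquivalence = record
          { refl = λ i → X.≈-refl ; sym = λ e i → X.≈-sym (e i) ; trans = λ e f i → X.≈-trans (e i) (f i) }
        ; _≟_ = λ u v → Fin.all? (λ i → u i X.≟ v i) } }

    vectors : ∀ n → List (Fin n → X.Carrier)
    vectors zero    = ⟨⟩ ∷ []
    vectors (suc n) = pairWith _◂_ X.list (vectors n)

    vectors-once : ∀ n y → ∑ (vectors n) (λ x → ⟦ DecSetoid._≟_ (Pointwise n) x y ⟧) ≡ 1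
    vectors-once zero    y = cong (_+ 0) (⟦⟧-yes (DecSetoid._≟_ (Pointwise zero) ⟨⟩ y) (λ ()))
    vectors-once (suc n) y = begin
      ∑ (vectors (suc n)) (λ x → ⟦ x ≟ₛ y ⟧)                                    ≡⟨ ∑-pairWith _◂_ X.list (vectors n) _ ⟩
      ∑ X.list (λ x → ∑ (vectors n) (λ v → ⟦ (x ◂ v) ≟ₛ y ⟧))                   ≡⟨ ∑-cong X.list (λ x → ∑-cong (vectors n) (λ v → split x v)) ⟩
      ∑ X.list (λ x → ∑ (vectors n) (λ v → ⟦ x X.≟ y zero ⟧ * ⟦ v ≟ₙ tail y ⟧)) ≡⟨ ∑-cong X.list (λ x → ∑-*ˡ (vectors n) ⟦ x X.≟ y zero ⟧ _) ⟩
      ∑ X.list (λ x → ⟦ x X.≟ y zero ⟧ * ∑ (vectors n) (λ v → ⟦ v ≟ₙ tail y ⟧)) ≡⟨ ∑-*ʳ X.list _ _ ⟩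
      ∑ X.list (λ x → ⟦ x X.≟ y zero ⟧) * ∑ (vectors n) (λ v → ⟦ v ≟ₙ tail y ⟧) ≡⟨ cong₂ _*_ (X.once (y zero)) (vectors-once n (tail y)) ⟩
      1                                                                         ∎
      where
      open ≡-Reasoning
      _≟ₛ_ = DecSetoid._≟_ (Pointwise (suc n))
      _≟ₙ_ = DecSetoid._≟_ (Pointwise n)
      split : ∀ x v → ⟦ (x ◂ v) ≟ₛ y ⟧ ≡ ⟦ x X.≟ y zero ⟧ * ⟦ v ≟ₙ tail y ⟧
      split x v = trans
        (⟦⟧-cong ((x ◂ v) ≟ₛ y) ((x X.≟ y zero) ×-dec (v ≟ₙ tail y))
          (λ e → e zero , e ∘ suc) (λ { (e , f) zero → e ; (e , f) (suc i) → f i }))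
        (⟦⟧-× (x X.≟ y zero) (v ≟ₙ tail y))

    _^ᶠ_ : ℕ → FinSet a ℓ₁
    _^ᶠ_ n = record { decSetoid = Pointwise n ; list = vectors n ; once = vectors-once n }

    ∑-vectors-suc : ∀ n f → ∑ (vectors (suc n)) f ≡ ∑ X.list (λ x → ∑ (vectors n) (λ v → f (x ◂ v)))
    ∑-vectors-suc n f = ∑-pairWith _◂_ X.list (vectors n) f

    card-^ : ∀ n → FinSet.card (_^ᶠ_ n) ≡ X.card ^ n
    card-^ zero    = refl
    card-^ (suc n) = trans (∑-vectors-suc n _)
      (trans (X.∑-card (FinSet.card (_^ᶠ_ n))) (cong (X.card *_) (card-^ n)))

  fins : ∀ n → List (Fin n)
  fins zero    = []
  fins (suc n) = zero ∷ map suc (fins n)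

  Finᶠ : ℕ → FinSet 0ℓ 0ℓ
  Finᶠ n = record { decSetoid = Fin.≡-decSetoid n ; list = fins n ; once = once′ n }
    where
    once′ : ∀ n (j : Fin n) → ∑ (fins n) (λ i → ⟦ i Fin.≟ j ⟧) ≡ 1
    once′ (suc n) zero = cong suc (trans (∑-map suc (fins n) _)
      (trans (∑-cong (fins n) (λ i → ⟦⟧-no (suc i Fin.≟ zero) (λ ()))) (∑-0 (fins n))))
    once′ (suc n) (suc j) = trans (cong₂ _+_ (⟦⟧-no (zero Fin.≟ suc j) (λ ())) (∑-map suc (fins n) _))
      (trans (∑-cong (fins n) (λ i → ⟦⟧-cong (suc i Fin.≟ suc j) (i Fin.≟ j) Fin.suc-injective (cong suc))) (once′ n j))

  module _ (S : DecSetoid a ℓ₁) where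
    open DecSetoid S using (_≈_; _≟_) renaming (sym to ≈-sym; trans to ≈-trans)

    ∑-absent : ∀ {xs y} → All (λ x → ¬ (x ≈ y)) xs → ∑ xs (λ x → ⟦ x ≟ y ⟧) ≡ 0
    ∑-absent []       = refl
    ∑-absent (h ∷ hs) = cong₂ _+_ (⟦⟧-no (_ ≟ _) h) (∑-absent hs)

    ∑-once : ∀ {xs} → AllPairs (λ x y → ¬ (x ≈ y)) xs → ∀ {y} → Any (y ≈_) xs → ∑ xs (λ x → ⟦ x ≟ y ⟧) ≡ 1
    ∑-once (h ∷ hs) {y} (here e) =
      cong₂ _+_ (⟦⟧-yes (_ ≟ y) (≈-sym e)) (∑-absent (All.map (λ x≉z z≈y → x≉z (≈-trans (≈-sym e) (≈-sym z≈y))) h))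
    ∑-once {x ∷ xs} (h ∷ hs) {y} (there e) = cong₂ _+_ (⟦⟧-no (x ≟ y) (apart h e)) (∑-once hs e)
      where
      apart : ∀ {zs} → All (λ z → ¬ (x ≈ z)) zs → Any (y ≈_) zs → ¬ (x ≈ y)
      apart (x≉z ∷ _) (here y≈z) x≈y = x≉z (≈-trans x≈y y≈z)
      apart (_ ∷ hs)  (there e)  x≈y = apart hs e x≈y

open Counting
open ℕ.+-*-Solver using () renaming (solve to solveℕ; _:=_ to _:=ℕ_; _:+_ to _:+ℕ_; _:*_ to _:*ℕ_)

module Codes {c ℓ′} (𝔽 : FiniteField c ℓ′) where

  open FiniteField 𝔽 using
    ( Carrier; _≈_; _+_; _*_; -_; 0#; 1#; _≟_; 0≉1; inverse; q; setoid; refl; sym; trans; reflexive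
    ; +-cong; *-cong; +-congˡ; +-congʳ; *-congˡ; *-congʳ; -‿cong; +-identityˡ; +-identityʳ; *-identityˡ; *-identityʳ
    ; +-assoc; +-comm; *-assoc; *-comm; distribˡ; distribʳ; zeroˡ; zeroʳ; -‿inverseˡ; -‿inverseʳ
    ; ring; commutativeSemiring)
  open import Algebra.Properties.Ring ring using (-‿distribˡ-*; -‿distribʳ-*; -0#≈0#; -‿involutive; -‿+-comm)
  open import Algebra.Solver.Ring.NaturalCoefficients.Default commutativeSemiring using (solve; _:=_; _:+_; _:*_)
  import Relation.Binary.Reasoning.Setoid setoid as ≈-Reasoning

  -- Linear algebra over 𝔽

  Σ : ∀ n → (Fin n → Carrier) → Carrier
  Σ = sumF 𝔽

  V : ℕ → Set c
  V n = Fin n → Carrier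

  infix 4 _≋_
  _≋_ : ∀ {n} → V n → V n → Set ℓ′
  u ≋ v = ∀ j → u j ≈ v j

  Mat : ℕ → ℕ → Set c
  Mat = Matrix 𝔽

  Σ-cong : ∀ n {f g : V n} → f ≋ g → Σ n f ≈ Σ n g
  Σ-cong zero    h = refl
  Σ-cong (suc n) h = +-cong (h zero) (Σ-cong n (h ∘ suc))

  Σ-0 : ∀ n → Σ n (λ _ → 0#) ≈ 0#
  Σ-0 zero    = refl
  Σ-0 (suc n) = trans (+-identityˡ _) (Σ-0 n)

  Σ-≈0 : ∀ n {f : V n} → (∀ i → f i ≈ 0#) → Σ n f ≈ 0#
  Σ-≈0 n h = trans (Σ-cong n h) (Σ-0 n)

  Σ-+ : ∀ n (f g : V n) → Σ n (λ i → f i + g i) ≈ Σ n f + Σ n g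
  Σ-+ zero    f g = sym (+-identityˡ 0#)
  Σ-+ (suc n) f g = trans (+-congˡ (Σ-+ n (f ∘ suc) (g ∘ suc)))
    (solve 4 (λ a b x y → (a :+ b) :+ (x :+ y) := (a :+ x) :+ (b :+ y)) refl _ _ _ _)

  Σ-*ˡ : ∀ n a (f : V n) → Σ n (λ i → a * f i) ≈ a * Σ n f
  Σ-*ˡ zero    a f = sym (zeroʳ a)
  Σ-*ˡ (suc n) a f = trans (+-congˡ (Σ-*ˡ n a (f ∘ suc))) (sym (distribˡ a _ _))

  Σ-*ʳ : ∀ n (f : V n) a → Σ n (λ i → f i * a) ≈ Σ n f * a
  Σ-*ʳ n f a = trans (Σ-cong n (λ i → *-comm (f i) a)) (trans (Σ-*ˡ n a f) (*-comm a _))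

  Σ-lin : ∀ n a b (f g : V n) → Σ n (λ i → a * f i + b * g i) ≈ a * Σ n f + b * Σ n g
  Σ-lin n a b f g = trans (Σ-+ n _ _) (+-cong (Σ-*ˡ n a f) (Σ-*ˡ n b g))

  Σ-swap : ∀ m n (f : Fin m → Fin n → Carrier) → Σ m (λ i → Σ n (f i)) ≈ Σ n (λ j → Σ m (λ i → f i j))
  Σ-swap zero    n f = sym (Σ-0 n)
  Σ-swap (suc m) n f = trans (+-congˡ (Σ-swap m n (f ∘ suc))) (sym (Σ-+ n (f zero) _))

  Σ-single : ∀ n (f : V n) k → (∀ i → i ≢ k → f i ≈ 0#) → Σ n f ≈ f k
  Σ-single (suc n) f zero    h = trans (+-congˡ (Σ-≈0 n (λ i → h (suc i) λ ()))) (+-identityʳ _)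
  Σ-single (suc n) f (suc k) h = trans (+-congʳ (h zero λ ()))
    (trans (+-identityˡ _) (Σ-single n (f ∘ suc) k (λ i i≢k → h (suc i) (i≢k ∘ Fin.suc-injective))))

  e : ∀ {n} → Fin n → V n
  e i j with i Fin.≟ j
  ... | yes _ = 1#
  ... | no _  = 0#

  e-same : ∀ {n} {i : Fin n} j → i ≡ j → e i j ≈ 1#
  e-same {i = i} j i≡j with i Fin.≟ j
  ... | yes _   = refl
  ... | no i≢j = contradiction i≡j i≢j

  e-diff : ∀ {n} {i j : Fin n} → i ≢ j → e i j ≈ 0#
  e-diff {i = i} {j} i≢j with i Fin.≟ j
  ... | yes i≡j = contradiction i≡j i≢j
  ... | no _    = refl

  e-expand : ∀ {n} (v : V n) j → Σ n (λ i → v i * e i j) ≈ v j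
  e-expand {n} v j = trans (Σ-single n _ j (λ i i≢j → trans (*-congˡ (e-diff i≢j)) (zeroʳ _)))
    (trans (*-congˡ (e-same j ≡.refl)) (*-identityʳ _))

  e-pick : ∀ {n} (v : V n) i → Σ n (λ j → e i j * v j) ≈ v i
  e-pick {n} v i = trans (Σ-single n _ i (λ j j≢i → trans (*-congʳ (e-diff (j≢i ∘ ≡.sym))) (zeroˡ _)))
    (trans (*-congʳ (e-same i ≡.refl)) (*-identityˡ _))

  e-indep : ∀ {n} → LinIndep 𝔽 (e {n})
  e-indep λc h k = trans (sym (e-expand λc k)) (h k)

  *-≈0 : ∀ {x y} → ¬ (x ≈ 0#) → x * y ≈ 0# → y ≈ 0#
  *-≈0 {x} {y} x≉0 xy≈0 with x⁻¹ , xx⁻¹≈1 ← inverse x x≉0 = begin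
    y             ≈⟨ sym (*-identityˡ y) ⟩
    1# * y        ≈⟨ *-congʳ (sym xx⁻¹≈1) ⟩
    (x * x⁻¹) * y ≈⟨ solve 3 (λ x i y → (x :* i) :* y := i :* (x :* y)) refl x x⁻¹ y ⟩
    x⁻¹ * (x * y) ≈⟨ *-congˡ xy≈0 ⟩
    x⁻¹ * 0#      ≈⟨ zeroʳ x⁻¹ ⟩
    0#            ∎
    where open ≈-Reasoning

  +-≈0 : ∀ {x y} → x + y ≈ 0# → y ≈ 0# → x ≈ 0#
  +-≈0 {x} {y} h y≈0 = trans (sym (+-identityʳ x)) (trans (+-congˡ (sym y≈0)) h)

  infixl 7 _⊡_
  _⊡_ : ∀ {r s n} → Mat r s → Mat s n → Mat r n
  _⊡_ {s = s} A R i j = Σ s (λ k → A i k * R k j)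

  ⊡-cong : ∀ {r s n} {A A′ : Mat r s} (R : Mat s n) → (∀ i → A i ≋ A′ i) → ∀ i → (A ⊡ R) i ≋ (A′ ⊡ R) i
  ⊡-cong {s = s} R h i j = Σ-cong s (λ k → *-congʳ (h i k))

  ⊡-row : ∀ {r s n} (x : V r) (A : Mat r s) (R : Mat s n) j →
          Σ r (λ i → x i * (A ⊡ R) i j) ≈ Σ s (λ k → Σ r (λ i → x i * A i k) * R k j)
  ⊡-row {r} {s} x A R j = begin
    Σ r (λ i → x i * Σ s (λ k → A i k * R k j))   ≈⟨ Σ-cong r (λ i → sym (Σ-*ˡ s (x i) _)) ⟩
    Σ r (λ i → Σ s (λ k → x i * (A i k * R k j))) ≈⟨ Σ-swap r s _ ⟩
    Σ s (λ k → Σ r (λ i → x i * (A i k * R k j))) ≈⟨ Σ-cong s (λ k → Σ-cong r (λ i → sym (*-assoc _ _ _))) ⟩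
    Σ s (λ k → Σ r (λ i → x i * A i k * R k j))   ≈⟨ Σ-cong s (λ k → Σ-*ʳ r _ _) ⟩
    Σ s (λ k → Σ r (λ i → x i * A i k) * R k j)   ∎
    where open ≈-Reasoning

  ⊡-indep : ∀ {r s n} (A : Mat r s) (R : Mat s n) → LinIndep 𝔽 A → LinIndep 𝔽 R → LinIndep 𝔽 (A ⊡ R)
  ⊡-indep A R hA hR x h = hA x (hR _ (λ j → trans (sym (⊡-row x A R j)) (h j)))

  -- If `x zero` is invertible, the other coordinates are free and the equation is solved for the
  -- first one. Otherwise the first basis vector is itself a solution and the rest is left to the
  -- recursion.
  kernel₁ : ∀ {t} (x : V (suc t)) → ∃ λ (C : Mat t (suc t)) → LinIndep 𝔽 C × (∀ i → Σ (suc t) (λ k → C i k * x k) ≈ 0#)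
  kernel₁ {t} x with x zero ≟ 0#
  kernel₁ {t} x | no x₀≉0 with y , xy≈1 ← inverse (x zero) x₀≉0 = C , indep , ann
    where
    open ≈-Reasoning
    C : Mat t (suc t)
    C i = (- (x (suc i) * y)) ◂ e i
    indep : LinIndep 𝔽 C
    indep λc h = e-indep λc (h ∘ suc)
    ann : ∀ i → Σ (suc t) (λ k → C i k * x k) ≈ 0#
    ann i = begin
      - (x (suc i) * y) * x zero + Σ t (λ k → e i k * x (suc k)) ≈⟨ +-cong (sym (-‿distribˡ-* _ _)) (e-pick (x ∘ suc) i) ⟩
      - (x (suc i) * y * x zero) + x (suc i)                     ≈⟨ +-congʳ (-‿cong (trans (solve 3 (λ a y z → (a :* y) :* z := a :* (z :* y)) refl _ _ _) (trans (*-congˡ xy≈1) (*-identityʳ _)))) ⟩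
      - x (suc i) + x (suc i)                                    ≈⟨ -‿inverseˡ _ ⟩
      0#                                                         ∎
  kernel₁ {zero} x | yes x₀≈0 = (λ ()) , (λ _ _ ()) , λ ()
  kernel₁ {suc t} x | yes x₀≈0 with C , indepC , annC ← kernel₁ (x ∘ suc) = D , indep , ann
    where
    open ≈-Reasoning
    D : Mat (suc t) (suc (suc t))
    D zero    = 1# ◂ (λ _ → 0#)
    D (suc i) = 0# ◂ C i
    indep : LinIndep 𝔽 D
    indep λc h zero = begin
      λc zero                                      ≈⟨ sym (*-identityʳ _) ⟩
      λc zero * 1#                                 ≈⟨ sym (+-identityʳ _) ⟩
      λc zero * 1# + 0#                            ≈⟨ +-congˡ (sym (Σ-≈0 t (λ _ → zeroʳ _))) ⟩
      λc zero * 1# + Σ t (λ k → λc (suc k) * 0#)  ≈⟨ h zero ⟩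
      0#                                           ∎
    indep λc h (suc k) = indepC (λc ∘ suc) (λ j → trans (sym (trans (+-congʳ (zeroʳ _)) (+-identityˡ _))) (h (suc j))) k
    ann : ∀ i → Σ (suc (suc t)) (λ k → D i k * x k) ≈ 0#
    ann zero    = trans (+-cong (trans (*-identityˡ _) x₀≈0) (Σ-≈0 (suc t) (λ k → zeroˡ (x (suc k))))) (+-identityˡ _)
    ann (suc i) = trans (+-cong (zeroˡ _) (annC i)) (+-identityˡ _)

  -- Conditions are imposed one at a time: the rows of `D` solve the first, and the others are
  -- rewritten in coordinates with respect to `D`.
  kernel : ∀ s {t n} (X : Mat s n) → n ≡ s ℕ.+ t →
           ∃ λ (C : Mat t n) → LinIndep 𝔽 C × (∀ i j → Σ n (λ k → C i k * X j k) ≈ 0#)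
  kernel zero    X ≡.refl = e , e-indep , λ i ()
  kernel (suc s) {t} {n} X ≡.refl
    with D , indepD , annD ← kernel₁ (X zero)
    with C , indepC , annC ← kernel s {t} (λ j i → Σ n (λ k → D i k * X (suc j) k)) ≡.refl
    = C ⊡ D , ⊡-indep C D indepC indepD , ann
    where
    through : ∀ i (x : V n) → Σ n (λ k → (C ⊡ D) i k * x k) ≈ Σ (s ℕ.+ t) (λ l → C i l * Σ n (λ k → D l k * x k))
    through i x = sym (⊡-row (C i) D (λ k (_ : Fin 1) → x k) zero)
    ann : ∀ i j → Σ n (λ k → (C ⊡ D) i k * X j k) ≈ 0#
    ann i zero    = trans (through i (X zero)) (Σ-≈0 _ (λ l → trans (*-congˡ (annD l)) (zeroʳ _)))
    ann i (suc j) = trans (through i (X (suc j))) (annC i j)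

  fieldᶠ : FinSet c ℓ′
  fieldᶠ = record
    { decSetoid = S
    ; list = FiniteField.elements 𝔽
    ; once = λ y → ∑-once S (FiniteField.distinct 𝔽) (FiniteField.complete 𝔽 y)
    }
    where
    S : DecSetoid c ℓ′
    S = record { isDecEquivalence = record { isEquivalence = FiniteField.isEquivalence 𝔽 ; _≟_ = _≟_ } }

  card-field : FinSet.card fieldᶠ ≡ q
  card-field = length-∑ (FiniteField.elements 𝔽)
    where
    length-∑ : ∀ {a} {A : Set a} (xs : List A) → ∑ xs (λ _ → 1) ≡ length xs
    length-∑ []       = ≡.refl
    length-∑ (_ ∷ xs) = ≡.cong suc (length-∑ xs)

  Vᶠ : ℕ → FinSet c ℓ′
  Vᶠ n = fieldᶠ ^ᶠ n

  Matᶠ : ℕ → ℕ → FinSet c ℓ′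
  Matᶠ k n = Vᶠ n ^ᶠ k

  card-V : ∀ n → FinSet.card (Vᶠ n) ≡ q ℕ.^ n
  card-V n = ≡.trans (card-^ fieldᶠ n) (≡.cong (ℕ._^ n) card-field)

  1<q : 1 ℕ.< q
  1<q with FiniteField.elements 𝔽 | FiniteField.complete 𝔽 0# | FiniteField.complete 𝔽 1#
  ... | x ∷ [] | here 0≈x | here 1≈x = contradiction (trans 0≈x (sym 1≈x)) 0≉1
  ... | x ∷ [] | there () | _
  ... | x ∷ [] | here _ | there ()
  ... | x ∷ y ∷ xs | _ | _ = ℕ.s≤s (ℕ.s≤s ℕ.z≤n)

  -- Alternating forms and determinants

  -- Linearity in row i is a relation between three matrices that agree off row i, so that no
  -- particular way of replacing a row enters and rows need only agree pointwise.
  record Form (k n : ℕ) : Set (c Level.⊔ ℓ′) where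
    field
      fun  : Mat k n → Carrier
      cong : ∀ {M N} → (∀ i → M i ≋ N i) → fun M ≈ fun N
      linear : ∀ i a b {M P Q} → (Q i ≋ λ j → a * M i j + b * P i j) →
               (∀ r → r ≢ i → Q r ≋ M r × Q r ≋ P r) → fun Q ≈ a * fun M + b * fun P
      alternating : ∀ {i j M} → i ≢ j → M i ≋ M j → fun M ≈ 0#

  open Form

  _[_≔_] : ∀ {k n} → Mat k n → Fin k → V n → Mat k n
  (M [ i ≔ v ]) r with r Fin.≟ i
  ... | yes _ = v
  ... | no _  = M r

  ≔-same : ∀ {k n} (M : Mat k n) i v → (M [ i ≔ v ]) i ≋ v
  ≔-same M i v j with i Fin.≟ i
  ... | yes _  = refl
  ... | no i≢i = contradiction ≡.refl i≢i

  ≔-other : ∀ {k n} (M : Mat k n) {i r} v → r ≢ i → (M [ i ≔ v ]) r ≋ M r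
  ≔-other M {i} {r} v r≢i j with r Fin.≟ i
  ... | yes r≡i = contradiction r≡i r≢i
  ... | no _    = refl

  1*+1* : ∀ x y → x + y ≈ 1# * x + 1# * y
  1*+1* x y = sym (+-cong (*-identityˡ x) (*-identityˡ y))

  ≈0⇒lin≈0 : ∀ {a b x y} → x ≈ 0# → y ≈ 0# → a * x + b * y ≈ 0#
  ≈0⇒lin≈0 x≈0 y≈0 = trans (+-cong (trans (*-congˡ x≈0) (zeroʳ _)) (trans (*-congˡ y≈0) (zeroʳ _))) (+-identityˡ 0#)

  ◂-η : ∀ {k n} (M : Mat (suc k) n) i → M i ≋ (M zero ◂ tail M) i
  ◂-η M zero    j = refl
  ◂-η M (suc i) j = refl

  ◂-cong : ∀ {k n} {u v : V n} {M N : Mat k n} → u ≋ v → (∀ i → M i ≋ N i) → ∀ i → (u ◂ M) i ≋ (v ◂ N) i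
  ◂-cong h hs zero    = h
  ◂-cong h hs (suc i) = hs i

  module _ {k n} (g : Form k n) where

    zero-row : ∀ i {M} → (∀ j → M i j ≈ 0#) → fun g M ≈ 0#
    zero-row i {M} h = trans
      (linear g i 0# 0# (λ j → trans (h j) (sym (trans (+-cong (zeroˡ _) (zeroˡ _)) (+-identityˡ 0#)))) (λ _ _ → (λ _ → refl) , (λ _ → refl)))
      (trans (+-cong (zeroˡ _) (zeroˡ _)) (+-identityˡ 0#))

    Σ-linear : ∀ i s (a : V s) (M : Fin s → Mat k n) {Q} → (Q i ≋ λ j → Σ s (λ t → a t * M t i j)) →
               (∀ t r → r ≢ i → Q r ≋ M t r) → fun g Q ≈ Σ s (λ t → a t * fun g (M t))
    Σ-linear i zero    a M     h hs = zero-row i h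
    Σ-linear i (suc s) a M {Q} h hs = trans
      (linear g i (a zero) 1# {M zero} {Q′}
        (λ j → trans (h j) (+-congˡ (sym (trans (*-identityˡ _) (≔-same Q i _ j)))))
        (λ r r≢i → hs zero r r≢i , λ j → sym (≔-other Q _ r≢i j)))
      (+-congˡ (trans (*-identityˡ _)
        (Σ-linear i s (a ∘ suc) (M ∘ suc) (≔-same Q i _) (λ t r r≢i j → trans (≔-other Q _ r≢i j) (hs (suc t) r r≢i j)))))
      where Q′ = Q [ i ≔ (λ j → Σ s (λ t → a (suc t) * M (suc t) i j)) ]

    -- After expansion of row i, every summand other than the i-th repeats a row of `M`, and the
    -- i-th restores `M`.
    cramer : ∀ (b : V k) M i → fun g (M [ i ≔ (λ j → Σ k (λ r → b r * M r j)) ]) ≈ b i * fun g M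
    cramer b M i = trans
      (Σ-linear i k b (λ t → M [ i ≔ M t ])
        (λ j → trans (≔-same M i _ j) (Σ-cong k (λ t → *-congˡ (sym (≔-same M i (M t) j)))))
        (λ t r r≢i j → trans (≔-other M _ r≢i j) (sym (≔-other M _ r≢i j))))
      (trans (Σ-single k _ i repeated) (*-congˡ (cong g restore)))
      where
      repeated : ∀ t → t ≢ i → b t * fun g (M [ i ≔ M t ]) ≈ 0#
      repeated t t≢i = trans (*-congˡ (alternating g (t≢i ∘ ≡.sym)
        (λ j → trans (≔-same M i (M t) j) (sym (≔-other M (M t) t≢i j))))) (zeroʳ _)
      restore : ∀ r → (M [ i ≔ M i ]) r ≋ M r
      restore r j with r Fin.≟ i
      ... | yes r≡i = reflexive (≡.cong (λ s → M s j) (≡.sym r≡i))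
      ... | no _    = refl

    nonzero⇒indep : ∀ {M} → ¬ (fun g M ≈ 0#) → LinIndep 𝔽 M
    nonzero⇒indep {M} gM≉0 b h i = *-≈0 gM≉0 (trans (*-comm _ _)
      (trans (sym (cramer b M i)) (zero-row i (λ j → trans (≔-same M i _ j) (h j)))))

  contract : ∀ {k n} → Form (suc k) n → V n → Form k n
  contract g v = record
    { fun = λ M → fun g (v ◂ M)
    ; cong = λ h → cong g (◂-cong (λ _ → refl) h)
    ; linear = λ i a b h hs → linear g (suc i) a b h
        λ { zero _ → (λ _ → refl) , (λ _ → refl) ; (suc r) r≢i → hs r (r≢i ∘ ≡.cong suc) }
    ; alternating = λ i≢j h → alternating g (i≢j ∘ Fin.suc-injective) h
    }

  linear₀ : ∀ {k n} (g : Form (suc k) n) a b u w N →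
            fun g ((λ j → a * u j + b * w j) ◂ N) ≈ a * fun g (u ◂ N) + b * fun g (w ◂ N)
  linear₀ g a b u w N = linear g zero a b (λ _ → refl)
    λ { zero r≢0 → contradiction ≡.refl r≢0 ; (suc r) _ → (λ _ → refl) , (λ _ → refl) }

  Σ-linear₀ : ∀ {k n} (g : Form (suc k) n) s (a : V s) (u : Mat s n) N →
              fun g ((λ j → Σ s (λ t → a t * u t j)) ◂ N) ≈ Σ s (λ t → a t * fun g (u t ◂ N))
  Σ-linear₀ g s a u N = Σ-linear g zero s a (λ t → u t ◂ N) (λ _ → refl)
    λ { t zero r≢0 → contradiction ≡.refl r≢0 ; t (suc r) _ _ → refl }

  -- Polarisation: the value with u + v in both arguments is zero.
  antisym₀₁ : ∀ {k n} (g : Form (suc (suc k)) n) u v N → fun g (u ◂ v ◂ N) + fun g (v ◂ u ◂ N) ≈ 0#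
  antisym₀₁ g u v N = begin
    g₂ u v + g₂ v u                                               ≈⟨ +-cong (sym (+-identityˡ _)) (sym (+-identityʳ _)) ⟩
    (0# + g₂ u v) + (g₂ v u + 0#)                                 ≈⟨ +-cong (+-congʳ (sym (same u))) (+-congˡ (sym (same v))) ⟩
    (g₂ u u + g₂ u v) + (g₂ v u + g₂ v v)                         ≈⟨ +-cong (1*+1* _ _) (1*+1* _ _) ⟩
    (1# * g₂ u u + 1# * g₂ u v) + (1# * g₂ v u + 1# * g₂ v v)     ≈⟨ +-cong (sym (linear₀ (contract g u) 1# 1# u v N)) (sym (linear₀ (contract g v) 1# 1# u v N)) ⟩
    g₂ u w + g₂ v w                                               ≈⟨ 1*+1* _ _ ⟩
    1# * g₂ u w + 1# * g₂ v w                                     ≈⟨ sym (linear₀ g 1# 1# u v (w ◂ N)) ⟩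
    g₂ w w                                                        ≈⟨ same w ⟩
    0#                                                            ∎
    where
    open ≈-Reasoning
    w : V _
    w j = 1# * u j + 1# * v j
    g₂ : V _ → V _ → Carrier
    g₂ x y = fun g (x ◂ y ◂ N)
    same : ∀ x → g₂ x x ≈ 0#
    same x = alternating g {zero} {suc zero} (λ ()) (λ _ → refl)

  Rad : ∀ {k n} → Form (suc k) n → V n → Set (c Level.⊔ ℓ′)
  Rad g v = ∀ N → fun g (v ◂ N) ≈ 0#

  Rad-contract : ∀ {k n} (g : Form (suc (suc k)) n) {v} u → Rad g v → Rad (contract g u) v
  Rad-contract g {v} u h N = +-≈0 (antisym₀₁ g u v N) (h (u ◂ N))

  Rad-contract-self : ∀ {k n} (g : Form (suc (suc k)) n) v → Rad (contract g v) v
  Rad-contract-self g v N = alternating g {zero} {suc zero} (λ ()) (λ _ → refl)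

  -- `Rad` only tests the first argument. By antisymmetry v stays in the radical after contraction
  -- with the first row, so induction reaches every position.
  Rad⇒vanishes : ∀ {k n} (g : Form (suc k) n) {v} → Rad g v → ∀ i {M} → M i ≋ v → fun g M ≈ 0#
  Rad⇒vanishes g {v} h zero {M} e = trans (cong g (λ i j → trans (◂-η M i j) (◂-cong e (λ _ _ → refl) i j))) (h (tail M))
  Rad⇒vanishes {suc k} g h (suc i) {M} e =
    trans (cong g (◂-η M)) (Rad⇒vanishes (contract g (M zero)) (Rad-contract g (M zero) h) i e)

  Rad-linear : ∀ {k n} (g : Form (suc k) n) a b {u v} → Rad g u → Rad g v → Rad g (λ j → a * u j + b * v j)
  Rad-linear g a b hu hv N = trans (linear₀ g a b _ _ N) (≈0⇒lin≈0 (hu N) (hv N))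

  Rad-span : ∀ {k n} (g : Form (suc k) n) {s} (a : V s) {u : Mat s n} → (∀ i → Rad g (u i)) → Rad g (λ j → Σ s (λ t → a t * u t j))
  Rad-span g {s} a {u} h N = trans (Σ-linear₀ g s a u N) (Σ-≈0 s (λ t → trans (*-congˡ (h t N)) (zeroʳ _)))

  Rad-resp : ∀ {k n} (g : Form (suc k) n) {u v} → u ≋ v → Rad g u → Rad g v
  Rad-resp g e h N = trans (cong g (◂-cong (λ j → sym (e j)) (λ _ _ → refl))) (h N)

  -- The rows are changed one at a time, and the error term always has a row equal to v. The
  -- hypothesis asks for vanishing at every position because `Rad` is not defined for forms of
  -- degree 0, which occur when the determinant is contracted for elimination.
  add-multiples : ∀ {k n} (g : Form k n) {v} → (∀ i {M} → M i ≋ v → fun g M ≈ 0#) →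
                  ∀ (b : V k) M → fun g (λ r j → M r j + b r * v j) ≈ fun g M
  add-multiples {zero}  g     h b M = cong g λ ()
  add-multiples {suc k} g {v} h b M = begin
    fun g (λ r j → M r j + b r * v j)                               ≈⟨ linear g zero 1# (b zero) {M zero ◂ M′} {v ◂ M′}
                                                                         (λ j → +-congʳ (sym (*-identityˡ _)))
                                                                         (λ { zero r≢0 → contradiction ≡.refl r≢0 ; (suc r) _ → (λ _ → refl) , (λ _ → refl) }) ⟩
    1# * fun g (M zero ◂ M′) + b zero * fun g (v ◂ M′)              ≈⟨ +-cong (*-identityˡ _) (trans (*-congˡ (h zero (λ _ → refl))) (zeroʳ _)) ⟩
    fun g (M zero ◂ M′) + 0#                                        ≈⟨ +-identityʳ _ ⟩
    fun g (M zero ◂ M′)                                             ≈⟨ add-multiples (contract g (M zero)) (λ i e → h (suc i) e) (b ∘ suc) (tail M) ⟩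
    fun g (M zero ◂ tail M)                                         ≈⟨ cong g (λ i j → sym (◂-η M i j)) ⟩
    fun g M                                                         ∎
    where
    open ≈-Reasoning
    M′ : Mat k _
    M′ r j = M (suc r) j + b (suc r) * v j

  pullback : ∀ {k n n′} (L : V n → V n′) → (∀ {u v} → u ≋ v → L u ≋ L v) →
             (∀ a b u v → L (λ j → a * u j + b * v j) ≋ λ j → a * L u j + b * L v j) → Form k n′ → Form k n
  pullback L L-cong L-lin g = record
    { fun = λ M → fun g (λ r → L (M r))
    ; cong = λ h → cong g (λ i → L-cong (h i))
    ; linear = λ i a b h hs → linear g i a b (λ j → trans (L-cong h j) (L-lin a b _ _ j))
        (λ r r≢i → L-cong (proj₁ (hs r r≢i)) , L-cong (proj₂ (hs r r≢i)))
    ; alternating = λ i≢j h → alternating g i≢j (L-cong h)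
    }

  onColumns : ∀ {k n n′} → Form k n′ → (Fin n′ → Fin n) → Form k n
  onColumns g σ = pullback (_∘ σ) (_∘ σ) (λ _ _ _ _ _ → refl) g

  timesᴿ : ∀ {k s n} → Form k n → Mat s n → Form k s
  timesᴿ {s = s} g R = pullback (λ u j → Σ s (λ k → u k * R k j)) (λ h j → Σ-cong s (λ k → *-congʳ (h k)))
    (λ a b u v j → trans (Σ-cong s (λ k → trans (distribʳ _ _ _) (+-cong (*-assoc _ _ _) (*-assoc _ _ _)))) (Σ-lin s a b _ _)) g

  combination : ∀ {k n} s → V s → (Fin s → Form k n) → Form k n
  combination s a h = record
    { fun = λ M → Σ s (λ i → a i * fun (h i) M)
    ; cong = λ e → Σ-cong s (λ i → *-congˡ (cong (h i) e))
    ; linear = λ i x y e es → trans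
        (Σ-cong s (λ t → trans (*-congˡ (linear (h t) i x y e es))
          (solve 5 (λ z x y p q → z :* (x :* p :+ y :* q) := x :* (z :* p) :+ y :* (z :* q)) refl _ _ _ _ _)))
        (Σ-lin s x y _ _)
    ; alternating = λ i≢j e → Σ-≈0 s (λ t → trans (*-congˡ (alternating (h t) i≢j e)) (zeroʳ _))
    }

  sgn : ∀ {n} → Fin n → Carrier
  sgn j = altSign 𝔽 (toℕ j)

  minor : ∀ {n} → Mat (suc n) (suc n) → Fin (suc n) → Mat n n
  minor M j r s = M (suc r) (punchIn j s)

  laplace : ∀ {n} → Mat (suc n) (suc n) → V (suc n)
  laplace {n} M j = sgn j * (M zero j * det 𝔽 n (minor M j))

  det-cong : ∀ n {M N : Mat n n} → (∀ i → M i ≋ N i) → det 𝔽 n M ≈ det 𝔽 n N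
  det-cong zero    h = refl
  det-cong (suc n) h = Σ-cong (suc n) (λ j → *-congˡ {sgn j} (*-cong (h zero j) (det-cong n (λ r s → h (suc r) (punchIn j s)))))

  det-linear : ∀ n i a b {M P Q : Mat n n} → (Q i ≋ λ j → a * M i j + b * P i j) →
               (∀ r → r ≢ i → Q r ≋ M r × Q r ≋ P r) → det 𝔽 n Q ≈ a * det 𝔽 n M + b * det 𝔽 n P
  det-linear (suc n) zero a b {M} {P} {Q} h hs = trans (Σ-cong (suc n) term) (Σ-lin (suc n) a b (laplace M) (laplace P))
    where
    open ≈-Reasoning
    term : ∀ j → laplace Q j ≈ a * laplace M j + b * laplace P j
    term j = begin
      sgn j * (Q zero j * det 𝔽 n (minor Q j)) ≈⟨ *-congˡ (*-congʳ (h j)) ⟩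
      sgn j * ((a * M zero j + b * P zero j) * det 𝔽 n (minor Q j))
        ≈⟨ solve 6 (λ s a m b p d → s :* ((a :* m :+ b :* p) :* d) := a :* (s :* (m :* d)) :+ b :* (s :* (p :* d))) refl _ _ _ _ _ _ ⟩
      a * (sgn j * (M zero j * det 𝔽 n (minor Q j))) + b * (sgn j * (P zero j * det 𝔽 n (minor Q j)))
        ≈⟨ +-cong (*-congˡ (*-congˡ (*-congˡ (det-cong n (λ r s → proj₁ (hs (suc r) (λ ())) (punchIn j s))))))
                  (*-congˡ (*-congˡ (*-congˡ (det-cong n (λ r s → proj₂ (hs (suc r) (λ ())) (punchIn j s)))))) ⟩
      a * (sgn j * (M zero j * det 𝔽 n (minor M j))) + b * (sgn j * (P zero j * det 𝔽 n (minor P j))) ∎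
  det-linear (suc n) (suc i) a b {M} {P} {Q} h hs = trans (Σ-cong (suc n) term) (Σ-lin (suc n) a b (laplace M) (laplace P))
    where
    open ≈-Reasoning
    term : ∀ j → laplace Q j ≈ a * laplace M j + b * laplace P j
    term j = begin
      sgn j * (Q zero j * det 𝔽 n (minor Q j))
        ≈⟨ *-congˡ (*-congˡ (det-linear n i a b {minor M j} {minor P j} (λ s → h (punchIn j s))
             (λ r r≢i → (λ s → proj₁ (hs (suc r) (r≢i ∘ Fin.suc-injective)) (punchIn j s))
                      , (λ s → proj₂ (hs (suc r) (r≢i ∘ Fin.suc-injective)) (punchIn j s))))) ⟩
      sgn j * (Q zero j * (a * det 𝔽 n (minor M j) + b * det 𝔽 n (minor P j)))
        ≈⟨ solve 6 (λ s z a x b y → s :* (z :* (a :* x :+ b :* y)) := a :* (s :* (z :* x)) :+ b :* (s :* (z :* y))) refl _ _ _ _ _ _ ⟩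
      a * (sgn j * (Q zero j * det 𝔽 n (minor M j))) + b * (sgn j * (Q zero j * det 𝔽 n (minor P j)))
        ≈⟨ +-cong (*-congˡ (*-congˡ (*-congʳ (proj₁ (hs zero (λ ())) j)))) (*-congˡ (*-congˡ (*-congʳ (proj₂ (hs zero (λ ())) j)))) ⟩
      a * (sgn j * (M zero j * det 𝔽 n (minor M j))) + b * (sgn j * (P zero j * det 𝔽 n (minor P j))) ∎

  -x*-y≈x*y : ∀ x y → - x * - y ≈ x * y
  -x*-y≈x*y x y = trans (sym (-‿distribˡ-* x (- y))) (trans (-‿cong (sym (-‿distribʳ-* x y))) (-‿involutive _))

  Σ-neg : ∀ n (f : V n) → Σ n (λ i → - f i) ≈ - Σ n f
  Σ-neg zero    f = sym -0#≈0#
  Σ-neg (suc n) f = trans (+-congˡ (Σ-neg n (f ∘ suc))) (-‿+-comm _ _)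

  -- This is the Laplace expansion along two rows both equal to `x`, with `E τ` in the role of the
  -- minor of the remaining rows in the columns `τ`. The terms that use column zero cancel, zero
  -- chosen first against zero chosen second. What is left is the same kind of sum over the other
  -- columns.
  double-laplace≈0 : ∀ n (x : V (suc (suc n))) (E : (Fin n → Fin (suc (suc n))) → Carrier) →
    (∀ {τ τ′} → (∀ s → τ s ≡ τ′ s) → E τ ≈ E τ′) →
    Σ (suc (suc n)) (λ a → sgn a * (x a * Σ (suc n) (λ b → sgn b * (x (punchIn a b) * E (λ s → punchIn a (punchIn b s)))))) ≈ 0#
  double-laplace≈0 n x E E-cong = begin
    1# * (x zero * S) + Σ (suc n) (λ a → - sgn a * (x (suc a) * (1# * (x zero * E (λ s → suc (punchIn a s))) + Σ n (λ b → - sgn b * (x (suc (punchIn a b)) * E (λ s → punchIn (suc a) (punchIn (suc b) s)))))))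
      ≈⟨ +-cong (*-identityˡ _) (Σ-cong (suc n) split) ⟩
    x zero * S + Σ (suc n) (λ a → - (x zero * first a) + rest a) ≈⟨ +-congˡ (Σ-+ (suc n) (λ a → - (x zero * first a)) rest) ⟩
    x zero * S + (Σ (suc n) (λ a → - (x zero * first a)) + Σ (suc n) rest)
      ≈⟨ +-congˡ (+-cong (trans (Σ-neg (suc n) (λ a → x zero * first a)) (-‿cong (Σ-*ˡ (suc n) (x zero) first))) (rest≈0 n x E E-cong)) ⟩
    x zero * S + (- (x zero * S) + 0#) ≈⟨ +-congˡ (+-identityʳ _) ⟩
    x zero * S + - (x zero * S)        ≈⟨ -‿inverseʳ _ ⟩
    0# ∎
    where
    open ≈-Reasoning
    first : V (suc n)
    first b = sgn b * (x (suc b) * E (λ s → suc (punchIn b s)))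
    S = Σ (suc n) first
    restOf : ∀ n (x : V (suc (suc n))) (E : (Fin n → Fin (suc (suc n))) → Carrier) → V (suc n)
    restOf n x E a = sgn a * (x (suc a) * Σ n (λ b → sgn b * (x (suc (punchIn a b)) * E (λ s → punchIn (suc a) (punchIn (suc b) s)))))
    rest = restOf n x E
    rest≈0 : ∀ n x (E : (Fin n → Fin (suc (suc n))) → Carrier) → (∀ {τ τ′} → (∀ s → τ s ≡ τ′ s) → E τ ≈ E τ′) → Σ (suc n) (restOf n x E) ≈ 0#
    rest≈0 zero    x E E-cong = Σ-≈0 1 (λ a → trans (*-congˡ {sgn a} (zeroʳ (x (suc a)))) (zeroʳ (sgn a)))
    -- Column zero is not chosen in these terms, so it stays the first column of every complementary
    -- minor and is absorbed into the new `E`.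
    rest≈0 (suc n) x E E-cong = trans
      (Σ-cong (suc (suc n)) (λ a → *-congˡ {sgn a} (*-congˡ {x (suc a)} (Σ-cong (suc n) (λ b → *-congˡ {sgn b} (*-congˡ {x (suc (punchIn a b))} (E-cong {λ s → punchIn (suc a) (punchIn (suc b) s)} {zero ◂ (λ s → suc (punchIn a (punchIn b s)))} (λ { zero → ≡.refl ; (suc s) → ≡.refl }))))))))
      (double-laplace≈0 n (x ∘ suc) (λ τ → E (zero ◂ (suc ∘ τ))) (λ h → E-cong (λ { zero → ≡.refl ; (suc s) → ≡.cong suc (h s) })))
    split : ∀ a → - sgn a * (x (suc a) * (1# * (x zero * E (λ s → suc (punchIn a s))) + Σ n (λ b → - sgn b * (x (suc (punchIn a b)) * E (λ s → punchIn (suc a) (punchIn (suc b) s))))))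
                  ≈ - (x zero * first a) + rest a
    split a = begin
      - sgn a * (x (suc a) * (1# * (x zero * Ea) + Σ n (λ b → - sgn b * y b)))
        ≈⟨ *-congˡ (*-congˡ (+-cong (*-identityˡ _) (trans (Σ-cong n (λ b → sym (-‿distribˡ-* _ _))) (Σ-neg n _)))) ⟩
      - sgn a * (x (suc a) * (x zero * Ea + - T))
        ≈⟨ solve 5 (λ s x z e t → s :* (x :* (z :* e :+ t)) := s :* (z :* (x :* e)) :+ s :* (x :* t)) refl _ _ _ _ _ ⟩
      - sgn a * (x zero * (x (suc a) * Ea)) + - sgn a * (x (suc a) * - T)
        ≈⟨ +-cong (trans (sym (-‿distribˡ-* _ _)) (-‿cong (solve 3 (λ s z m → s :* (z :* m) := z :* (s :* m)) refl _ _ _)))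
                  (trans (*-congˡ (sym (-‿distribʳ-* _ _))) (-x*-y≈x*y _ _)) ⟩
      - (x zero * first a) + rest a ∎
      where
      Ea = E (λ s → suc (punchIn a s))
      y : V n
      y b = x (suc (punchIn a b)) * E (λ s → punchIn (suc a) (punchIn (suc b) s))
      T = Σ n (λ b → sgn b * y b)

  det-repeat₀₁ : ∀ n {M : Mat (suc (suc n)) (suc (suc n))} → M zero ≋ M (suc zero) → det 𝔽 (suc (suc n)) M ≈ 0#
  det-repeat₀₁ n {M} h = trans
    (Σ-cong (suc (suc n)) (λ a → *-congˡ {sgn a} (*-congˡ {M zero a} (Σ-cong (suc n) (λ b → *-congˡ {sgn b} (*-congʳ {det 𝔽 n (λ r s → M (suc (suc r)) (punchIn a (punchIn b s)))} (sym (h (punchIn a b)))))))))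
    (double-laplace≈0 n (M zero) (λ τ → det 𝔽 n (λ r s → M (suc (suc r)) (τ s)))
      (λ e → det-cong n (λ r s → reflexive (≡.cong (M (suc (suc r))) (e s)))))

  -- Rows j and l are both replaced by w = Mⱼ + Mᵢ and the result expanded: every term but D M has a repeated row.
  vanish-transfer : ∀ {k n} (D : Mat k n → Carrier) →
    (∀ i a b {M P Q} → (Q i ≋ λ j → a * M i j + b * P i j) → (∀ r → r ≢ i → Q r ≋ M r × Q r ≋ P r) → D Q ≈ a * D M + b * D P) →
    ∀ {i j l} → i ≢ j → j ≢ l → i ≢ l →
    (∀ M → M i ≋ M j → D M ≈ 0#) → (∀ M → M j ≋ M l → D M ≈ 0#) → ∀ M → M i ≋ M l → D M ≈ 0#
  vanish-transfer {n = n} D linear {i} {j} {l} i≢j j≢l i≢l ij jl M h = begin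
    D M                          ≈⟨ sym (+-identityʳ _) ⟩
    D M + 0#                     ≈⟨ +-congˡ (sym (jl (M [ l ≔ M j ])
                                      (λ t → trans (≔-other M (M j) j≢l t) (sym (≔-same M l (M j) t))))) ⟩
    D M + D (M [ l ≔ M j ])      ≈⟨ 1*+1* _ _ ⟩
    1# * D M + 1# * D (M [ l ≔ M j ])
      ≈⟨ sym (linear l 1# 1# (λ t → trans (≔-same M l w t) (trans (+-comm _ _) (trans (1*+1* _ _)
           (+-cong (*-congˡ (h t)) (*-congˡ (sym (≔-same M l (M j) t)))))))
           (λ r r≢l → ≔-other M w r≢l , λ t → trans (≔-other M w r≢l t) (sym (≔-other M (M j) r≢l t)))) ⟩
    D A                          ≈⟨ sym (+-identityʳ _) ⟩
    D A + 0#                     ≈⟨ +-congˡ (sym (ij (A [ j ≔ M i ]) (λ t → trans (≔-other A (M i) i≢j t)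
                                      (trans (≔-other M w i≢l t) (sym (≔-same A j (M i) t)))))) ⟩
    D A + D (A [ j ≔ M i ])      ≈⟨ 1*+1* _ _ ⟩
    1# * D A + 1# * D (A [ j ≔ M i ])
      ≈⟨ sym (linear j 1# 1# (λ t → trans (≔-same A j w t) (trans (1*+1* _ _)
           (+-cong (*-congˡ (sym (≔-other M w j≢l t))) (*-congˡ (sym (≔-same A j (M i) t))))))
           (λ r r≢j → ≔-other A w r≢j , λ t → trans (≔-other A w r≢j t) (sym (≔-other A (M i) r≢j t)))) ⟩
    D (A [ j ≔ w ])              ≈⟨ jl (A [ j ≔ w ]) (λ t → trans (≔-same A j w t)
                                      (sym (trans (≔-other A w (j≢l ∘ ≡.sym) t) (≔-same M l w t)))) ⟩
    0# ∎
    where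
    open ≈-Reasoning
    w : V n
    w t = M j t + M i t
    A = M [ l ≔ w ]

  module _ n (alternating : ∀ {i j} (M : Mat n n) → i ≢ j → M i ≋ M j → det 𝔽 n M ≈ 0#) where

    det-repeat-below : ∀ {i j} (M : Mat (suc n) (suc n)) → i ≢ j → M (suc i) ≋ M (suc j) → det 𝔽 (suc n) M ≈ 0#
    det-repeat-below M i≢j h = Σ-≈0 (suc n) (λ t →
      trans (*-congˡ {sgn t} (trans (*-congˡ {M zero t} (alternating (minor M t) i≢j (λ s → h (punchIn t s)))) (zeroʳ _))) (zeroʳ _))

  det-repeat₀ : ∀ n → (∀ {i j} (M : Mat n n) → i ≢ j → M i ≋ M j → det 𝔽 n M ≈ 0#) →
                ∀ j (M : Mat (suc n) (suc n)) → M zero ≋ M (suc j) → det 𝔽 (suc n) M ≈ 0#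
  det-repeat₀ (suc n) alternating zero    M h = det-repeat₀₁ n {M} h
  -- Row 1 is the intermediary: equal rows 0 and 1 are settled by the double expansion, equal rows 1
  -- and j + 2 by the minors along row 0.
  det-repeat₀ (suc n) alternating (suc j) M h = vanish-transfer (det 𝔽 (suc (suc n))) (det-linear (suc (suc n)))
    {zero} {suc zero} {suc (suc j)} (λ ()) (λ ()) (λ ())
    (λ N → det-repeat₀₁ n {N}) (λ N → det-repeat-below (suc n) alternating N (λ ())) M h

  det-alternating : ∀ n {i j} (M : Mat n n) → i ≢ j → M i ≋ M j → det 𝔽 n M ≈ 0#
  det-alternating (suc n) {zero}  {zero}  M 0≢0 h = contradiction ≡.refl 0≢0
  det-alternating (suc n) {zero}  {suc j} M _   h = det-repeat₀ n (det-alternating n) j M h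
  det-alternating (suc n) {suc i} {zero}  M _   h = det-repeat₀ n (det-alternating n) i M (λ j → sym (h j))
  det-alternating (suc n) {suc i} {suc j} M i≢j h = det-repeat-below n (det-alternating n) M (i≢j ∘ ≡.cong suc) h

  detForm : ∀ n → Form n n
  detForm n = record { fun = det 𝔽 n ; cong = det-cong n ; linear = det-linear n ; alternating = λ {_} {_} {M} → det-alternating n M }

  det-zero-column : ∀ n (M : Mat n n) j → (∀ i → M i j ≈ 0#) → det 𝔽 n M ≈ 0#
  det-zero-column (suc n) M j h = Σ-≈0 (suc n) term
    where
    term : ∀ t → sgn t * (M zero t * det 𝔽 n (minor M t)) ≈ 0#
    term t with t Fin.≟ j
    ... | yes ≡.refl = trans (*-congˡ (trans (*-congʳ (h zero)) (zeroˡ _))) (zeroʳ _)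
    ... | no t≢j    = trans (*-congˡ (trans (*-congˡ (det-zero-column n (minor M t) (punchOut t≢j)
        (λ i → trans (reflexive (≡.cong (M (suc i)) (Fin.punchIn-punchOut t≢j))) (h (suc i))))) (zeroʳ _))) (zeroʳ _)

  det-pivot : ∀ n (M : Mat (suc n) (suc n)) t → (∀ j → j ≢ t → M zero j * det 𝔽 n (minor M j) ≈ 0#) →
              det 𝔽 (suc n) M ≈ sgn t * (M zero t * det 𝔽 n (minor M t))
  det-pivot n M t h = Σ-single (suc n) (laplace M) t (λ j j≢t → trans (*-congˡ {sgn j} (h j j≢t)) (zeroʳ _))

  det-e◂ : ∀ n t (M : Mat n (suc n)) → det 𝔽 (suc n) (e t ◂ M) ≈ sgn t * det 𝔽 n (λ r s → M r (punchIn t s))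
  det-e◂ n t M = trans (det-pivot n (e t ◂ M) t (λ j j≢t → trans (*-congʳ (e-diff (j≢t ∘ ≡.sym))) (zeroˡ _)))
    (*-congˡ (trans (*-congʳ (e-same t ≡.refl)) (*-identityˡ _)))

  det-e : ∀ n → det 𝔽 n e ≈ 1#
  det-e zero    = refl
  det-e (suc n) = trans (det-cong (suc n) {e} {e zero ◂ (e ∘ suc)} (◂-η e))
    (trans (det-e◂ n zero (e ∘ suc)) (trans (*-identityˡ _) (trans (det-cong n {λ i j → e (suc i) (suc j)} {e} e-suc) (det-e n))))
    where
    e-suc : ∀ (i : Fin n) j → e (suc i) (suc j) ≈ e i j
    e-suc i j with i Fin.≟ j
    ... | yes i≡j = refl
    ... | no i≢j  = refl

  sgn*sgn : ∀ {n} (j : Fin n) → sgn j * sgn j ≈ 1#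
  sgn*sgn zero    = *-identityˡ 1#
  sgn*sgn (suc j) = trans (-x*-y≈x*y _ _) (sgn*sgn j)

  sgn≉0 : ∀ {n} (j : Fin n) → ¬ (sgn j ≈ 0#)
  sgn≉0 j h = 0≉1 (trans (sym (zeroˡ _)) (trans (*-congʳ (sym h)) (sgn*sgn j)))

  undo-elimination : ∀ {k n} (M : Mat (suc k) n) (b x : V k) →
    (∀ j → Σ k (λ r → x r * (M (suc r) j + b r * M zero j)) ≈ 0#) →
    ∀ j → Σ k (λ r → x r * b r) * M zero j + Σ k (λ r → x r * M (suc r) j) ≈ 0#
  undo-elimination {k} M b x ann j = begin
    Σ k (λ r → x r * b r) * M zero j + Σ k (λ r → x r * M (suc r) j)     ≈⟨ +-congʳ (sym (Σ-*ʳ k _ _)) ⟩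
    Σ k (λ r → x r * b r * M zero j) + Σ k (λ r → x r * M (suc r) j)     ≈⟨ sym (Σ-+ k _ _) ⟩
    Σ k (λ r → x r * b r * M zero j + x r * M (suc r) j)                 ≈⟨ Σ-cong k (λ r →
        solve 4 (λ x b z m → x :* b :* z :+ x :* m := x :* (m :+ b :* z)) refl (x r) (b r) (M zero j) (M (suc r) j)) ⟩
    Σ k (λ r → x r * (M (suc r) j + b r * M zero j))                     ≈⟨ ann j ⟩
    0# ∎
    where open ≈-Reasoning

  -- Gaussian elimination: `p` is the column of a nonzero entry of the first row and is cleared
  -- below it, so only the minor at `p` survives in the expansion along that row. This minor is
  -- singular, and a dependency between its rows extends to `N`, whose column `p` is zero.
  singular⇒dependent : ∀ n (M : Mat n n) → det 𝔽 n M ≈ 0# →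
                       ∃ λ (x : V n) → (∃ λ i → ¬ (x i ≈ 0#)) × (∀ j → Σ n (λ i → x i * M i j) ≈ 0#)
  singular⇒dependent zero    M h = contradiction (sym h) 0≉1
  singular⇒dependent (suc n) M h with Fin.all? (λ j → M zero j ≟ 0#)
  ... | yes M₀≈0 = e zero , (zero , λ e≈0 → 0≉1 (sym e≈0)) , λ j → trans (e-pick (λ i → M i j) zero) (M₀≈0 j)
  ... | no M₀≉0
    with p , Mp≉0 ← Fin.¬∀⟶∃¬ (suc n) (λ j → M zero j ≈ 0#) (λ j → M zero j ≟ 0#) M₀≉0
    with y , My≈1 ← inverse (M zero p) Mp≉0
    = lift (singular⇒dependent n (minor M′ p) minor-singular)
    where
    b : V n
    b r = - (M (suc r) p * y)
    N : Mat n (suc n)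
    N r j = M (suc r) j + b r * M zero j
    Np≈0 : ∀ r → N r p ≈ 0#
    Np≈0 r = trans (+-congˡ (trans (sym (-‿distribˡ-* _ _)) (-‿cong (trans (trans (*-assoc _ _ _) (*-congˡ (trans (*-comm _ _) My≈1))) (*-identityʳ _)))))
      (-‿inverseʳ _)
    M′ : Mat (suc n) (suc n)
    M′ = M zero ◂ N
    det-M′ : det 𝔽 (suc n) M′ ≈ 0#
    det-M′ = trans (add-multiples (contract (detForm (suc n)) (M zero))
                     (λ i {P} e → det-alternating (suc n) {zero} {suc i} (M zero ◂ P) (λ ()) (λ j → sym (e j))) b (tail M))
                   (trans (det-cong (suc n) (λ i j → sym (◂-η M i j))) h)
    minor-singular : det 𝔽 n (minor M′ p) ≈ 0#
    minor-singular = *-≈0 Mp≉0 (*-≈0 (sgn≉0 p) (trans (sym (det-pivot n M′ p (λ j j≢p →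
      trans (*-congˡ (det-zero-column n (minor M′ j) (punchOut j≢p)
        (λ r → trans (reflexive (≡.cong (N r) (Fin.punchIn-punchOut j≢p))) (Np≈0 r)))) (zeroʳ _)))) det-M′))
    annN : ∀ (x : V n) → (∀ j → Σ n (λ i → x i * minor M′ p i j) ≈ 0#) → ∀ j → Σ n (λ r → x r * N r j) ≈ 0#
    annN x ann j with p Fin.≟ j
    ... | yes ≡.refl = Σ-≈0 n (λ r → trans (*-congˡ (Np≈0 r)) (zeroʳ _))
    ... | no p≢j     = trans (Σ-cong n (λ r → *-congˡ {x r} (reflexive (≡.cong (N r) (≡.sym (Fin.punchIn-punchOut p≢j)))))) (ann (punchOut p≢j))
    lift : (∃ λ (x : V n) → (∃ λ i → ¬ (x i ≈ 0#)) × (∀ j → Σ n (λ i → x i * minor M′ p i j) ≈ 0#)) →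
           ∃ λ (x : V (suc n)) → (∃ λ i → ¬ (x i ≈ 0#)) × (∀ j → Σ (suc n) (λ i → x i * M i j) ≈ 0#)
    lift (x , (i , xi≉0) , ann) = Σ n (λ r → x r * b r) ◂ x , (suc i , xi≉0) , undo-elimination M b x (annN x ann)

  indep⇒det≉0 : ∀ {n} {M : Mat n n} → LinIndep 𝔽 M → ¬ (det 𝔽 n M ≈ 0#)
  indep⇒det≉0 {n} {M} indep h with x , (i , xi≉0) , ann ← singular⇒dependent n M h = xi≉0 (indep x ann i)

  -- Number of nonzeros of a form

  module FinV n = FinSet (Vᶠ n)
  module FinMat k n = FinSet (Matᶠ k n)

  nonzero? : ∀ {k n} (g : Form k n) M → Dec (¬ (fun g M ≈ 0#))
  nonzero? g M = ¬? (fun g M ≟ 0#)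

  N : ∀ {k n} → Form k n → ℕ
  N {k} {n} g = FinMat.count k n (nonzero? g)

  N-contract : ∀ {k n} (g : Form (suc k) n) → N g ≡ ∑ (FinV.list n) (λ v → N (contract g v))
  N-contract {k} {n} g = ∑-vectors-suc (Vᶠ n) k _

  N-cong : ∀ {k n} (g h : Form k n) → (∀ M → fun g M ≈ fun h M) → N g ≡ N h
  N-cong {k} {n} g h e = ∑-cong (FinMat.list k n) (λ M → ⟦⟧-cong (nonzero? g M) (nonzero? h M)
    (λ gM≉0 hM≈0 → gM≉0 (trans (e M) hM≈0)) (λ hM≉0 gM≈0 → hM≉0 (trans (sym (e M)) gM≈0)))

  nonzero-resp : ∀ {k n} (g : Form k n) {M M′} → (∀ i → M i ≋ M′ i) → ¬ (fun g M ≈ 0#) → ¬ (fun g M′ ≈ 0#)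
  nonzero-resp g e gM≉0 gM′≈0 = gM≉0 (trans (cong g e) gM′≈0)

  N≡0⇒vanishes : ∀ {k n} (g : Form k n) → N g ≡ 0 → ∀ M → fun g M ≈ 0#
  N≡0⇒vanishes {k} {n} g N≡0 M =
    decidable-stable (fun g M ≟ 0#) (FinMat.count≡0⇒¬ k n (nonzero? g) (nonzero-resp g) N≡0 M)

  vanishes⇒N≡0 : ∀ {k n} (g : Form k n) → (∀ M → fun g M ≈ 0#) → N g ≡ 0
  vanishes⇒N≡0 {k} {n} g h =
    ≡.trans (∑-cong (FinMat.list k n) (λ M → ⟦⟧-no (nonzero? g M) (λ gM≉0 → gM≉0 (h M)))) (∑-0 (FinMat.list k n))

  nonzero⇒∃ : ∀ {k n} (g : Form k n) → N g ≢ 0 → ∃ λ M → ¬ (fun g M ≈ 0#)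
  nonzero⇒∃ {k} {n} g = FinMat.count≢0⇒∃ k n (nonzero? g)

  -- The quantifier over all tuples is decided by counting the nonzeros of the contraction.
  Rad? : ∀ {k n} (g : Form (suc k) n) v → Dec (Rad g v)
  Rad? g v with N (contract g v) ℕ.≟ 0
  ... | yes N≡0 = yes (N≡0⇒vanishes (contract g v) N≡0)
  ... | no N≢0  = no (λ h → N≢0 (vanishes⇒N≡0 (contract g v) h))

  ¬Rad⇒∃ : ∀ {k n} (g : Form (suc k) n) {v} → ¬ Rad g v → ∃ λ M → ¬ (fun g (v ◂ M) ≈ 0#)
  ¬Rad⇒∃ g {v} ¬rad = nonzero⇒∃ (contract g v) (λ N≡0 → ¬rad (N≡0⇒vanishes (contract g v) N≡0))

  radicals : ∀ {k n} → Form (suc k) n → ℕ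
  radicals {n = n} g = FinV.count n (Rad? g)

  nonradicals : ∀ {k n} → Form (suc k) n → ℕ
  nonradicals {n = n} g = FinV.count n (¬? ∘ Rad? g)

  radicals+nonradicals : ∀ {k n} (g : Form (suc k) n) → radicals g ℕ.+ nonradicals g ≡ q ℕ.^ n
  radicals+nonradicals {n = n} g = ≡.trans (FinV.count+count¬ n (Rad? g)) (card-V n)

  -- Differences are written with the coefficients `1#` and `- 1#`: this is the shape that `linear`
  -- and `Rad-linear` consume, and the semiring solver can treat `- 1#` as an atom.
  x-x≈0 : ∀ x → 1# * x + - 1# * x ≈ 0#
  x-x≈0 x = trans (sym (distribʳ x 1# (- 1#))) (trans (*-congʳ (-‿inverseʳ 1#)) (zeroˡ x))

  x-y≈0⇒x≈y : ∀ {x y} → 1# * x + - 1# * y ≈ 0# → x ≈ y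
  x-y≈0⇒x≈y {x} {y} h = begin
    x                               ≈⟨ sym (+-identityʳ x) ⟩
    x + 0#                          ≈⟨ +-cong (sym (*-identityˡ x)) (sym (x-x≈0 y)) ⟩
    1# * x + (1# * y + - 1# * y)    ≈⟨ solve 3 (λ x y z → x :+ (y :+ z) := (x :+ z) :+ y) refl _ _ _ ⟩
    (1# * x + - 1# * y) + 1# * y    ≈⟨ +-cong h (*-identityˡ y) ⟩
    0# + y                          ≈⟨ +-identityˡ y ⟩
    y                               ∎
    where open ≈-Reasoning

  +≈+⇒-≈- : ∀ {v a v′ a′} → v + a ≈ v′ + a′ → 1# * a + - 1# * a′ ≈ 1# * v′ + - 1# * v
  +≈+⇒-≈- {v} {a} {v′} {a′} h = begin
    1# * a + m * a′                                 ≈⟨ sym (+-identityʳ _) ⟩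
    (1# * a + m * a′) + 0#                          ≈⟨ +-congˡ (sym (x-x≈0 v)) ⟩
    (1# * a + m * a′) + (1# * v + m * v)            ≈⟨ solve 6 (λ i m a a′ v w → (i :* a :+ m :* a′) :+ (i :* v :+ m :* w) := i :* (v :+ a) :+ (m :* a′ :+ m :* w)) refl 1# m a a′ v v ⟩
    1# * (v + a) + (m * a′ + m * v)                 ≈⟨ +-congʳ (*-congˡ h) ⟩
    1# * (v′ + a′) + (m * a′ + m * v)               ≈⟨ solve 5 (λ i m a v w → i :* (v :+ a) :+ (m :* a :+ m :* w) := (i :* v :+ m :* w) :+ (i :* a :+ m :* a)) refl 1# m a′ v′ v ⟩
    (1# * v′ + m * v) + (1# * a′ + m * a′)          ≈⟨ +-congˡ (x-x≈0 a′) ⟩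
    (1# * v′ + m * v) + 0#                          ≈⟨ +-identityʳ _ ⟩
    1# * v′ + m * v                                 ∎
    where
    open ≈-Reasoning
    m = - 1#

  rowCombination : ∀ {r n} → V r → Mat r n → V n
  rowCombination {r} x M j = Σ r (λ i → x i * M i j)

  rowCombination-sub : ∀ {r n} (a a′ : V r) (M : Mat r n) j →
    rowCombination (λ i → 1# * a i + - 1# * a′ i) M j ≈ 1# * rowCombination a M j + - 1# * rowCombination a′ M j
  rowCombination-sub {r} a a′ M j = trans
    (Σ-cong r (λ i → trans (distribʳ _ _ _) (+-cong (*-assoc _ _ _) (*-assoc _ _ _)))) (Σ-lin r 1# (- 1#) _ _)

  indep⇒injective : ∀ {r n} {M : Mat r n} → LinIndep 𝔽 M → ∀ {a a′} → rowCombination a M ≋ rowCombination a′ M → a ≋ a′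
  indep⇒injective {M = M} indep {a} {a′} h i = x-y≈0⇒x≈y (indep _
    (λ j → trans (rowCombination-sub a a′ M j) (trans (+-congʳ (*-congˡ (h j))) (x-x≈0 _))) i)

  -- If g(w) ≠ 0, the radical meets the span of the rows of w trivially.
  radicals-upper : ∀ {k n} (g : Form (suc k) n) {w} → ¬ (fun g w ≈ 0#) → radicals g ℕ.* q ℕ.^ suc k ≤ q ℕ.^ n
  radicals-upper {k} {n} g {w} gw≉0 = begin
    radicals g ℕ.* q ℕ.^ suc k                                             ≡⟨ ≡.cong (radicals g ℕ.*_) (≡.sym (card-V (suc k))) ⟩
    radicals g ℕ.* FinV.card (suc k)                                       ≡⟨ ≡.sym (∑-*ʳ (FinV.list n) _ _) ⟩
    ∑ (FinV.list n) (λ v → ⟦ Rad? g v ⟧ ℕ.* FinV.card (suc k))             ≡⟨ ∑-cong (FinV.list n) (λ v → ≡.trans (ℕ.*-comm ⟦ Rad? g v ⟧ _) (≡.sym (FinV.∑-card (suc k) _))) ⟩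
    ∑ (FinV.list n) (λ v → ∑ (FinV.list (suc k)) (λ _ → ⟦ Rad? g v ⟧))     ≡⟨ ≡.sym (∑-pairWith _,_ (FinV.list n) (FinV.list (suc k)) _) ⟩
    FinSet.count (Vᶠ n ×ᶠ Vᶠ (suc k)) (λ (v , _) → Rad? g v)               ≤⟨ count-inj≤ (Vᶠ n ×ᶠ Vᶠ (suc k)) (Vᶠ n) (λ (v , _) → Rad? g v) (λ _ → yes tt)
                                                                                (λ (v , a) j → v j + rowCombination a w j) (λ _ _ → tt {Level.zero}) (λ _ _ → tt) inj ⟩
    FinV.card n                                                            ≡⟨ card-V n ⟩
    q ℕ.^ n                                                                ∎
    where
    open ℕ.≤-Reasoning
    inj : ∀ {x x′ : V n × V (suc k)} → Rad g (proj₁ x) → Rad g (proj₁ x′) →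
          (∀ j → proj₁ x j + rowCombination (proj₂ x) w j ≈ proj₁ x′ j + rowCombination (proj₂ x′) w j) →
          proj₁ x ≋ proj₁ x′ × proj₂ x ≋ proj₂ x′
    inj {v , a} {v′ , a′} rad rad′ h = v≋v′ , a≋a′
      where
      b : V (suc k)
      b i = 1# * a i + - 1# * a′ i
      difference-radical : Rad g (rowCombination b w)
      difference-radical = Rad-resp g (λ j → sym (trans (rowCombination-sub a a′ w j) (+≈+⇒-≈- (h j)))) (Rad-linear g 1# (- 1#) rad′ rad)
      -- Putting the radical vector into row i of `w` multiplies the value at `w` by `b i`, and also
      -- gives zero.
      a≋a′ : a ≋ a′
      a≋a′ i = x-y≈0⇒x≈y (*-≈0 gw≉0 (trans (*-comm _ _) (trans (sym (cramer g b w i))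
        (Rad⇒vanishes g difference-radical i (≔-same w i _)))))
      v≋v′ : v ≋ v′
      v≋v′ j = sym (x-y≈0⇒x≈y (trans (sym (+≈+⇒-≈- (h′ j))) (x-x≈0 (rowCombination a w j))))
        where
        h′ : ∀ j → v j + rowCombination a w j ≈ v′ j + rowCombination a w j
        h′ j = trans (h j) (+-congˡ (Σ-cong (suc k) (λ i → *-congʳ {w i j} (sym (a≋a′ i)))))

  radicals-lower : ∀ {k n s} (g : Form (suc k) n) {u : Mat s n} → LinIndep 𝔽 u → (∀ i → Rad g (u i)) → q ℕ.^ s ≤ radicals g
  radicals-lower {k} {n} {s} g {u} indep rad = ℕ.≤-trans (ℕ.≤-reflexive (≡.sym (card-V s)))
    (count-inj≤ (Vᶠ s) (Vᶠ n) {P = λ _ → ⊤ {Level.zero}} (λ _ → yes tt) (Rad? g) (λ a → rowCombination a u)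
      (Rad-resp g) (λ a _ → Rad-span g a rad) (λ _ _ → indep⇒injective indep))

  ∏qⁱ : ℕ → ℕ
  ∏qⁱ zero    = 1
  ∏qⁱ (suc k) = ∏qⁱ k ℕ.* q ℕ.^ suc k

  ∏qⁱ-1 : ℕ → ℕ
  ∏qⁱ-1 zero    = 1
  ∏qⁱ-1 (suc k) = ∏qⁱ-1 k ℕ.* (q ℕ.^ suc k ℕ.∸ 1)

  instance
    q-nonZero : ℕ.NonZero q
    q-nonZero = ℕ.>-nonZero (ℕ.≤-trans (ℕ.s≤s ℕ.z≤n) 1<q)

  0<q^ : ∀ k → 1 ≤ q ℕ.^ k
  0<q^ k = ℕ.m^n>0 q k

  ∏qⁱ>0 : ∀ k → 1 ≤ ∏qⁱ k
  ∏qⁱ>0 zero    = ℕ.≤-refl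
  ∏qⁱ>0 (suc k) = ℕ.*-mono-≤ (∏qⁱ>0 k) (0<q^ (suc k))

  q^-suc : ∀ k → q ℕ.^ k ≡ suc (q ℕ.^ k ℕ.∸ 1)
  q^-suc k = ≡.sym (ℕ.m+[n∸m]≡n (0<q^ k))

  -- N g ≥ ∏ (qⁿ - qⁿ⁻ⁱ) over 1 ≤ i ≤ k, multiplied by ∏ qⁱ so that only the factors qⁱ - 1 involve a subtraction.
  N-lower : ∀ {k n} (g : Form k n) {w} → ¬ (fun g w ≈ 0#) → (q ℕ.^ n) ℕ.^ k ℕ.* ∏qⁱ-1 k ≤ ∏qⁱ k ℕ.* N g
  N-lower {zero} g {w} gw≉0 = ℕ.≤-reflexive (≡.sym (≡.trans (ℕ.*-identityˡ _)
    (≡.cong (ℕ._+ 0) (⟦⟧-yes (nonzero? g ⟨⟩) (nonzero-resp g (λ ()) gw≉0)))))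
  N-lower {suc k} {n} g gw≉0 = begin
    X ℕ.* X ℕ.^ k ℕ.* (∏qⁱ-1 k ℕ.* e′)        ≡⟨ solveℕ 4 (λ X Y P e → X :*ℕ Y :*ℕ (P :*ℕ e) :=ℕ Y :*ℕ P :*ℕ (X :*ℕ e)) ≡.refl X (X ℕ.^ k) (∏qⁱ-1 k) e′ ⟩
    X ℕ.^ k ℕ.* ∏qⁱ-1 k ℕ.* (X ℕ.* e′)        ≤⟨ ℕ.*-monoʳ-≤ (X ℕ.^ k ℕ.* ∏qⁱ-1 k) Xe′≤se ⟩
    X ℕ.^ k ℕ.* ∏qⁱ-1 k ℕ.* (s ℕ.* E)         ≡⟨ ≡.sym (ℕ.*-assoc (X ℕ.^ k ℕ.* ∏qⁱ-1 k) s E) ⟩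
    X ℕ.^ k ℕ.* ∏qⁱ-1 k ℕ.* s ℕ.* E           ≤⟨ ℕ.*-monoˡ-≤ E sum-contractions ⟩
    ∏qⁱ k ℕ.* N g ℕ.* E                     ≡⟨ solveℕ 3 (λ Q N e → Q :*ℕ N :*ℕ e :=ℕ Q :*ℕ e :*ℕ N) ≡.refl (∏qⁱ k) (N g) E ⟩
    ∏qⁱ k ℕ.* E ℕ.* N g                     ∎
    where
    open ℕ.≤-Reasoning
    X E e′ r s : ℕ
    X = q ℕ.^ n
    E = q ℕ.^ suc k
    e′ = E ℕ.∸ 1
    r = radicals g
    s = nonradicals g
    -- At most X / E vectors are radical, so at least X (1 - 1/E) contractions are nonzero; the
    -- denominator E is multiplied out.
    Xe′≤se : X ℕ.* e′ ≤ s ℕ.* E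
    Xe′≤se = ℕ.+-cancelˡ-≤ X _ _ (begin
      X ℕ.+ X ℕ.* e′          ≡⟨ ≡.sym (ℕ.*-suc X e′) ⟩
      X ℕ.* suc e′            ≡⟨ ≡.cong₂ ℕ._*_ (≡.sym (radicals+nonradicals g)) (≡.sym (q^-suc (suc k))) ⟩
      (r ℕ.+ s) ℕ.* E         ≡⟨ ℕ.*-distribʳ-+ E r s ⟩
      r ℕ.* E ℕ.+ s ℕ.* E     ≤⟨ ℕ.+-monoˡ-≤ _ (radicals-upper g gw≉0) ⟩
      X ℕ.+ s ℕ.* E           ∎)
    at : ∀ v → X ℕ.^ k ℕ.* ∏qⁱ-1 k ℕ.* ⟦ ¬? (Rad? g v) ⟧ ≤ ∏qⁱ k ℕ.* N (contract g v)
    at v with Rad? g v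
    ... | yes _    = ℕ.≤-trans (ℕ.≤-reflexive (ℕ.*-zeroʳ (X ℕ.^ k ℕ.* ∏qⁱ-1 k))) ℕ.z≤n
    ... | no ¬rad  = ℕ.≤-trans (ℕ.≤-reflexive (ℕ.*-identityʳ _)) (N-lower (contract g v) (proj₂ (¬Rad⇒∃ g ¬rad)))
    sum-contractions : X ℕ.^ k ℕ.* ∏qⁱ-1 k ℕ.* s ≤ ∏qⁱ k ℕ.* N g
    sum-contractions = begin
      X ℕ.^ k ℕ.* ∏qⁱ-1 k ℕ.* s                                                      ≡⟨ ≡.sym (∑-*ˡ (FinV.list n) (X ℕ.^ k ℕ.* ∏qⁱ-1 k) _) ⟩
      ∑ (FinV.list n) (λ v → X ℕ.^ k ℕ.* ∏qⁱ-1 k ℕ.* ⟦ ¬? (Rad? g v) ⟧)              ≤⟨ ∑-mono (FinV.list n) at ⟩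
      ∑ (FinV.list n) (λ v → ∏qⁱ k ℕ.* N (contract g v))                           ≡⟨ ∑-*ˡ (FinV.list n) (∏qⁱ k) _ ⟩
      ∏qⁱ k ℕ.* ∑ (FinV.list n) (λ v → N (contract g v))                           ≡⟨ ≡.cong (∏qⁱ k ℕ.*_) (≡.sym (N-contract g)) ⟩
      ∏qⁱ k ℕ.* N g                                                                ∎

  -- Choose M with g (v ◂ M) nonzero and apply g (· ◂ M) to a relation: the radical vectors
  -- contribute zero, so the coefficient of v must vanish.
  ◂-indep : ∀ {k n s} (g : Form (suc k) n) {v} {u : Mat s n} → ¬ Rad g v → LinIndep 𝔽 u → (∀ i → Rad g (u i)) → LinIndep 𝔽 (v ◂ u)
  ◂-indep {s = s} g {v} {u} ¬rad indep rad λc h = λ { zero → λ₀≈0 ; (suc i) → indep (λc ∘ suc) rest i }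
    where
    open ≈-Reasoning
    M = proj₁ (¬Rad⇒∃ g ¬rad)
    λ₀≈0 : λc zero ≈ 0#
    λ₀≈0 = *-≈0 (proj₂ (¬Rad⇒∃ g ¬rad)) (trans (*-comm _ _) (begin
      λc zero * fun g (v ◂ M)                                                          ≈⟨ sym (+-identityʳ _) ⟩
      λc zero * fun g (v ◂ M) + 0#                                                     ≈⟨ +-congˡ (sym (Σ-≈0 s (λ t → trans (*-congˡ (rad t M)) (zeroʳ _)))) ⟩
      λc zero * fun g (v ◂ M) + Σ s (λ t → λc (suc t) * fun g (u t ◂ M))               ≈⟨ sym (Σ-linear₀ g (suc s) λc (v ◂ u) M) ⟩
      fun g (rowCombination λc (v ◂ u) ◂ M)                                            ≈⟨ zero-row g zero h ⟩
      0#                                                                               ∎))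
    rest : ∀ j → Σ s (λ t → λc (suc t) * u t j) ≈ 0#
    rest j = trans (sym (trans (+-congʳ (trans (*-congʳ λ₀≈0) (zeroˡ _))) (+-identityˡ _))) (h j)

  -- The estimates of `N-lower` are reversed. Contraction with v puts v itself into the radical, so
  -- the radical gains a dimension as the degree drops by one, and the dimension equation persists.
  -- `N-upper-contract` is separate because a form of degree 0 has no radical to recurse on.
  N-upper : ∀ {k n s} (g : Form (suc k) n) {u : Mat s n} → LinIndep 𝔽 u → (∀ i → Rad g (u i)) → s ℕ.+ suc k ≡ n →
            ∏qⁱ (suc k) ℕ.* N g ≤ (q ℕ.^ n) ℕ.^ suc k ℕ.* ∏qⁱ-1 (suc k)
  N-upper-contract : ∀ {k n s} (g : Form (suc k) n) {u : Mat s n} → LinIndep 𝔽 u → (∀ i → Rad g (u i)) → s ℕ.+ suc k ≡ n →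
                     ∀ {v} → ¬ Rad g v → ∏qⁱ k ℕ.* N (contract g v) ≤ (q ℕ.^ n) ℕ.^ k ℕ.* ∏qⁱ-1 k
  N-upper-contract {zero} g indep rad eq {v} ¬rad =
    ℕ.≤-trans (ℕ.≤-reflexive (≡.trans (ℕ.*-identityˡ _) (ℕ.+-identityʳ _))) (⟦⟧≤1 (nonzero? (contract g v) ⟨⟩))
    where
    ⟦⟧≤1 : ∀ {p} {P : Set p} (P? : Dec P) → ⟦ P? ⟧ ≤ 1
    ⟦⟧≤1 (yes _) = ℕ.≤-refl
    ⟦⟧≤1 (no _)  = ℕ.z≤n
  N-upper-contract {suc k} {s = s} g {u} indep rad eq {v} ¬rad =
    N-upper (contract g v) {v ◂ u} (◂-indep g ¬rad indep rad)
      (λ { zero → Rad-contract-self g v ; (suc i) → Rad-contract g v (rad i) }) (≡.trans (≡.sym (ℕ.+-suc s (suc k))) eq)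
  N-upper {k} {n} {s = t} g {u} indep rad eq = begin
    ∏qⁱ k ℕ.* E ℕ.* N g                     ≡⟨ solveℕ 3 (λ Q N e → Q :*ℕ e :*ℕ N :=ℕ Q :*ℕ N :*ℕ e) ≡.refl (∏qⁱ k) (N g) E ⟩
    ∏qⁱ k ℕ.* N g ℕ.* E                     ≤⟨ ℕ.*-monoˡ-≤ E sum-contractions ⟩
    X ℕ.^ k ℕ.* ∏qⁱ-1 k ℕ.* s ℕ.* E           ≡⟨ ℕ.*-assoc (X ℕ.^ k ℕ.* ∏qⁱ-1 k) s E ⟩
    X ℕ.^ k ℕ.* ∏qⁱ-1 k ℕ.* (s ℕ.* E)         ≤⟨ ℕ.*-monoʳ-≤ (X ℕ.^ k ℕ.* ∏qⁱ-1 k) se≤Xe′ ⟩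
    X ℕ.^ k ℕ.* ∏qⁱ-1 k ℕ.* (X ℕ.* e′)        ≡⟨ solveℕ 4 (λ X Y P e → Y :*ℕ P :*ℕ (X :*ℕ e) :=ℕ X :*ℕ Y :*ℕ (P :*ℕ e)) ≡.refl X (X ℕ.^ k) (∏qⁱ-1 k) e′ ⟩
    X ℕ.* X ℕ.^ k ℕ.* (∏qⁱ-1 k ℕ.* e′)        ∎
    where
    open ℕ.≤-Reasoning
    X E e′ r s : ℕ
    X = q ℕ.^ n
    E = q ℕ.^ suc k
    e′ = E ℕ.∸ 1
    r = radicals g
    s = nonradicals g
    X≤rE : X ≤ r ℕ.* E
    X≤rE = ℕ.≤-trans (ℕ.≤-reflexive (≡.trans (≡.cong (q ℕ.^_) (≡.sym eq)) (ℕ.^-distribˡ-+-* q t (suc k))))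
      (ℕ.*-monoˡ-≤ E (radicals-lower g indep rad))
    se≤Xe′ : s ℕ.* E ≤ X ℕ.* e′
    se≤Xe′ = ℕ.+-cancelˡ-≤ X _ _ (begin
      X ℕ.+ s ℕ.* E           ≤⟨ ℕ.+-monoˡ-≤ _ X≤rE ⟩
      r ℕ.* E ℕ.+ s ℕ.* E     ≡⟨ ≡.sym (ℕ.*-distribʳ-+ E r s) ⟩
      (r ℕ.+ s) ℕ.* E         ≡⟨ ≡.cong₂ ℕ._*_ (radicals+nonradicals g) (q^-suc (suc k)) ⟩
      X ℕ.* suc e′            ≡⟨ ℕ.*-suc X e′ ⟩
      X ℕ.+ X ℕ.* e′          ∎)
    at : ∀ v → ∏qⁱ k ℕ.* N (contract g v) ≤ X ℕ.^ k ℕ.* ∏qⁱ-1 k ℕ.* ⟦ ¬? (Rad? g v) ⟧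
    at v with Rad? g v
    ... | yes h   = ℕ.≤-trans (ℕ.≤-reflexive (≡.trans (≡.cong (∏qⁱ k ℕ.*_) (vanishes⇒N≡0 (contract g v) h)) (ℕ.*-zeroʳ (∏qⁱ k)))) ℕ.z≤n
    ... | no ¬rad = ℕ.≤-trans (N-upper-contract g indep rad eq ¬rad) (ℕ.≤-reflexive (≡.sym (ℕ.*-identityʳ _)))
    sum-contractions : ∏qⁱ k ℕ.* N g ≤ X ℕ.^ k ℕ.* ∏qⁱ-1 k ℕ.* s
    sum-contractions = begin
      ∏qⁱ k ℕ.* N g                                                                ≡⟨ ≡.cong (∏qⁱ k ℕ.*_) (N-contract g) ⟩
      ∏qⁱ k ℕ.* ∑ (FinV.list n) (λ v → N (contract g v))                           ≡⟨ ≡.sym (∑-*ˡ (FinV.list n) (∏qⁱ k) _) ⟩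
      ∑ (FinV.list n) (λ v → ∏qⁱ k ℕ.* N (contract g v))                           ≤⟨ ∑-mono (FinV.list n) at ⟩
      ∑ (FinV.list n) (λ v → X ℕ.^ k ℕ.* ∏qⁱ-1 k ℕ.* ⟦ ¬? (Rad? g v) ⟧)              ≡⟨ ∑-*ˡ (FinV.list n) (X ℕ.^ k ℕ.* ∏qⁱ-1 k) _ ⟩
      X ℕ.^ k ℕ.* ∏qⁱ-1 k ℕ.* s                                                      ∎

  -- The order of GL_ℓ(q).
  Γ : ℕ → ℕ
  Γ ℓ = N (detForm ℓ)

  det-e≉0 : ∀ ℓ → ¬ (det 𝔽 ℓ e ≈ 0#)
  det-e≉0 ℓ h = 0≉1 (trans (sym h) (det-e ℓ))

  -- For the determinant the degree equals n, so an empty family of radical vectors already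
  -- satisfies the dimension equation of `N-upper`, and the two bounds meet.
  ∏qⁱ*Γ : ∀ ℓ → ∏qⁱ (suc ℓ) ℕ.* Γ (suc ℓ) ≡ (q ℕ.^ suc ℓ) ℕ.^ suc ℓ ℕ.* ∏qⁱ-1 (suc ℓ)
  ∏qⁱ*Γ ℓ = ℕ.≤-antisym (N-upper {s = 0} (detForm (suc ℓ)) {λ ()} (λ _ _ ()) (λ ()) ≡.refl)
                     (N-lower (detForm (suc ℓ)) {e} (det-e≉0 (suc ℓ)))

  module _ (d ℓ₀ : ℕ) where
    private
      ℓ = suc ℓ₀
      D = q ℕ.^ (ℓ ℕ.* d)

    -- The factor q^δ arises here as the ratio of the extremal counts in dimensions d + ℓ and ℓ,
    -- since (q^(d+ℓ))^ℓ = q^(ℓd) (q^ℓ)^ℓ and the factor `∏qⁱ-1 ℓ` is common to both.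
    ∏qⁱ*DΓ : ∏qⁱ ℓ ℕ.* (D ℕ.* Γ ℓ) ≡ (q ℕ.^ (d ℕ.+ ℓ)) ℕ.^ ℓ ℕ.* ∏qⁱ-1 ℓ
    ∏qⁱ*DΓ = begin
      ∏qⁱ ℓ ℕ.* (D ℕ.* Γ ℓ)                     ≡⟨ solveℕ 3 (λ Q D G → Q :*ℕ (D :*ℕ G) :=ℕ D :*ℕ (Q :*ℕ G)) ≡.refl (∏qⁱ ℓ) D (Γ ℓ) ⟩
      D ℕ.* (∏qⁱ ℓ ℕ.* Γ ℓ)                     ≡⟨ ≡.cong (D ℕ.*_) (∏qⁱ*Γ ℓ₀) ⟩
      D ℕ.* ((q ℕ.^ ℓ) ℕ.^ ℓ ℕ.* ∏qⁱ-1 ℓ)         ≡⟨ ≡.sym (ℕ.*-assoc D _ (∏qⁱ-1 ℓ)) ⟩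
      D ℕ.* (q ℕ.^ ℓ) ℕ.^ ℓ ℕ.* ∏qⁱ-1 ℓ           ≡⟨ ≡.cong (λ x → D ℕ.* x ℕ.* ∏qⁱ-1 ℓ) (ℕ.^-*-assoc q ℓ ℓ) ⟩
      D ℕ.* q ℕ.^ (ℓ ℕ.* ℓ) ℕ.* ∏qⁱ-1 ℓ           ≡⟨ ≡.cong (ℕ._* ∏qⁱ-1 ℓ) (≡.sym (ℕ.^-distribˡ-+-* q (ℓ ℕ.* d) (ℓ ℕ.* ℓ))) ⟩
      q ℕ.^ (ℓ ℕ.* d ℕ.+ ℓ ℕ.* ℓ) ℕ.* ∏qⁱ-1 ℓ     ≡⟨ ≡.cong (λ x → q ℕ.^ x ℕ.* ∏qⁱ-1 ℓ) (≡.trans (≡.sym (ℕ.*-distribˡ-+ ℓ d ℓ)) (ℕ.*-comm ℓ (d ℕ.+ ℓ))) ⟩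
      q ℕ.^ ((d ℕ.+ ℓ) ℕ.* ℓ) ℕ.* ∏qⁱ-1 ℓ         ≡⟨ ≡.cong (ℕ._* ∏qⁱ-1 ℓ) (≡.sym (ℕ.^-*-assoc q (d ℕ.+ ℓ) ℓ)) ⟩
      (q ℕ.^ (d ℕ.+ ℓ)) ℕ.^ ℓ ℕ.* ∏qⁱ-1 ℓ         ∎
      where
      open ≡.≡-Reasoning

    DΓ≤N : (g : Form ℓ (d ℕ.+ ℓ)) → ∀ {w} → ¬ (fun g w ≈ 0#) → D ℕ.* Γ ℓ ≤ N g
    DΓ≤N g gw≉0 = ℕ.*-cancelˡ-≤ (∏qⁱ ℓ) {{ℕ.>-nonZero (∏qⁱ>0 ℓ)}} (ℕ.≤-trans (ℕ.≤-reflexive ∏qⁱ*DΓ) (N-lower g gw≉0))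

    N≤DΓ : (g : Form ℓ (d ℕ.+ ℓ)) {u : Mat d (d ℕ.+ ℓ)} → LinIndep 𝔽 u → (∀ i → Rad g (u i)) → N g ≤ D ℕ.* Γ ℓ
    N≤DΓ g indep rad = ℕ.*-cancelˡ-≤ (∏qⁱ ℓ) {{ℕ.>-nonZero (∏qⁱ>0 ℓ)}} (ℕ.≤-trans (N-upper g indep rad ≡.refl) (ℕ.≤-reflexive (≡.sym ∏qⁱ*DΓ)))

  Γ>0 : ∀ ℓ → 1 ≤ Γ ℓ
  Γ>0 ℓ = ℕ.n≢0⇒n>0 (λ Γ≡0 → det-e≉0 ℓ (N≡0⇒vanishes (detForm ℓ) Γ≡0 e))

  -- N h ≥ Γ, while a zero of h at an invertible A would leave fewer than Γ places where h can be nonzero.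
  top-form-nonzero : ∀ {ℓ} (h : Form (suc ℓ) (suc ℓ)) {M A} → ¬ (fun h M ≈ 0#) → ¬ (det 𝔽 (suc ℓ) A ≈ 0#) → ¬ (fun h A ≈ 0#)
  top-form-nonzero {ℓ} h {M} {A} hM≉0 detA≉0 hA≈0 = ℕ.1+n≰n (begin
    suc (N h)                                                         ≡⟨ ℕ.+-comm 1 (N h) ⟩
    N h ℕ.+ 1                                                         ≡⟨ ≡.cong (N h ℕ.+_) (≡.sym (once A)) ⟩
    N h ℕ.+ ∑ list (λ B → ⟦ B ≟ᴹ A ⟧)                                 ≡⟨ ≡.sym (∑-+ list _ _) ⟩
    ∑ list (λ B → ⟦ nonzero? h B ⟧ ℕ.+ ⟦ B ≟ᴹ A ⟧)                    ≤⟨ ∑-mono list at ⟩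
    Γ (suc ℓ)                                                         ≡⟨ ≡.sym (ℕ.*-identityˡ _) ⟩
    1 ℕ.* Γ (suc ℓ)                                                   ≡⟨ ≡.cong (λ x → q ℕ.^ x ℕ.* Γ (suc ℓ)) (≡.sym (ℕ.*-zeroʳ ℓ)) ⟩
    q ℕ.^ (suc ℓ ℕ.* 0) ℕ.* Γ (suc ℓ)                                 ≤⟨ DΓ≤N 0 ℓ h hM≉0 ⟩
    N h                                                               ∎)
    where
    open ℕ.≤-Reasoning
    open FinSet (Matᶠ (suc ℓ) (suc ℓ)) using (list; once) renaming (_≟_ to _≟ᴹ_)
    det? = nonzero? (detForm (suc ℓ))
    at : ∀ B → ⟦ nonzero? h B ⟧ ℕ.+ ⟦ B ≟ᴹ A ⟧ ≤ ⟦ det? B ⟧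
    at B with B ≟ᴹ A
    ... | yes B≈A = ℕ.≤-reflexive (≡.trans (≡.cong (ℕ._+ 1) (⟦⟧-no (nonzero? h B) (λ hB≉0 → hB≉0 (trans (cong h B≈A) hA≈0))))
                      (≡.sym (⟦⟧-yes (det? B) (nonzero-resp (detForm (suc ℓ)) (λ i j → sym (B≈A i j)) detA≉0))))
    ... | no _    = ℕ.≤-trans (ℕ.≤-reflexive (ℕ.+-identityʳ _))
                      (⟦⟧-mono (nonzero? h B) (det? B) (λ hB≉0 → indep⇒det≉0 {M = B} (nonzero⇒indep h hB≉0)))

  rowCombination-surjective : ∀ {n} {A : Mat n n} → LinIndep 𝔽 A → ∀ y → ∃ λ x → rowCombination x A ≋ y
  rowCombination-surjective {n} {A} indep = injective⇒surjective (Vᶠ n) (λ x → rowCombination x A)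
    (λ e j → Σ-cong n (λ k → *-congʳ (e k))) (indep⇒injective indep)

  -- Averaging over the combinations of a family of forms

  module Field = FinSet fieldᶠ

  zero? : ∀ {s} (x : V s) → Dec (∀ i → x i ≈ 0#)
  zero? x = Fin.all? (λ i → x i ≟ 0#)

  -- The constant t carries the induction: fixing the first coefficient moves its term into t. If
  -- all later entries of x vanish, the first coefficient is determined and the others are free. The
  -- factor q on the left replaces an exponent s - 1 on the right.
  solutions : ∀ {s} (x : V s) → ¬ (∀ i → x i ≈ 0#) → ∀ t →
              q ℕ.* FinV.count s (λ c → (Σ s (λ i → c i * x i) + t) ≟ 0#) ≡ q ℕ.^ s
  solutions {zero}  x x≉0 t = contradiction (λ ()) x≉0
  solutions {suc s} x x≉0 t with zero? (x ∘ suc)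
  ... | no x′≉0 = begin
      q ℕ.* ∑ (FinV.list (suc s)) (λ c → ⟦ (Σ (suc s) (λ i → c i * x i) + t) ≟ 0# ⟧)
        ≡⟨ ≡.cong (q ℕ.*_) (∑-vectors-suc fieldᶠ s _) ⟩
      q ℕ.* ∑ Field.list (λ c₀ → ∑ (FinV.list s) (λ c → ⟦ ((c₀ * x zero + Σ s (λ i → c i * x (suc i))) + t) ≟ 0# ⟧))
        ≡⟨ ≡.sym (∑-*ˡ Field.list q _) ⟩
      ∑ Field.list (λ c₀ → q ℕ.* ∑ (FinV.list s) (λ c → ⟦ ((c₀ * x zero + Σ s (λ i → c i * x (suc i))) + t) ≟ 0# ⟧))
        ≡⟨ ∑-cong Field.list (λ c₀ → ≡.trans (≡.cong (q ℕ.*_) (∑-cong (FinV.list s) (λ c →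
             ⟦⟧-cong (_ ≟ 0#) (_ ≟ 0#) (trans (sym (shift c₀ _))) (trans (shift c₀ _)))))
             (solutions (x ∘ suc) x′≉0 (c₀ * x zero + t))) ⟩
      ∑ Field.list (λ _ → q ℕ.^ s)
        ≡⟨ Field.∑-card (q ℕ.^ s) ⟩
      Field.card ℕ.* q ℕ.^ s
        ≡⟨ ≡.cong (ℕ._* q ℕ.^ s) card-field ⟩
      q ℕ.* q ℕ.^ s ∎
    where
    open ≡.≡-Reasoning
    shift : ∀ c₀ y → (c₀ * x zero + y) + t ≈ y + (c₀ * x zero + t)
    shift c₀ y = solve 3 (λ a y t → (a :+ y) :+ t := y :+ (a :+ t)) refl _ _ _
  ... | yes x′≈0 = ≡.cong (q ℕ.*_) (begin
      ∑ (FinV.list (suc s)) (λ c → ⟦ (Σ (suc s) (λ i → c i * x i) + t) ≟ 0# ⟧)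
        ≡⟨ ∑-vectors-suc fieldᶠ s _ ⟩
      ∑ Field.list (λ c₀ → ∑ (FinV.list s) (λ c → ⟦ ((c₀ * x zero + Σ s (λ i → c i * x (suc i))) + t) ≟ 0# ⟧))
        ≡⟨ ∑-cong Field.list (λ c₀ → ∑-cong (FinV.list s) (λ c →
             ⟦⟧-cong (_ ≟ 0#) (c₀ ≟ root) (root-unique c₀ c) (root-solves c₀ c))) ⟩
      ∑ Field.list (λ c₀ → ∑ (FinV.list s) (λ c → ⟦ c₀ ≟ root ⟧))
        ≡⟨ ∑-swap Field.list (FinV.list s) _ ⟩
      ∑ (FinV.list s) (λ c → ∑ Field.list (λ c₀ → ⟦ c₀ ≟ root ⟧))
        ≡⟨ ∑-cong (FinV.list s) (λ _ → Field.once root) ⟩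
      FinV.card s
        ≡⟨ card-V s ⟩
      q ℕ.^ s ∎)
    where
    open ≡.≡-Reasoning
    x₀≉0 : ¬ (x zero ≈ 0#)
    x₀≉0 x₀≈0 = x≉0 λ { zero → x₀≈0 ; (suc i) → x′≈0 i }
    y : Carrier
    y = proj₁ (inverse (x zero) x₀≉0)
    xy≈1 : x zero * y ≈ 1#
    xy≈1 = proj₂ (inverse (x zero) x₀≉0)
    root : Carrier
    root = - (t * y)
    drop-tail : ∀ c₀ (c : V s) → (c₀ * x zero + Σ s (λ i → c i * x (suc i))) + t ≈ c₀ * x zero + t
    drop-tail c₀ c = +-congʳ (trans (+-congˡ (Σ-≈0 s (λ i → trans (*-congˡ (x′≈0 i)) (zeroʳ _)))) (+-identityʳ _))
    root*x₀ : root * x zero + t ≈ 0#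
    root*x₀ = trans (+-congʳ (trans (sym (-‿distribˡ-* _ _)) (-‿cong (trans (*-assoc _ _ _)
      (trans (*-congˡ (trans (*-comm _ _) xy≈1)) (*-identityʳ t)))))) (-‿inverseˡ t)
    root-solves : ∀ c₀ (c : V s) → c₀ ≈ root → (c₀ * x zero + Σ s (λ i → c i * x (suc i))) + t ≈ 0#
    root-solves c₀ c e = trans (drop-tail c₀ c) (trans (+-congʳ (*-congʳ e)) root*x₀)
    root-unique : ∀ c₀ (c : V s) → (c₀ * x zero + Σ s (λ i → c i * x (suc i))) + t ≈ 0# → c₀ ≈ root
    root-unique c₀ c h = x-y≈0⇒x≈y (*-≈0 x₀≉0 (begin′
      x zero * (1# * c₀ + - 1# * root)               ≈⟨ solve 5 (λ x i c m r → x :* (i :* c :+ m :* r) := i :* (c :* x) :+ m :* (r :* x)) refl _ _ _ _ _ ⟩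
      1# * (c₀ * x zero) + - 1# * (root * x zero)    ≈⟨ +≈+⇒-≈- (trans (+-comm _ _) (trans (trans (trans (sym (drop-tail c₀ c)) h) (sym root*x₀)) (+-comm _ _))) ⟩
      1# * t + - 1# * t                              ≈⟨ x-x≈0 t ⟩
      0#                                             ∎′))
      where open ≈-Reasoning renaming (begin_ to begin′_; _∎ to _∎′)

  nonsolutions : ∀ {s} (x : V s) → q ℕ.* FinV.count s (λ c → ¬? (Σ s (λ i → c i * x i) ≟ 0#)) ≡
                 (q ℕ.∸ 1) ℕ.* q ℕ.^ s ℕ.* ⟦ ¬? (zero? x) ⟧
  nonsolutions {s} x with zero? x
  ... | yes x≈0 = begin
      q ℕ.* FinV.count s (λ c → ¬? (Σ s (λ i → c i * x i) ≟ 0#))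
        ≡⟨ ≡.cong (q ℕ.*_) (≡.trans (∑-cong (FinV.list s) (λ c → ⟦⟧-no (¬? (_ ≟ 0#))
             (λ ≉0 → ≉0 (Σ-≈0 s (λ i → trans (*-congˡ (x≈0 i)) (zeroʳ _)))))) (∑-0 (FinV.list s))) ⟩
      q ℕ.* 0                      ≡⟨ ℕ.*-zeroʳ q ⟩
      0                            ≡⟨ ≡.sym (ℕ.*-zeroʳ ((q ℕ.∸ 1) ℕ.* q ℕ.^ s)) ⟩
      (q ℕ.∸ 1) ℕ.* q ℕ.^ s ℕ.* 0  ∎
    where open ≡.≡-Reasoning
  ... | no x≉0 = ℕ.+-cancelˡ-≡ (q ℕ.^ s) _ _ (begin
      q ℕ.^ s ℕ.+ q ℕ.* nonzeros                  ≡⟨ ≡.cong (ℕ._+ q ℕ.* nonzeros) (≡.sym zeros≡) ⟩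
      q ℕ.* zeros ℕ.+ q ℕ.* nonzeros              ≡⟨ ≡.sym (ℕ.*-distribˡ-+ q zeros nonzeros) ⟩
      q ℕ.* (zeros ℕ.+ nonzeros)                  ≡⟨ ≡.cong (q ℕ.*_) (≡.trans (FinV.count+count¬ s _) (card-V s)) ⟩
      q ℕ.* q ℕ.^ s                               ≡⟨ ≡.cong (ℕ._* q ℕ.^ s) (≡.sym (ℕ.m+[n∸m]≡n {1} {q} (ℕ.<⇒≤ 1<q))) ⟩
      q ℕ.^ s ℕ.+ (q ℕ.∸ 1) ℕ.* q ℕ.^ s           ≡⟨ ≡.cong (q ℕ.^ s ℕ.+_) (≡.sym (ℕ.*-identityʳ _)) ⟩
      q ℕ.^ s ℕ.+ (q ℕ.∸ 1) ℕ.* q ℕ.^ s ℕ.* 1     ∎)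
    where
    open ≡.≡-Reasoning
    zeros nonzeros : ℕ
    zeros = FinV.count s (λ c → Σ s (λ i → c i * x i) ≟ 0#)
    nonzeros = FinV.count s (λ c → ¬? (Σ s (λ i → c i * x i) ≟ 0#))
    zeros≡ : q ℕ.* zeros ≡ q ℕ.^ s
    zeros≡ = ≡.trans (≡.cong (q ℕ.*_) (∑-cong (FinV.list s) (λ c → ⟦⟧-cong (_ ≟ 0#) (_ ≟ 0#)
      (trans (+-identityʳ _)) (trans (sym (+-identityʳ _)))))) (solutions x x≉0 0#)

  some? : ∀ {s k n} (h : Fin s → Form k n) (M : Mat k n) → Dec (¬ (∀ i → fun (h i) M ≈ 0#))
  some? h M = ¬? (zero? (λ i → fun (h i) M))

  support : ∀ {s k n} → (Fin s → Form k n) → ℕ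
  support {k = k} {n} h = FinMat.count k n (some? h)

  -- Pairs of a combination and a tuple are counted in both orders: a tuple at which some `h i` is
  -- nonzero is a nonzero of the fraction (q - 1)/q of all combinations, any other tuple of none.
  averaging : ∀ {s k n} (h : Fin s → Form k n) →
              q ℕ.* ∑ (FinV.list s) (λ c → N (combination s c h)) ≡ (q ℕ.∸ 1) ℕ.* q ℕ.^ s ℕ.* support h
  averaging {s} {k} {n} h = begin
    q ℕ.* ∑ (FinV.list s) (λ c → ∑ (FinMat.list k n) (λ M → ⟦ nonzero? (combination s c h) M ⟧))
      ≡⟨ ≡.cong (q ℕ.*_) (∑-swap (FinV.list s) (FinMat.list k n) _) ⟩
    q ℕ.* ∑ (FinMat.list k n) (λ M → ∑ (FinV.list s) (λ c → ⟦ nonzero? (combination s c h) M ⟧))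
      ≡⟨ ≡.sym (∑-*ˡ (FinMat.list k n) q _) ⟩
    ∑ (FinMat.list k n) (λ M → q ℕ.* ∑ (FinV.list s) (λ c → ⟦ nonzero? (combination s c h) M ⟧))
      ≡⟨ ∑-cong (FinMat.list k n) (λ M → nonsolutions (λ i → fun (h i) M)) ⟩
    ∑ (FinMat.list k n) (λ M → (q ℕ.∸ 1) ℕ.* q ℕ.^ s ℕ.* ⟦ some? h M ⟧)
      ≡⟨ ∑-*ˡ (FinMat.list k n) ((q ℕ.∸ 1) ℕ.* q ℕ.^ s) (λ M → ⟦ some? h M ⟧) ⟩
    (q ℕ.∸ 1) ℕ.* q ℕ.^ s ℕ.* support h ∎
    where open ≡.≡-Reasoning

  zeroV? : ∀ {s} (x : V s) → Dec (x ≋ (λ _ → 0#))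
  zeroV? x = FinV._≟_ _ x (λ _ → 0#)

  module _ {s k n} (h : Fin s → Form k n) (B : ℕ) where
    private
      weight : V s → ℕ
      weight c = N (combination s c h)
      total : ∑ (FinV.list s) (λ c → B ℕ.* ⟦ zeroV? c ⟧) ≡ B
      total = ≡.trans (∑-*ˡ (FinV.list s) B _) (≡.trans (≡.cong (B ℕ.*_) (FinV.once s (λ _ → 0#))) (ℕ.*-identityʳ B))
      constant : ∑ (FinV.list s) (λ _ → B) ≡ q ℕ.^ s ℕ.* B
      constant = ≡.trans (FinV.∑-card s B) (≡.cong (ℕ._* B) (card-V s))
      open ℕ.≤-Reasoning

    -- The bound fails only for the zero combination, and the extra `B` pays for it without a
    -- subtraction.
    ∑-weights-lower : (∀ c → ¬ (c ≋ (λ _ → 0#)) → B ≤ weight c) → q ℕ.^ s ℕ.* B ≤ ∑ (FinV.list s) weight ℕ.+ B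
    ∑-weights-lower bound = begin
      q ℕ.^ s ℕ.* B                                                ≡⟨ ≡.sym constant ⟩
      ∑ (FinV.list s) (λ _ → B)                                    ≤⟨ ∑-mono (FinV.list s) at ⟩
      ∑ (FinV.list s) (λ c → weight c ℕ.+ B ℕ.* ⟦ zeroV? c ⟧)      ≡⟨ ∑-+ (FinV.list s) weight _ ⟩
      ∑ (FinV.list s) weight ℕ.+ ∑ (FinV.list s) (λ c → B ℕ.* ⟦ zeroV? c ⟧) ≡⟨ ≡.cong (∑ (FinV.list s) weight ℕ.+_) total ⟩
      ∑ (FinV.list s) weight ℕ.+ B                                 ∎
      where
      at : ∀ c → B ≤ weight c ℕ.+ B ℕ.* ⟦ zeroV? c ⟧
      at c with zeroV? c
      ... | yes _  = ℕ.≤-trans (ℕ.≤-reflexive (≡.sym (ℕ.*-identityʳ B))) (ℕ.m≤n+m _ (weight c))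
      ... | no c≉0 = ℕ.≤-trans (bound c c≉0) (ℕ.m≤m+n (weight c) _)

    ∑-weights-upper : (∀ c → ¬ (c ≋ (λ _ → 0#)) → weight c ≤ B) → ∑ (FinV.list s) weight ℕ.+ B ≤ q ℕ.^ s ℕ.* B
    ∑-weights-upper bound = begin
      ∑ (FinV.list s) weight ℕ.+ B                                 ≡⟨ ≡.cong (∑ (FinV.list s) weight ℕ.+_) (≡.sym total) ⟩
      ∑ (FinV.list s) weight ℕ.+ ∑ (FinV.list s) (λ c → B ℕ.* ⟦ zeroV? c ⟧) ≡⟨ ≡.sym (∑-+ (FinV.list s) weight _) ⟩
      ∑ (FinV.list s) (λ c → weight c ℕ.+ B ℕ.* ⟦ zeroV? c ⟧)      ≤⟨ ∑-mono (FinV.list s) at ⟩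
      ∑ (FinV.list s) (λ _ → B)                                    ≡⟨ constant ⟩
      q ℕ.^ s ℕ.* B                                                ∎
      where
      at : ∀ c → weight c ℕ.+ B ℕ.* ⟦ zeroV? c ⟧ ≤ B
      at c with zeroV? c
      ... | yes c≈0 = ℕ.≤-reflexive (≡.cong₂ ℕ._+_ (vanishes⇒N≡0 (combination s c h)
              (λ M → Σ-≈0 s (λ i → trans (*-congʳ (c≈0 i)) (zeroˡ _)))) (ℕ.*-identityʳ B))
      ... | no c≉0  = ℕ.≤-trans (ℕ.≤-reflexive (≡.trans (≡.cong (weight c ℕ.+_) (ℕ.*-zeroʳ B)) (ℕ.+-identityʳ _))) (bound c c≉0)

  ⟦⟧-split : ∀ {a b c} {A : Set a} {B : Set b} {C : Set c} (A? : Dec A) (B? : Dec B) (C? : Dec C) →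
             (A → C → B) → (B → C) → (¬ A → C) → ⟦ C? ⟧ ≡ ⟦ ¬? A? ⟧ ℕ.+ ⟦ A? ×-dec B? ⟧
  ⟦⟧-split (yes x) B? C? f g h = ⟦⟧-cong C? (yes x ×-dec B?) (λ z → x , f x z) (g ∘ proj₂)
  ⟦⟧-split (no ¬x) B? C? f g h = ≡.trans (⟦⟧-yes C? (h ¬x)) (≡.cong suc (≡.sym (⟦⟧-no (no ¬x ×-dec B?) (¬x ∘ proj₁))))


  module _ {k n r} (p : Form k n) (a : Fin r → Form k n) where

    section? : ∀ M → Dec (fun p M ≈ 0# × ¬ (∀ i → fun (a i) M ≈ 0#))
    section? M = (fun p M ≟ 0#) ×-dec some? a M

    sectionSupport : ℕ
    sectionSupport = FinMat.count k n section?

    support-◂ : support (p ◂ a) ≡ N p ℕ.+ sectionSupport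
    support-◂ = ≡.trans (∑-cong (FinMat.list k n) at) (∑-+ (FinMat.list k n) _ _)
      where
      at : ∀ M → ⟦ some? (p ◂ a) M ⟧ ≡ ⟦ nonzero? p M ⟧ ℕ.+ ⟦ section? M ⟧
      at M = ⟦⟧-split (fun p M ≟ 0#) (some? a M) (some? (p ◂ a) M)
        (λ pM≈0 h a≈0 → h λ { zero → pM≈0 ; (suc i) → a≈0 i }) (λ h all≈0 → h (all≈0 ∘ suc)) (λ pM≉0 all≈0 → pM≉0 (all≈0 zero))

    module _ (B : ℕ) (Np≡B : N p ≡ B) where
      private
        q′ T Y : ℕ
        q′ = q ℕ.∸ 1
        T = ∑ (FinV.list (suc r)) (λ c → N (combination (suc r) c (p ◂ a)))
        Y = sectionSupport
        q≡ : q ≡ suc q′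
        q≡ = ≡.sym (ℕ.m+[n∸m]≡n {1} {q} (ℕ.<⇒≤ 1<q))
        T≡ : T ≡ q′ ℕ.* q ℕ.^ r ℕ.* B ℕ.+ q′ ℕ.* q ℕ.^ r ℕ.* Y
        T≡ = ℕ.*-cancelˡ-≡ _ _ q (begin
          q ℕ.* T                                                        ≡⟨ averaging (p ◂ a) ⟩
          q′ ℕ.* (q ℕ.* q ℕ.^ r) ℕ.* support (p ◂ a)                     ≡⟨ ≡.cong (q′ ℕ.* (q ℕ.* q ℕ.^ r) ℕ.*_) (≡.trans support-◂ (≡.cong (ℕ._+ Y) Np≡B)) ⟩
          q′ ℕ.* (q ℕ.* q ℕ.^ r) ℕ.* (B ℕ.+ Y)                           ≡⟨ solveℕ 5 (λ q′ q R B Y → q′ :*ℕ (q :*ℕ R) :*ℕ (B :+ℕ Y) :=ℕ q :*ℕ (q′ :*ℕ R :*ℕ B :+ℕ q′ :*ℕ R :*ℕ Y)) ≡.refl q′ q (q ℕ.^ r) B Y ⟩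
          q ℕ.* (q′ ℕ.* q ℕ.^ r ℕ.* B ℕ.+ q′ ℕ.* q ℕ.^ r ℕ.* Y)          ∎)
          where open ≡.≡-Reasoning
        T+B≡ : T ℕ.+ B ≡ q′ ℕ.* q ℕ.^ r ℕ.* B ℕ.+ (q′ ℕ.* q ℕ.^ r ℕ.* Y ℕ.+ B)
        T+B≡ = ≡.trans (≡.cong (ℕ._+ B) T≡) (ℕ.+-assoc (q′ ℕ.* q ℕ.^ r ℕ.* B) _ B)
        qB≡ : q ℕ.^ suc r ℕ.* B ≡ q′ ℕ.* q ℕ.^ r ℕ.* B ℕ.+ q ℕ.^ r ℕ.* B
        qB≡ = ≡.trans (≡.cong (λ x → x ℕ.* q ℕ.^ r ℕ.* B) q≡)
          (solveℕ 3 (λ q′ R B → (R :+ℕ q′ :*ℕ R) :*ℕ B :=ℕ q′ :*ℕ R :*ℕ B :+ℕ R :*ℕ B) ≡.refl q′ (q ℕ.^ r) B)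

      -- The forms p and aᵢ have B + Y tuples in their joint support, B of them with p nonzero.
      -- Cancelling the contribution (q - 1) q^r B of these from both sides lowers q^(r+1) to q^r.
      section-lower : (∀ c → ¬ (c ≋ (λ _ → 0#)) → B ≤ N (combination (suc r) c (p ◂ a))) →
                      q ℕ.^ r ℕ.* B ≤ q′ ℕ.* q ℕ.^ r ℕ.* Y ℕ.+ B
      section-lower bound = ℕ.+-cancelˡ-≤ (q′ ℕ.* q ℕ.^ r ℕ.* B) _ _
        (≡.subst₂ _≤_ qB≡ T+B≡ (∑-weights-lower (p ◂ a) B bound))

      section-upper : (∀ c → ¬ (c ≋ (λ _ → 0#)) → N (combination (suc r) c (p ◂ a)) ≤ B) →
                      q′ ℕ.* q ℕ.^ r ℕ.* Y ℕ.+ B ≤ q ℕ.^ r ℕ.* B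
      section-upper bound = ℕ.+-cancelˡ-≤ (q′ ℕ.* q ℕ.^ r ℕ.* B) _ _
        (≡.subst₂ _≤_ T+B≡ qB≡ (∑-weights-upper (p ◂ a) B bound))

  -- The Schubert divisor and the fibres over its points

  module _ {ℓ₀ n} (g : Form (suc ℓ₀) n) {A : Mat (suc ℓ₀) (suc ℓ₀)} (detA≉0 : ¬ (det 𝔽 (suc ℓ₀) A ≈ 0#)) (R : Mat (suc ℓ₀) n) where

    -- As a function of `A`, the value at `A ⊡ R` is a form of top degree on square matrices. If it
    -- is nonzero at `e`, where it equals the value at `R`, it is nonzero at every invertible
    -- matrix.
    times-nonzero : ¬ (fun g R ≈ 0#) → ¬ (fun g (A ⊡ R) ≈ 0#)
    times-nonzero gR≉0 = top-form-nonzero (timesᴿ g R) {e} {A}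
      (λ h → gR≉0 (trans (cong g (λ i j → sym (e-pick (λ k → R k j) i))) h)) detA≉0

    times-nonzero⁻ : ¬ (fun g (A ⊡ R) ≈ 0#) → ¬ (fun g R ≈ 0#)
    times-nonzero⁻ gAR≉0 gR≈0 = top-form-nonzero (timesᴿ g R) {A} {e} gAR≉0 (det-e≉0 (suc ℓ₀))
      (trans (cong g (λ i j → e-pick (λ k → R k j) i)) gR≈0)

    times-zero : fun g R ≈ 0# → fun g (A ⊡ R) ≈ 0#
    times-zero gR≈0 = decidable-stable (fun g (A ⊡ R) ≟ 0#) (λ gAR≉0 → times-nonzero⁻ gAR≉0 gR≈0)

    times-zero⁻ : fun g (A ⊡ R) ≈ 0# → fun g R ≈ 0#
    times-zero⁻ gAR≈0 = decidable-stable (fun g R ≟ 0#) (λ gR≉0 → times-nonzero gR≉0 gAR≈0)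

  -- If x A is the k-th basis vector, then row k of R is x (A R) = x (A′ R′).
  rows-in-span : ∀ {ℓ n} {A A′ : Mat ℓ ℓ} {R R′ : Mat ℓ n} → LinIndep 𝔽 A → (∀ i → (A ⊡ R) i ≋ (A′ ⊡ R′) i) → ∀ k → InRowSpace 𝔽 R′ (R k)
  rows-in-span {ℓ} {n} {A} {A′} {R} {R′} indep h k with x , xA≋e ← rowCombination-surjective {A = A} indep (e k) =
    rowCombination x A′ , λ j → begin
      R k j                                      ≈⟨ sym (e-pick (λ i → R i j) k) ⟩
      rowCombination (e k) R j                   ≈⟨ Σ-cong ℓ (λ i → *-congʳ (sym (xA≋e i))) ⟩
      rowCombination (rowCombination x A) R j    ≈⟨ sym (⊡-row x A R j) ⟩
      rowCombination x (A ⊡ R) j                 ≈⟨ Σ-cong ℓ (λ i → *-congˡ (h i j)) ⟩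
      rowCombination x (A′ ⊡ R′) j               ≈⟨ ⊡-row x A′ R′ j ⟩
      rowCombination (rowCombination x A′) R′ j  ∎
    where open ≈-Reasoning

  ↑ʳ-view : ∀ d {ℓ} (x : Fin (d ℕ.+ ℓ)) → d ≤ toℕ x → ∃ λ y → x ≡ d ↑ʳ y
  ↑ʳ-view zero    x       _         = x , ≡.refl
  ↑ʳ-view (suc d) (suc x) (s≤s d≤x) with y , eq ← ↑ʳ-view d x d≤x = y , ≡.cong suc eq

  module Divisor (d ℓ₀ : ℕ) where
    ℓ m : ℕ
    ℓ = suc ℓ₀
    m = d ℕ.+ ℓ

    -- The Plücker coordinate of the last ℓ columns: Ω_η is its zero locus.
    p : Form ℓ m
    p = onColumns (detForm ℓ) (d ↑ʳ_)

    m∸ℓ≡d : m ℕ.∸ ℓ ≡ d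
    m∸ℓ≡d = ℕ.m+n∸n≡m d ℓ

    -- The condition for i = 1 gives a nonzero combination of the rows that vanishes on the last ℓ
    -- columns. If p were nonzero, these columns would force its coefficients to be zero.
    schubert⇒p≈0 : ∀ {R} → InSchubert 𝔽 (etaDiv ℓ m) R → fun p R ≈ 0#
    schubert⇒p≈0 {R} (_ , dims) with u , u∈R , u∈A , u-indep ← dims zero =
      decidable-stable (fun p R ≟ 0#) λ pR≉0 → 0≉1 (sym (u-indep (λ _ → 1#)
        (λ j → trans (+-identityʳ _) (trans (*-identityˡ _) (trans (proj₂ (u∈R zero) j)
          (Σ-≈0 ℓ (λ k → trans (*-congʳ (c≈0 u u∈R u∈A pR≉0 k)) (zeroˡ (R k j))))))) zero))
      where
      c≈0 : ∀ (u : Mat 1 m) (u∈R : ∀ k → InRowSpace 𝔽 R (u k)) → (∀ k → InA 𝔽 (m ℕ.∸ ℓ) (u k)) → ¬ (fun p R ≈ 0#) →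
            ∀ k → proj₁ (u∈R zero) k ≈ 0#
      c≈0 u u∈R u∈A pR≉0 = nonzero⇒indep (detForm ℓ) {λ r s → R r (d ↑ʳ s)} pR≉0 (proj₁ (u∈R zero))
        (λ s → trans (sym (proj₂ (u∈R zero) (d ↑ʳ s)))
          (u∈A zero (d ↑ʳ s) (ℕ.≤-trans (ℕ.≤-reflexive m∸ℓ≡d) (ℕ.≤-trans (ℕ.m≤m+n d (toℕ s)) (ℕ.≤-reflexive (≡.sym (Fin.toℕ-↑ʳ d s)))))))

    cast-view : ∀ {t s n} (eq : t ℕ.+ s ≡ n) (y : Fin n) → t ≤ toℕ y → ∃ λ z → y ≡ Fin.cast eq (t ↑ʳ z)
    cast-view {t} ≡.refl y t≤y with z , y≡ ← ↑ʳ-view t y t≤y = z , ≡.trans y≡ (≡.sym (Fin.cast-is-id ≡.refl _))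

    p≈0⇒schubert : ∀ {M} → LinIndep 𝔽 M → fun p M ≈ 0# → InSchubert 𝔽 (etaDiv ℓ m) M
    p≈0⇒schubert {M} indep pM≈0 = indep , dims
      where
      dims : ∀ k → DimCapAtLeast 𝔽 M (etaDiv ℓ m k) (suc (toℕ k))
      -- Here η is one less than the pattern d + i of the other entries: ℓ conditions on ℓ rows,
      -- solvable because the determinant vanishes.
      dims zero with x , (i , xi≉0) , ann ← singular⇒dependent ℓ (λ r s → M r (d ↑ʳ s)) pM≈0 =
        (λ _ → rowCombination x M) , (λ _ → x , λ _ → refl) , (λ _ → vanishes) , independent
        where
        vanishes : InA 𝔽 (m ℕ.∸ ℓ) (rowCombination x M)
        vanishes t d≤t with y , ≡.refl ← ↑ʳ-view d t (ℕ.≤-trans (ℕ.≤-reflexive (≡.sym m∸ℓ≡d)) d≤t) = ann y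
        independent : LinIndep 𝔽 {1} (λ _ → rowCombination x M)
        independent λc h zero = decidable-stable (λc zero ≟ 0#) λ λ₀≉0 →
          xi≉0 (indep x (λ j → *-≈0 λ₀≉0 (trans (sym (+-identityʳ _)) (h j))) i)
      -- With i = k + 2 the entry of η is d + i, so the last s = ℓ - i coordinates have to vanish,
      -- and these s conditions on ℓ coefficients leave i independent combinations of the rows.
      dims (suc k) with s , t+s≡ℓ ← ℕ.m≤n⇒∃[o]m+o≡n (Fin.toℕ<n (suc k))
        with C , C-indep , ann ← kernel s {suc (toℕ (suc k))} (λ j r → M r (d ↑ʳ Fin.cast t+s≡ℓ (suc (toℕ (suc k)) ↑ʳ j)))
                                   (≡.trans (≡.sym t+s≡ℓ) (ℕ.+-comm (suc (toℕ (suc k))) s)) =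
        C ⊡ M , (λ i → C i , λ _ → refl) , vanishes , ⊡-indep C M C-indep indep
        where
        vanishes : ∀ i → InA 𝔽 ((m ℕ.∸ ℓ) ℕ.+ suc (suc (toℕ k))) ((C ⊡ M) i)
        vanishes i x η≤x
          with y , ≡.refl ← ↑ʳ-view d x (ℕ.≤-trans (ℕ.≤-trans (ℕ.≤-reflexive (≡.sym m∸ℓ≡d)) (ℕ.m≤m+n _ _)) η≤x)
          with z , ≡.refl ← cast-view t+s≡ℓ y (ℕ.+-cancelˡ-≤ d _ _ (ℕ.≤-trans
                 (ℕ.≤-reflexive (≡.cong (ℕ._+ suc (suc (toℕ k))) (≡.sym m∸ℓ≡d))) (ℕ.≤-trans η≤x (ℕ.≤-reflexive (Fin.toℕ-↑ʳ d y)))))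
          = ann i z

  All-lookup : ∀ {a p} {A : Set a} {P : A → Set p} {xs : List A} → All P xs → ∀ i → P (lookup xs i)
  All-lookup (h ∷ _)  zero    = h
  All-lookup (_ ∷ hs) (suc i) = All-lookup hs i

  AllPairs-lookup : ∀ {a r} {A : Set a} {R : A → A → Set r} {xs : List A} → (∀ {x y} → R x y → R y x) →
                    AllPairs (λ x y → ¬ R x y) xs → ∀ i j → R (lookup xs i) (lookup xs j) → i ≡ j
  AllPairs-lookup R-sym (h ∷ hs) zero    zero    r = ≡.refl
  AllPairs-lookup R-sym (h ∷ hs) zero    (suc j) r = contradiction r (All-lookup h j)
  AllPairs-lookup R-sym (h ∷ hs) (suc i) zero    r = contradiction (R-sym r) (All-lookup h i)
  AllPairs-lookup R-sym (h ∷ hs) (suc i) (suc j) r = ≡.cong suc (AllPairs-lookup R-sym hs i j r)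

  weightOf : ∀ {r n} → (Fin r → V n) → ℕ
  weightOf {r} {n} w = FinSet.count (Finᶠ n) (λ j → ¬? (zero? (λ i → w i j)))

  module _ {r} (x : V (suc r)) where

    -- The test inside `supportSize` is a local function; a matrix with a single column gives access
    -- to it.
    support-column-zero : x zero ≈ 0# → supportSize 𝔽 {suc r} {1} (λ i _ → x i) ≡ supportSize 𝔽 {r} {1} (λ i _ → x (suc i))
    support-column-zero x₀≈0 with x zero ≟ 0#
    ... | yes _   = ≡.refl
    ... | no x₀≉0 = contradiction x₀≈0 x₀≉0

    support-column-nonzero : ¬ (x zero ≈ 0#) → supportSize 𝔽 {suc r} {1} (λ i _ → x i) ≡ 1
    support-column-nonzero x₀≉0 with x zero ≟ 0#
    ... | yes x₀≈0 = contradiction x₀≈0 x₀≉0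
    ... | no _     = ≡.refl

  support-column : ∀ {r} (x : V r) → supportSize 𝔽 {r} {1} (λ i _ → x i) ≡ ⟦ ¬? (zero? x) ⟧
  support-column {zero}  x = ≡.sym (⟦⟧-no (¬? (zero? x)) (λ h → h λ ()))
  support-column {suc r} x = go (x zero ≟ 0#)
    where
    go : Dec (x zero ≈ 0#) → supportSize 𝔽 {suc r} {1} (λ i _ → x i) ≡ ⟦ ¬? (zero? x) ⟧
    go (yes x₀≈0) = ≡.trans (support-column-zero x x₀≈0) (≡.trans (support-column (x ∘ suc))
      (⟦⟧-cong (¬? (zero? (x ∘ suc))) (¬? (zero? x)) (λ h x≈0 → h (x≈0 ∘ suc)) (λ h x′≈0 → h λ { zero → x₀≈0 ; (suc i) → x′≈0 i })))
    go (no x₀≉0)  = ≡.trans (support-column-nonzero x x₀≉0) (≡.sym (⟦⟧-yes (¬? (zero? x)) (λ x≈0 → x₀≉0 (x≈0 zero))))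

  -- The local functions of supportSize do not depend on the matrix they are lifted over,
  -- so both sides of the splitting by the first column agree definitionally.
  supportSize≡weightOf : ∀ {r n} (w : Fin r → V n) → supportSize 𝔽 w ≡ weightOf w
  supportSize≡weightOf {n = zero}  w = ≡.refl
  supportSize≡weightOf {n = suc n} w = begin
    supportSize 𝔽 w                                                                   ≡⟨⟩
    _ ℕ.+ supportSize 𝔽 (λ i j → w i (suc j))                                         ≡⟨ ≡.cong₂ ℕ._+_
        (≡.trans (≡.sym (ℕ.+-identityʳ _)) (support-column (λ i → w i zero))) (supportSize≡weightOf (λ i j → w i (suc j))) ⟩
    ⟦ ¬? (zero? (λ i → w i zero)) ⟧ ℕ.+ weightOf (λ i j → w i (suc j))                ≡⟨ ≡.cong (⟦ ¬? (zero? (λ i → w i zero)) ⟧ ℕ.+_) (≡.sym (∑-map suc (fins n) _)) ⟩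
    weightOf w                                                                        ∎
    where open ≡.≡-Reasoning

  module Fibres (d ℓ₀ : ℕ) (reps : List (Mat (suc ℓ₀) (d ℕ.+ suc ℓ₀)))
                (enumerates : EnumeratesSchubert 𝔽 (etaDiv (suc ℓ₀) (d ℕ.+ suc ℓ₀)) reps) where
    open Divisor d ℓ₀

    rep : Fin (length reps) → Mat ℓ m
    rep = lookup reps

    schubert : ∀ j → InSchubert 𝔽 (etaDiv ℓ m) (rep j)
    schubert = All-lookup (proj₁ enumerates)

    module _ {r} (a : Fin r → Form ℓ m) (w : Fin r → V (length reps)) (w≈ : ∀ i j → w i j ≈ fun (a i) (rep j)) where

      private
        Indices = Finᶠ (length reps)
        Frame? : ∀ (x : Fin (length reps) × Mat ℓ ℓ) →
                 Dec (¬ (∀ i → w i (proj₁ x) ≈ 0#) × ¬ (det 𝔽 ℓ (proj₂ x) ≈ 0#))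
        Frame? (j , A) = ¬? (zero? (λ i → w i j)) ×-dec nonzero? (detForm ℓ) A
        open ≡.≡-Reasoning

      count-frames : FinSet.count (Indices ×ᶠ Matᶠ ℓ ℓ) Frame? ≡ weightOf w ℕ.* Γ ℓ
      count-frames = begin
        FinSet.count (Indices ×ᶠ Matᶠ ℓ ℓ) Frame?
          ≡⟨ ∑-pairWith _,_ (fins (length reps)) (FinMat.list ℓ ℓ) _ ⟩
        ∑ (fins (length reps)) (λ j → ∑ (FinMat.list ℓ ℓ) (λ A → ⟦ Frame? (j , A) ⟧))
          ≡⟨ ∑-cong (fins (length reps)) (λ j → ≡.trans (∑-cong (FinMat.list ℓ ℓ) (λ A → ⟦⟧-× (¬? (zero? (λ i → w i j))) (nonzero? (detForm ℓ) A)))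
               (∑-*ˡ (FinMat.list ℓ ℓ) ⟦ ¬? (zero? (λ i → w i j)) ⟧ _)) ⟩
        ∑ (fins (length reps)) (λ j → ⟦ ¬? (zero? (λ i → w i j)) ⟧ ℕ.* Γ ℓ)
          ≡⟨ ∑-*ʳ (fins (length reps)) (Γ ℓ) _ ⟩
        weightOf w ℕ.* Γ ℓ ∎

      frame⇒section : ∀ j A → ¬ (det 𝔽 ℓ A ≈ 0#) → ¬ (∀ i → w i j ≈ 0#) →
                      fun p (A ⊡ rep j) ≈ 0# × ¬ (∀ i → fun (a i) (A ⊡ rep j) ≈ 0#)
      frame⇒section j A detA≉0 w≉0 = times-zero p {A} detA≉0 (rep j) (schubert⇒p≈0 {rep j} (schubert j)) ,
        λ a≈0 → w≉0 (λ i → trans (w≈ i j) (times-zero⁻ (a i) {A} detA≉0 (rep j) (a≈0 i)))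

      -- Equal frames span the same space, so the representatives coincide, and coordinates with
      -- respect to the independent rows of one representative are unique.
      frame-injective : ∀ {j j′ A A′} → ¬ (det 𝔽 ℓ A ≈ 0#) → ¬ (det 𝔽 ℓ A′ ≈ 0#) →
                        (∀ i → (A ⊡ rep j) i ≋ (A′ ⊡ rep j′) i) → j ≡ j′ × (∀ i → A i ≋ A′ i)
      frame-injective {j} {j′} {A} {A′} detA≉0 detA′≉0 h = same-rep , same-matrix same-rep h
        where
        same-rep : j ≡ j′
        same-rep = AllPairs-lookup swap (proj₁ (proj₂ enumerates)) j j′
          ( rows-in-span {A = A} {A′} {rep j} {rep j′} (nonzero⇒indep (detForm ℓ) {A} detA≉0) h
          , rows-in-span {A = A′} {A} {rep j′} {rep j} (nonzero⇒indep (detForm ℓ) {A′} detA′≉0) (λ i t → sym (h i t)))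
        same-matrix : j ≡ j′ → (∀ i → (A ⊡ rep j) i ≋ (A′ ⊡ rep j′) i) → ∀ i → A i ≋ A′ i
        same-matrix ≡.refl h i = indep⇒injective {M = rep j} (proj₁ (schubert j)) (h i)

      -- A tuple at which some aᵢ is nonzero is independent. With p zero it is therefore a basis of
      -- a point of the divisor, and `A` consists of its coordinates in the listed basis of that
      -- point.
      section⇒frame : ∀ M → fun p M ≈ 0# × ¬ (∀ i → fun (a i) M ≈ 0#) →
                      ∃ λ x → (¬ (∀ i → w i (proj₁ x) ≈ 0#) × ¬ (det 𝔽 ℓ (proj₂ x) ≈ 0#)) × (∀ i → (proj₂ x ⊡ rep (proj₁ x)) i ≋ M i)
      section⇒frame M (pM≈0 , aM≉0)
        with i₀ , aᵢM≉0 ← Fin.¬∀⟶∃¬ r (λ i → fun (a i) M ≈ 0#) (λ i → fun (a i) M ≟ 0#) aM≉0 = (j , A) , (w≉0 , detA≉0) , M≈AR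
        where
        M-indep : LinIndep 𝔽 M
        M-indep = nonzero⇒indep (a i₀) aᵢM≉0
        found : Any (SameSpace 𝔽 M) reps
        found = proj₂ (proj₂ enumerates) M (p≈0⇒schubert {M} M-indep pM≈0)
        j : Fin (length reps)
        j = Any.index found
        spans : ∀ k → InRowSpace 𝔽 (rep j) (M k)
        spans = proj₁ (lookup-index found)
        A : Mat ℓ ℓ
        A k = proj₁ (spans k)
        M≈AR : ∀ k → (A ⊡ rep j) k ≋ M k
        M≈AR k t = sym (proj₂ (spans k) t)
        A-indep : LinIndep 𝔽 A
        A-indep x h = M-indep x (λ t → trans (Σ-cong ℓ (λ k → *-congˡ {x k} (proj₂ (spans k) t)))
          (trans (⊡-row x A (rep j) t) (Σ-≈0 ℓ (λ k → trans (*-congʳ (h k)) (zeroˡ (rep j k t))))))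
        detA≉0 : ¬ (det 𝔽 ℓ A ≈ 0#)
        detA≉0 = indep⇒det≉0 {M = A} A-indep
        w≉0 : ¬ (∀ i → w i j ≈ 0#)
        w≉0 w≈0 = aᵢM≉0 (trans (cong (a i₀) (λ k t → sym (M≈AR k t)))
          (times-zero (a i₀) {A} detA≉0 (rep j) (trans (sym (w≈ i₀ j)) (w≈0 i₀))))

      section≡weight*Γ : sectionSupport p a ≡ weightOf w ℕ.* Γ ℓ
      section≡weight*Γ = ≡.trans (ℕ.≤-antisym
        (count-surj≤ (Indices ×ᶠ Matᶠ ℓ ℓ) (Matᶠ ℓ m) Frame? (section? p a) (λ (j , A) → A ⊡ rep j)
          (λ { {j , A} (≡.refl , A≈A′) (w≉0 , detA≉0) → w≉0 , nonzero-resp (detForm ℓ) A≈A′ detA≉0 })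
          (λ { {j , A} (≡.refl , A≈A′) → ⊡-cong (rep j) A≈A′ })
          section⇒frame)
        (count-inj≤ (Indices ×ᶠ Matᶠ ℓ ℓ) (Matᶠ ℓ m) Frame? (section? p a) (λ (j , A) → A ⊡ rep j)
          (λ e (pM≈0 , aM≉0) → trans (cong p (λ i t → sym (e i t))) pM≈0 , λ a≈0 → aM≉0 (λ i → trans (cong (a i) e) (a≈0 i)))
          (λ (j , A) (w≉0 , detA≉0) → frame⇒section j A detA≉0 w≉0)
          (λ (_ , detA≉0) (_ , detA′≉0) → frame-injective detA≉0 detA′≉0)))
        count-frames

  -- Plücker coordinates as codewords

  sumList≡Σ : ∀ {a} {A : Set a} (xs : List A) (f : A → Carrier) → sumList 𝔽 xs f ≡ Σ (length xs) (λ i → f (lookup xs i))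
  sumList≡Σ []       f = ≡.refl
  sumList≡Σ (x ∷ xs) f = ≡.cong (f x +_) (sumList≡Σ xs f)

  evalForm : ∀ {ℓ m} → (Vec (Fin m) ℓ → Carrier) → Form ℓ m
  evalForm {ℓ} {m} a = combination (length tuples) (λ i → a (lookup tuples i)) (λ i → onColumns (detForm ℓ) (Vec.lookup (lookup tuples i)))
    where tuples = increasingTuples m ℓ

  evalFunctional≈evalForm : ∀ {ℓ m} (a : Vec (Fin m) ℓ → Carrier) M → evalFunctional 𝔽 a M ≈ fun (evalForm a) M
  evalFunctional≈evalForm {ℓ} {m} a M = reflexive (sumList≡Σ (increasingTuples m ℓ) (λ I → a I * plucker 𝔽 I M))

  StrictlyIncreasing : ∀ {ℓ m} → (Fin ℓ → Fin m) → Set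
  StrictlyIncreasing σ = ∀ {i j} → i Fin.< j → σ i Fin.< σ j

  unsuc : ∀ {m} (x : Fin (suc m)) → 0 ℕ.< toℕ x → ∃ λ y → x ≡ suc y
  unsuc (suc y) _ = y , ≡.refl

  unsuc-all : ∀ {ℓ m} (σ : Fin ℓ → Fin (suc m)) → StrictlyIncreasing σ → (∀ i → 0 ℕ.< toℕ (σ i)) →
              ∃ λ τ → StrictlyIncreasing τ × (∀ i → σ i ≡ suc (τ i))
  unsuc-all σ σ-inc σ>0 = (λ i → proj₁ (unsuc (σ i) (σ>0 i))) ,
    (λ {i} {j} i<j → ℕ.≤-pred (≡.subst₂ Fin._<_ (proj₂ (unsuc (σ i) (σ>0 i))) (proj₂ (unsuc (σ j) (σ>0 j))) (σ-inc i<j))) ,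
    λ i → proj₂ (unsuc (σ i) (σ>0 i))

  tabulate-∈-increasingTuples : ∀ ℓ m (σ : Fin ℓ → Fin m) → StrictlyIncreasing σ → Vec.tabulate σ ∈ increasingTuples m ℓ
  tabulate-∈-increasingTuples zero    m       σ σ-inc = here ≡.refl
  tabulate-∈-increasingTuples (suc ℓ) zero    σ σ-inc with () ← σ zero
  tabulate-∈-increasingTuples (suc ℓ) (suc m) σ σ-inc with σ zero in σ₀
  ... | zero
    with τ , τ-inc , σ≡ ← unsuc-all (σ ∘ suc) (σ-inc ∘ s≤s) (λ i → ℕ.≤-trans (s≤s z≤n) (σ-inc {zero} {suc i} (s≤s z≤n))) =
    ∈-++⁺ˡ (≡.subst (λ v → zero Vec.∷ v ∈ _) (≡.sym (≡.trans (Vec.tabulate-cong σ≡) (Vec.tabulate-∘ suc τ)))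
      (∈-map⁺ (λ v → zero Vec.∷ Vec.map suc v) (tabulate-∈-increasingTuples ℓ m τ τ-inc)))
  ... | suc y
    with τ , τ-inc , σ≡ ← unsuc-all σ σ-inc (λ { zero → ≡.subst (λ z → 0 ℕ.< toℕ z) (≡.sym σ₀) (s≤s z≤n)
                                               ; (suc i) → ℕ.≤-trans (s≤s z≤n) (σ-inc {zero} {suc i} (s≤s z≤n)) }) =
    ∈-++⁺ʳ (List.map (λ v → zero Vec.∷ Vec.map suc v) (increasingTuples m ℓ))
      (≡.subst (_∈ List.map (Vec.map suc) (increasingTuples m (suc ℓ))) (≡.sym (≡.trans (≡.cong (Vec._∷ Vec.tabulate (σ ∘ suc)) (≡.sym σ₀)) (≡.trans (Vec.tabulate-cong σ≡) (Vec.tabulate-∘ suc τ))))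
        (∈-map⁺ (Vec.map suc) (tabulate-∈-increasingTuples (suc ℓ) m τ τ-inc)))

  map-suc-injective : ∀ {n m} {u v : Vec (Fin m) n} → Vec.map Fin.suc u ≡ Vec.map suc v → u ≡ v
  map-suc-injective {u = Vec.[]}     {Vec.[]}     _ = ≡.refl
  map-suc-injective {u = x Vec.∷ u}  {y Vec.∷ v}  h =
    ≡.cong₂ Vec._∷_ (Fin.suc-injective (Vec.∷-injectiveˡ h)) (map-suc-injective (Vec.∷-injectiveʳ h))

  increasingTuples-unique : ∀ m ℓ → Unique (increasingTuples m ℓ)
  increasingTuples-unique zero    zero    = [] ∷ []
  increasingTuples-unique (suc m) zero    = [] ∷ []
  increasingTuples-unique zero    (suc ℓ) = []
  increasingTuples-unique (suc m) (suc ℓ) = Unique.++⁺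
    (Unique.map⁺ (λ h → map-suc-injective (Vec.∷-injectiveʳ h)) (increasingTuples-unique m ℓ))
    (Unique.map⁺ map-suc-injective (increasingTuples-unique m (suc ℓ)))
    disjoint
    where
    disjoint : ∀ {v : Vec (Fin (suc m)) (suc ℓ)} → ¬ (v ∈ List.map (λ u → zero Vec.∷ Vec.map suc u) (increasingTuples m ℓ) ×
                          v ∈ List.map (Vec.map suc) (increasingTuples m (suc ℓ)))
    disjoint (v∈₁ , v∈₂) with u , _ , ≡.refl ← ∈-map⁻ (λ u → zero Vec.∷ Vec.map suc u) v∈₁
                         with (y Vec.∷ w) , _ , () ← ∈-map⁻ (Vec.map suc) v∈₂

  indicator : ∀ {ℓ m} → Vec (Fin m) ℓ → Vec (Fin m) ℓ → Carrier
  indicator I J with Vec.≡-dec Fin._≟_ J I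
  ... | yes _ = 1#
  ... | no _  = 0#

  indicator-no : ∀ {ℓ m} {I J : Vec (Fin m) ℓ} → J ≢ I → ∀ x → indicator I J * x ≈ 0#
  indicator-no {I = I} {J} J≢I x with Vec.≡-dec Fin._≟_ J I
  ... | yes J≡I = contradiction J≡I J≢I
  ... | no _    = zeroˡ x

  indicator-yes : ∀ {ℓ m} (I : Vec (Fin m) ℓ) x → indicator I I * x ≈ x
  indicator-yes I x with Vec.≡-dec Fin._≟_ I I
  ... | yes _  = *-identityˡ x
  ... | no I≢I = contradiction ≡.refl I≢I

  sumList-indicator-∉ : ∀ {ℓ m} (I : Vec (Fin m) ℓ) {xs} (f : Vec (Fin m) ℓ → Carrier) → All (I ≢_) xs → sumList 𝔽 xs (λ J → indicator I J * f J) ≈ 0#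
  sumList-indicator-∉ I f []       = refl
  sumList-indicator-∉ I f (h ∷ hs) = trans (+-cong (indicator-no (h ∘ ≡.sym) _) (sumList-indicator-∉ I f hs)) (+-identityˡ 0#)

  sumList-indicator : ∀ {ℓ m} (I : Vec (Fin m) ℓ) {xs} (f : Vec (Fin m) ℓ → Carrier) → Unique xs → I ∈ xs → sumList 𝔽 xs (λ J → indicator I J * f J) ≈ f I
  sumList-indicator I f (h ∷ _)  (here ≡.refl) = trans (+-cong (indicator-yes I _) (sumList-indicator-∉ I f h)) (+-identityʳ _)
  sumList-indicator I f (h ∷ hs) (there I∈xs)  = trans (+-cong (indicator-no (apart h I∈xs) _) (sumList-indicator I f hs I∈xs)) (+-identityˡ _)
    where
    apart : ∀ {x xs} → All (x ≢_) xs → I ∈ xs → x ≢ I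
    apart (x≢y ∷ _) (here ≡.refl) = x≢y
    apart (_ ∷ hs)  (there I∈xs)  = apart hs I∈xs

  minorForm : ∀ {ℓ m} → (Fin ℓ → Fin m) → Form ℓ m
  minorForm {ℓ} = onColumns (detForm ℓ)

  evalFunctional-indicator : ∀ {ℓ m} (σ : Fin ℓ → Fin m) → StrictlyIncreasing σ → ∀ M →
    evalFunctional 𝔽 (indicator (Vec.tabulate σ)) M ≈ fun (minorForm σ) M
  evalFunctional-indicator {ℓ} {m} σ σ-inc M = trans
    (sumList-indicator (Vec.tabulate σ) (λ I → plucker 𝔽 I M) (increasingTuples-unique m ℓ) (tabulate-∈-increasingTuples ℓ m σ σ-inc))
    (det-cong ℓ (λ r s → reflexive (≡.cong (M r) (Vec.lookup∘tabulate σ s))))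

  -- Families of minors that attain the bound

  increasing⇒injective : ∀ {ℓ m} {σ : Fin ℓ → Fin m} → StrictlyIncreasing σ → ∀ {i j} → σ i ≡ σ j → i ≡ j
  increasing⇒injective {σ = σ} σ-inc {i} {j} h with Fin.<-cmp i j
  ... | tri< i<j _ _ = contradiction (≡.cong toℕ h) (ℕ.<⇒≢ (σ-inc i<j))
  ... | tri≈ _ i≡j _ = i≡j
  ... | tri> _ _ j<i = contradiction (≡.cong toℕ (≡.sym h)) (ℕ.<⇒≢ (σ-inc j<i))

  e-injective : ∀ {k m} {σ : Fin k → Fin m} → (∀ {i j} → σ i ≡ σ j → i ≡ j) → ∀ i j → e (σ i) (σ j) ≈ e i j
  e-injective {σ = σ} inj i j with i Fin.≟ j
  ... | yes ≡.refl = e-same (σ j) ≡.refl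
  ... | no i≢j     = e-diff (i≢j ∘ inj)

  minor-at-e-same : ∀ {ℓ m} (σ : Fin ℓ → Fin m) → StrictlyIncreasing σ → fun (minorForm σ) (e ∘ σ) ≈ 1#
  minor-at-e-same {ℓ} σ σ-inc = trans (det-cong ℓ {λ r s → e (σ r) (σ s)} {e} (e-injective (increasing⇒injective σ-inc))) (det-e ℓ)

  minor-at-e-other : ∀ {ℓ m} (σ τ : Fin ℓ → Fin m) → (∃ λ s → ∀ t → σ s ≢ τ t) → fun (minorForm σ) (e ∘ τ) ≈ 0#
  minor-at-e-other {ℓ} σ τ (s , h) = det-zero-column ℓ (λ r s → e (τ r) (σ s)) s (λ t → e-diff (h t ∘ ≡.sym))

  dot-e : ∀ {n} (v : V n) i → Σ n (λ k → v k * e i k) ≈ v i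
  dot-e {n} v i = trans (Σ-cong n (λ k → *-comm (v k) (e i k))) (e-pick v i)

  -- The data of an optimal subcode: tuple zero belongs to p, the other r minors give the codewords.
  -- By `separated` each minor vanishes at the basis vectors of every other tuple, whence the
  -- independence of the words; `radical` makes every nonzero combination attain the least weight.
  record Family (d ℓ₀ r : ℕ) : Set (c Level.⊔ ℓ′) where
    open Divisor d ℓ₀
    field
      tuple      : Fin (suc r) → Fin ℓ → Fin m
      increasing : ∀ y → StrictlyIncreasing (tuple y)
      tuple-zero : ∀ s → tuple zero s ≡ d ↑ʳ s
      separated  : ∀ {y z} → y ≢ z → ∃ λ s → ∀ t → tuple y s ≢ tuple z t
      -- The rows of X are ℓ linear conditions, so the radical has codimension at most ℓ.
      radical    : ∀ (b : V (suc r)) → ¬ (b ≋ (λ _ → 0#)) → ∃ λ (X : Mat ℓ m) →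
                   ∀ v → (∀ i → Σ m (λ k → v k * X i k) ≈ 0#) → Rad (combination (suc r) b (λ y → minorForm (tuple y))) v

  combination-cong : ∀ {k n s} (b : V s) {h h′ : Fin s → Form k n} → (∀ i M → fun (h i) M ≈ fun (h′ i) M) →
                     ∀ M → fun (combination s b h) M ≈ fun (combination s b h′) M
  combination-cong {s = s} b h≈h′ M = Σ-cong s (λ i → *-congˡ (h≈h′ i M))

  module SharedColumns (d ℓ₀ r : ℕ) (r≤d : r ≤ d) where
    open Divisor d ℓ₀

    first : Fin (suc r) → Fin m
    first zero    = d ↑ʳ zero
    first (suc i) = inject≤ i r≤d ↑ˡ ℓ

    tuple : Fin (suc r) → Fin ℓ → Fin m
    tuple y = first y ◂ (λ s → d ↑ʳ suc s)

    first≤d : ∀ y → toℕ (first y) ≤ d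
    first≤d zero    = ℕ.≤-reflexive (≡.trans (Fin.toℕ-↑ʳ d (zero {ℓ₀})) (ℕ.+-identityʳ d))
    first≤d (suc i) = ℕ.<⇒≤ (≡.subst (ℕ._< d) (≡.sym (Fin.toℕ-↑ˡ (inject≤ i r≤d) ℓ)) (Fin.toℕ<n (inject≤ i r≤d)))

    increasing : ∀ y → StrictlyIncreasing (tuple y)
    increasing y {zero}  {suc j} _ = ℕ.≤-trans (s≤s (first≤d y))
      (ℕ.≤-trans (ℕ.≤-trans (ℕ.≤-reflexive (ℕ.+-comm 1 d)) (ℕ.+-monoʳ-≤ d (s≤s z≤n))) (ℕ.≤-reflexive (≡.sym (Fin.toℕ-↑ʳ d (suc j)))))
    increasing y {suc i} {suc j} (s≤s i<j) = ≡.subst₂ ℕ._<_ (≡.sym (Fin.toℕ-↑ʳ d (suc i))) (≡.sym (Fin.toℕ-↑ʳ d (suc j)))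
      (ℕ.+-monoʳ-< d (s≤s i<j))

    tuple-zero : ∀ s → tuple zero s ≡ d ↑ʳ s
    tuple-zero zero    = ≡.refl
    tuple-zero (suc s) = ≡.refl

    left≢right : ∀ (i : Fin d) (s : Fin ℓ) → i ↑ˡ ℓ ≢ d ↑ʳ s
    left≢right i s h = ℕ.<⇒≱ (Fin.toℕ<n i) (ℕ.≤-trans (ℕ.m≤m+n d (toℕ s)) (ℕ.≤-reflexive
      (≡.trans (≡.sym (Fin.toℕ-↑ʳ d s)) (≡.trans (≡.cong toℕ (≡.sym h)) (Fin.toℕ-↑ˡ i ℓ)))))

    separated : ∀ {y z} → y ≢ z → ∃ λ s → ∀ t → tuple y s ≢ tuple z t
    separated {y} {z} y≢z = zero , apart y z y≢z
      where
      apart : ∀ y z → y ≢ z → ∀ t → first y ≢ tuple z t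
      apart zero    zero    y≢z _       _ = y≢z ≡.refl
      apart zero    (suc j) _   zero    h = left≢right _ zero (≡.sym h)
      apart zero    _       _   (suc t) h with () ← Fin.↑ʳ-injective d zero (suc t) h
      apart (suc i) zero    _   zero    h = left≢right _ zero h
      apart (suc i) (suc j) y≢z zero    h = y≢z (≡.cong suc (Fin.inject≤-injective r≤d r≤d i j (Fin.↑ˡ-injective ℓ _ _ h)))
      apart (suc i) _       _   (suc t) h = left≢right _ (suc t) h

    -- The minors share all columns but the first. A row v that is zero on the shared columns
    -- contributes `v (first y)` times a cofactor that is the same for all y, so one more condition,
    -- Σ b y * v (first y) = 0, puts v into the radical.
    radical : ∀ (b : V (suc r)) → ∃ λ (X : Mat ℓ m) →
              ∀ v → (∀ i → Σ m (λ k → v k * X i k) ≈ 0#) → Rad (combination (suc r) b (λ y → minorForm (tuple y))) v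
    radical b = X , rad
      where
      X : Mat ℓ m
      X zero    = rowCombination b (e ∘ first)
      X (suc s) = e (d ↑ʳ suc s)
      rad : ∀ v → (∀ i → Σ m (λ k → v k * X i k) ≈ 0#) → Rad (combination (suc r) b (λ y → minorForm (tuple y))) v
      rad v ann M = begin
        Σ (suc r) (λ y → b y * det 𝔽 ℓ (λ i s → (v ◂ M) i (tuple y s)))   ≈⟨ Σ-cong (suc r) (λ y → *-congˡ {b y} (expand y)) ⟩
        Σ (suc r) (λ y → b y * (v (first y) * D))                          ≈⟨ Σ-cong (suc r) (λ y → sym (*-assoc (b y) (v (first y)) D)) ⟩
        Σ (suc r) (λ y → b y * v (first y) * D)                            ≈⟨ Σ-*ʳ (suc r) (λ y → b y * v (first y)) D ⟩
        Σ (suc r) (λ y → b y * v (first y)) * D                            ≈⟨ *-congʳ {D} Σbv≈0 ⟩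
        0# * D                                                             ≈⟨ zeroˡ D ⟩
        0#                                                                 ∎
        where
        open ≈-Reasoning
        D : Carrier
        D = det 𝔽 ℓ₀ (λ i s → M i (d ↑ʳ suc s))
        expand : ∀ y → det 𝔽 ℓ (λ i s → (v ◂ M) i (tuple y s)) ≈ v (first y) * D
        expand y = trans (det-pivot ℓ₀ (λ i s → (v ◂ M) i (tuple y s)) zero
          (λ { zero 0≢0 → contradiction ≡.refl 0≢0 ; (suc s) _ → trans (*-congʳ (trans (sym (dot-e v (d ↑ʳ suc s))) (ann (suc s)))) (zeroˡ _) }))
          (*-identityˡ _)
        Σbv≈0 : Σ (suc r) (λ y → b y * v (first y)) ≈ 0#
        Σbv≈0 = begin
          Σ (suc r) (λ y → b y * v (first y))                          ≈⟨ Σ-cong (suc r) (λ y → *-congˡ {b y} (sym (trans (Σ-cong m (λ k → *-comm _ _)) (dot-e v (first y))))) ⟩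
          Σ (suc r) (λ y → b y * Σ m (λ k → e (first y) k * v k))      ≈⟨ ⊡-row b (e ∘ first) (λ k (_ : Fin 1) → v k) zero ⟩
          Σ m (λ k → X zero k * v k)                                   ≈⟨ Σ-cong m (λ k → *-comm _ _) ⟩
          Σ m (λ k → v k * X zero k)                                   ≈⟨ ann zero ⟩
          0#                                                           ∎

    family : Family d ℓ₀ r
    family = record { tuple = tuple ; increasing = increasing ; tuple-zero = tuple-zero ; separated = separated ; radical = λ b _ → radical b }

  module OmittedColumn (d₀ ℓ₀ r : ℕ) (r≤ℓ : r ≤ suc ℓ₀) where
    private d = suc d₀
    open Divisor d ℓ₀

    -- The last ℓ + 1 columns, starting at index d₀ = d - 1; omitting the first of them leaves the
    -- columns of p.
    column : Fin (suc ℓ) → Fin m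
    column zero    = fromℕ d₀ ↑ˡ ℓ
    column (suc s) = d ↑ʳ s

    toℕ-column : ∀ t → toℕ (column t) ≡ d₀ ℕ.+ toℕ t
    toℕ-column zero    = ≡.trans (Fin.toℕ-↑ˡ (fromℕ d₀) ℓ) (≡.trans (Fin.toℕ-fromℕ d₀) (≡.sym (ℕ.+-identityʳ d₀)))
    toℕ-column (suc s) = ≡.trans (Fin.toℕ-↑ʳ d s) (≡.sym (ℕ.+-suc d₀ (toℕ s)))

    column-injective : ∀ {t t′} → column t ≡ column t′ → t ≡ t′
    column-injective {t} {t′} h = Fin.toℕ-injective (ℕ.+-cancelˡ-≡ d₀ _ _
      (≡.trans (≡.sym (toℕ-column t)) (≡.trans (≡.cong toℕ h) (toℕ-column t′))))

    omitted : Fin (suc r) → Fin (suc ℓ)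
    omitted y = inject≤ y (s≤s r≤ℓ)

    omitted-injective : ∀ {y z} → omitted y ≡ omitted z → y ≡ z
    omitted-injective = Fin.inject≤-injective (s≤s r≤ℓ) (s≤s r≤ℓ) _ _

    tuple : Fin (suc r) → Fin ℓ → Fin m
    tuple y s = column (punchIn (omitted y) s)

    punchIn-mono-< : ∀ {n} t {i j : Fin n} → i Fin.< j → punchIn t i Fin.< punchIn t j
    punchIn-mono-< t {i} {j} i<j = ℕ.≤∧≢⇒< (Fin.punchIn-mono-≤ t i j (ℕ.<⇒≤ i<j))
      (λ h → ℕ.<⇒≢ i<j (≡.cong toℕ (Fin.punchIn-injective t i j (Fin.toℕ-injective h))))

    increasing : ∀ y → StrictlyIncreasing (tuple y)
    increasing y {i} {j} i<j = ≡.subst₂ ℕ._<_ (≡.sym (toℕ-column (punchIn (omitted y) i))) (≡.sym (toℕ-column (punchIn (omitted y) j)))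
      (ℕ.+-monoʳ-< d₀ (punchIn-mono-< (omitted y) i<j))

    separated : ∀ {y z} → y ≢ z → ∃ λ s → ∀ t → tuple y s ≢ tuple z t
    separated {y} {z} y≢z = punchOut y≢z′ , λ t h → Fin.punchInᵢ≢i (omitted z) t (≡.sym
        (≡.trans (≡.sym (Fin.punchIn-punchOut y≢z′)) (column-injective h)))
      where
      y≢z′ : omitted y ≢ omitted z
      y≢z′ = y≢z ∘ omitted-injective

    module _ (b : V (suc r)) (b≉0 : ¬ (b ≋ (λ _ → 0#))) where
      private
        pivotRow : ∃ λ y → ¬ (b y ≈ 0#)
        pivotRow = Fin.¬∀⟶∃¬ (suc r) (λ y → b y ≈ 0#) (λ y → b y ≟ 0#) b≉0
        signed : V (suc r)
        signed y = b y * sgn (omitted y)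
        normal : V (suc ℓ)
        normal = rowCombination signed (e ∘ omitted)
        t₀ : Fin (suc ℓ)
        t₀ = omitted (proj₁ pivotRow)
        normal-t₀ : normal t₀ ≈ signed (proj₁ pivotRow)
        normal-t₀ = trans (Σ-single (suc r) (λ y → signed y * e (omitted y) t₀) (proj₁ pivotRow) (λ y y≢ → trans (*-congˡ {signed y} (e-diff (y≢ ∘ omitted-injective))) (zeroʳ _)))
          (trans (*-congˡ (e-same t₀ ≡.refl)) (*-identityʳ _))
        normal-t₀≉0 : ¬ (normal t₀ ≈ 0#)
        normal-t₀≉0 h = sgn≉0 t₀ (*-≈0 (proj₂ pivotRow) (trans (sym normal-t₀) h))
        top = detForm (suc ℓ)

      -- The minors that omit one column are the cofactors of an added top row. Any combination of
      -- them is therefore a single determinant of size ℓ + 1, with the signs in `signed` cancelling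
      -- those of the expansion.
      combination≈det : ∀ M → fun (combination (suc r) b (λ y → minorForm (tuple y))) M ≈ det 𝔽 (suc ℓ) (normal ◂ λ i → M i ∘ column)
      combination≈det M = sym (begin
        det 𝔽 (suc ℓ) (normal ◂ K)                                                       ≈⟨ Σ-linear₀ top (suc r) signed (e ∘ omitted) K ⟩
        Σ (suc r) (λ y → signed y * det 𝔽 (suc ℓ) (e (omitted y) ◂ K))                   ≈⟨ Σ-cong (suc r) term ⟩
        Σ (suc r) (λ y → b y * det 𝔽 ℓ (λ i s → M i (tuple y s)))                        ∎)
        where
        open ≈-Reasoning
        K : Mat ℓ (suc ℓ)
        K i = M i ∘ column
        term : ∀ y → signed y * det 𝔽 (suc ℓ) (e (omitted y) ◂ K) ≈ b y * det 𝔽 ℓ (λ i s → M i (tuple y s))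
        term y = cancel-sign (det-e◂ ℓ (omitted y) K)
          where
          cancel-sign : ∀ {x z} → x ≈ sgn (omitted y) * z → signed y * x ≈ b y * z
          cancel-sign {x} {z} h = trans (*-congˡ h) (trans
            (solve 3 (λ b s z → (b :* s) :* (s :* z) := b :* ((s :* s) :* z)) refl (b y) (sgn (omitted y)) z)
            (*-congˡ (trans (*-congʳ (sgn*sgn (omitted y))) (*-identityˡ z))))

      -- The common kernel of the rows consists of the v proportional to the normal vector on the last ℓ + 1 columns.
      conditions : Mat ℓ m
      conditions s k = normal t₀ * e (column (punchIn t₀ s)) k + - normal (punchIn t₀ s) * e (column t₀) k

      proportional : ∀ v → (∀ i → Σ m (λ k → v k * conditions i k) ≈ 0#) → ∀ t → normal t₀ * v (column t) ≈ v (column t₀) * normal t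
      proportional v ann t with t₀ Fin.≟ t
      ... | yes ≡.refl = *-comm _ _
      ... | no t₀≢t    = ≡.subst (λ u → normal t₀ * v (column u) ≈ v (column t₀) * normal u) (Fin.punchIn-punchOut t₀≢t) (at (punchOut t₀≢t))
        where
        open ≈-Reasoning
        at : ∀ s → normal t₀ * v (column (punchIn t₀ s)) ≈ v (column t₀) * normal (punchIn t₀ s)
        at s = begin
          x                                                   ≈⟨ sym (+-identityʳ x) ⟩
          x + 0#                                              ≈⟨ +-congˡ (sym (-‿inverseˡ y)) ⟩
          x + (- y + y)                                       ≈⟨ sym (+-assoc _ _ _) ⟩
          (x + - y) + y                                       ≈⟨ +-congʳ (trans (sym expand) (ann s)) ⟩
          0# + y                                              ≈⟨ +-identityˡ y ⟩
          y                                                   ≈⟨ *-comm _ _ ⟩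
          v (column t₀) * normal (punchIn t₀ s)               ∎
          where
          x = normal t₀ * v (column (punchIn t₀ s))
          y = normal (punchIn t₀ s) * v (column t₀)
          expand : Σ m (λ k → v k * conditions s k) ≈ x + - y
          expand = begin
            Σ m (λ k → v k * conditions s k)
              ≈⟨ Σ-cong m (λ k → solve 5 (λ v a p b r → v :* (a :* p :+ b :* r) := a :* (v :* p) :+ b :* (v :* r)) refl
                   (v k) (normal t₀) (e (column (punchIn t₀ s)) k) (- normal (punchIn t₀ s)) (e (column t₀) k)) ⟩
            Σ m (λ k → normal t₀ * (v k * e (column (punchIn t₀ s)) k) + - normal (punchIn t₀ s) * (v k * e (column t₀) k))
              ≈⟨ Σ-lin m (normal t₀) (- normal (punchIn t₀ s)) (λ k → v k * e (column (punchIn t₀ s)) k) (λ k → v k * e (column t₀) k) ⟩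
            normal t₀ * Σ m (λ k → v k * e (column (punchIn t₀ s)) k) + - normal (punchIn t₀ s) * Σ m (λ k → v k * e (column t₀) k)
              ≈⟨ +-cong (*-congˡ (dot-e v _)) (trans (*-congˡ (dot-e v _)) (sym (-‿distribˡ-* _ _))) ⟩
            x + - y ∎

      -- On the chosen columns v is proportional to `normal`, which is already a row of the
      -- determinant. Multiplication by `normal t₀` takes the place of a division.
      radical : ∀ v → (∀ i → Σ m (λ k → v k * conditions i k) ≈ 0#) → Rad (combination (suc r) b (λ y → minorForm (tuple y))) v
      radical v ann M = trans (combination≈det (v ◂ M)) (trans (cong g {λ i → (v ◂ M) i ∘ column} {(v ∘ column) ◂ K} (λ { zero j → refl ; (suc i) j → refl }))
        (*-≈0 normal-t₀≉0 (begin
          normal t₀ * fun g ((v ∘ column) ◂ K)                                       ≈⟨ sym (+-identityʳ _) ⟩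
          normal t₀ * fun g ((v ∘ column) ◂ K) + 0#                                  ≈⟨ +-congˡ (sym (zeroˡ _)) ⟩
          -- The summand with coefficient `0#` only gives a scalar multiple the shape that `linear₀`
          -- expects.
          normal t₀ * fun g ((v ∘ column) ◂ K) + 0# * fun g ((v ∘ column) ◂ K)       ≈⟨ sym (linear₀ g (normal t₀) 0# (v ∘ column) (v ∘ column) K) ⟩
          fun g ((λ t → normal t₀ * v (column t) + 0# * v (column t)) ◂ K)           ≈⟨ cong g (◂-cong {M = K} {K} (λ t → +-cong (proportional v ann t) (trans (zeroˡ (v (column t))) (sym (zeroˡ (normal t))))) (λ _ _ → refl)) ⟩
          fun g ((λ t → v (column t₀) * normal t + 0# * normal t) ◂ K)               ≈⟨ Rad-linear g (v (column t₀)) 0# {normal} {normal} (Rad-contract-self top normal) (Rad-contract-self top normal) K ⟩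
          0#                                                                         ∎)))
        where
        open ≈-Reasoning
        g = contract top normal
        K : Mat ℓ₀ (suc ℓ)
        K i = M i ∘ column

    family : Family d ℓ₀ r
    family = record { tuple = tuple ; increasing = increasing ; tuple-zero = λ _ → ≡.refl ; separated = separated
                    ; radical = λ b b≉0 → conditions b b≉0 , radical b b≉0 }

  -- This is (q - 1) q^r Σ q^(δ-i) = (q^r - 1) q^δ with the negative term moved across; `r ≤ δ`
  -- keeps the exponents `δ ∸ i` from being truncated.
  geometric-sum : ∀ δ r → r ≤ δ → (q ∸ 1) ℕ.* q ^ r ℕ.* sumℕ₁ r (λ i → q ^ (δ ∸ i)) ℕ.+ q ^ δ ≡ q ^ r ℕ.* q ^ δ
  geometric-sum δ zero    _   = ≡.trans (≡.cong (ℕ._+ q ^ δ) (ℕ.*-zeroʳ ((q ∸ 1) ℕ.* 1))) (≡.sym (ℕ.*-identityˡ _))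
  geometric-sum δ (suc r) r<δ = begin
    q′ ℕ.* (q ℕ.* R) ℕ.* (G ℕ.+ x) ℕ.+ q ^ δ                  ≡⟨ solveℕ 6 (λ q′ q R G x y → q′ :*ℕ (q :*ℕ R) :*ℕ (G :+ℕ x) :+ℕ y :=ℕ q :*ℕ (q′ :*ℕ R :*ℕ G) :+ℕ (q′ :*ℕ (q :*ℕ R :*ℕ x) :+ℕ y)) ≡.refl q′ q R G x (q ^ δ) ⟩
    q ℕ.* (q′ ℕ.* R ℕ.* G) ℕ.+ (q′ ℕ.* (q ℕ.* R ℕ.* x) ℕ.+ q ^ δ) ≡⟨ ≡.cong (λ z → q ℕ.* (q′ ℕ.* R ℕ.* G) ℕ.+ (q′ ℕ.* z ℕ.+ q ^ δ)) qRx≡ ⟩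
    q ℕ.* (q′ ℕ.* R ℕ.* G) ℕ.+ (q′ ℕ.* q ^ δ ℕ.+ q ^ δ)       ≡⟨ ≡.cong (q ℕ.* (q′ ℕ.* R ℕ.* G) ℕ.+_) (≡.trans (ℕ.+-comm _ (q ^ δ)) (≡.cong (ℕ._* q ^ δ) (ℕ.m+[n∸m]≡n {1} {q} (ℕ.<⇒≤ 1<q)))) ⟩
    q ℕ.* (q′ ℕ.* R ℕ.* G) ℕ.+ q ℕ.* q ^ δ                    ≡⟨ ≡.sym (ℕ.*-distribˡ-+ q _ _) ⟩
    q ℕ.* (q′ ℕ.* R ℕ.* G ℕ.+ q ^ δ)                          ≡⟨ ≡.cong (q ℕ.*_) (geometric-sum δ r (ℕ.<⇒≤ r<δ)) ⟩
    q ℕ.* (R ℕ.* q ^ δ)                                       ≡⟨ ≡.sym (ℕ.*-assoc q R _) ⟩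
    q ^ suc r ℕ.* q ^ δ                                       ∎
    where
    open ≡.≡-Reasoning
    q′ R G x : ℕ
    q′ = q ∸ 1
    R = q ^ r
    G = sumℕ₁ r (λ i → q ^ (δ ∸ i))
    x = q ^ (δ ∸ suc r)
    qRx≡ : q ℕ.* R ℕ.* x ≡ q ^ δ
    qRx≡ = ≡.trans (≡.sym (ℕ.^-distribˡ-+-* q (suc r) (δ ∸ suc r))) (≡.cong (q ^_) (ℕ.m+[n∸m]≡n r<δ))

  -- The higher weights of the divisor code

  module HigherWeights (d₀ ℓ₀ : ℕ) (reps : List (Mat (suc ℓ₀) (suc d₀ ℕ.+ suc ℓ₀)))
                       (enumerates : EnumeratesSchubert 𝔽 (etaDiv (suc ℓ₀) (suc d₀ ℕ.+ suc ℓ₀)) reps) where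
    open Divisor (suc d₀) ℓ₀
    open Fibres (suc d₀) ℓ₀ reps enumerates

    d δ B : ℕ
    d = suc d₀
    δ = ℓ ℕ.* d
    B = q ^ δ ℕ.* Γ ℓ

    -- In dimension d + ℓ, the ℓ conditions leave d independent radical vectors, as many as `N≤DΓ`
    -- asks for.
    N-upper-kernel : (g : Form ℓ m) (X : Mat ℓ m) → (∀ v → (∀ i → Σ m (λ k → v k * X i k) ≈ 0#) → Rad g v) → N g ≤ B
    N-upper-kernel g X h with C , C-indep , ann ← kernel ℓ {d} X (ℕ.+-comm d ℓ) = N≤DΓ d ℓ₀ g {C} C-indep (λ i → h (C i) (ann i))

    last-increasing : StrictlyIncreasing (λ (s : Fin ℓ) → d ↑ʳ s)
    last-increasing {i} {j} i<j = ≡.subst₂ ℕ._<_ (≡.sym (Fin.toℕ-↑ʳ d i)) (≡.sym (Fin.toℕ-↑ʳ d j)) (ℕ.+-monoʳ-< d i<j)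

    p-at-e : fun p (e ∘ (d ↑ʳ_)) ≈ 1#
    p-at-e = minor-at-e-same (d ↑ʳ_) last-increasing

    Np≡B : N p ≡ B
    Np≡B = ℕ.≤-antisym
      (N-upper-kernel p (e ∘ (d ↑ʳ_)) (λ v ann M → zero-row (detForm ℓ) zero {λ i s → (v ◂ M) i (d ↑ʳ s)} (λ s → trans (sym (dot-e v (d ↑ʳ s))) (ann s))))
      (DΓ≤N d ℓ₀ p {e ∘ (d ↑ʳ_)} (λ h → 0≉1 (trans (sym h) p-at-e)))

    instance
      Γ-nonZero : ℕ.NonZero (Γ ℓ)
      Γ-nonZero = ℕ.>-nonZero (Γ>0 ℓ)

    module _ (r W Y : ℕ) (Y≡ : Y ≡ W ℕ.* Γ ℓ) where
      private
        weighted : ℕ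
        weighted = (q ∸ 1) ℕ.* q ^ r ℕ.* W ℕ.+ q ^ δ
        scaled : (q ∸ 1) ℕ.* q ^ r ℕ.* Y ℕ.+ B ≡ weighted ℕ.* Γ ℓ
        scaled = ≡.trans (≡.cong (λ y → (q ∸ 1) ℕ.* q ^ r ℕ.* y ℕ.+ B) Y≡)
          (solveℕ 5 (λ q′ R W G D → q′ :*ℕ R :*ℕ (W :*ℕ G) :+ℕ D :*ℕ G :=ℕ (q′ :*ℕ R :*ℕ W :+ℕ D) :*ℕ G) ≡.refl (q ∸ 1) (q ^ r) W (Γ ℓ) (q ^ δ))
        scaled′ : q ^ r ℕ.* B ≡ (q ^ r ℕ.* q ^ δ) ℕ.* Γ ℓ
        scaled′ = ≡.sym (ℕ.*-assoc (q ^ r) (q ^ δ) (Γ ℓ))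
        instance
          coefficient-nonZero : ℕ.NonZero ((q ∸ 1) ℕ.* q ^ r)
          coefficient-nonZero = ℕ.>-nonZero (ℕ.*-mono-≤ (ℕ.∸-monoˡ-≤ 1 1<q) (0<q^ r))

      -- Division by `Γ ℓ` and then by (q - 1) q^r passes from the count of tuples to the weight.
      geometric-lower : r ≤ δ → q ^ r ℕ.* B ≤ (q ∸ 1) ℕ.* q ^ r ℕ.* Y ℕ.+ B → sumℕ₁ r (λ i → q ^ (δ ∸ i)) ≤ W
      geometric-lower r≤δ h = ℕ.*-cancelˡ-≤ ((q ∸ 1) ℕ.* q ^ r) (ℕ.+-cancelʳ-≤ (q ^ δ) _ _
        (≡.subst (ℕ._≤ weighted) (≡.sym (geometric-sum δ r r≤δ)) (ℕ.*-cancelʳ-≤ (q ^ r ℕ.* q ^ δ) weighted (Γ ℓ) (≡.subst₂ _≤_ scaled′ scaled h))))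

      geometric-upper : r ≤ δ → (q ∸ 1) ℕ.* q ^ r ℕ.* Y ℕ.+ B ≤ q ^ r ℕ.* B → W ≤ sumℕ₁ r (λ i → q ^ (δ ∸ i))
      geometric-upper r≤δ h = ℕ.*-cancelˡ-≤ ((q ∸ 1) ℕ.* q ^ r) (ℕ.+-cancelʳ-≤ (q ^ δ) _ _
        (≡.subst (weighted ℕ.≤_) (≡.sym (geometric-sum δ r r≤δ)) (ℕ.*-cancelʳ-≤ weighted (q ^ r ℕ.* q ^ δ) (Γ ℓ) (≡.subst₂ _≤_ scaled scaled′ h))))

    module _ {r} (w : Fin r → V (length reps)) (codewords : ∀ i → IsCodeword 𝔽 reps (w i)) (w-indep : LinIndep 𝔽 w) where
      private
        a : Fin r → Form ℓ m
        a i = evalForm (proj₁ (codewords i))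
        w≈ : ∀ i j → w i j ≈ fun (a i) (rep j)
        w≈ i j = trans (proj₂ (codewords i) j) (evalFunctional≈evalForm (proj₁ (codewords i)) (rep j))

        -- If only p occurs, the basis vectors of its own columns are a nonzero. Otherwise
        -- independence of the words yields a representative at which their combination is nonzero,
        -- and p vanishes there.
        combination-nonzero : ∀ (b : V (suc r)) → ¬ (b ≋ (λ _ → 0#)) → ∃ λ M → ¬ (fun (combination (suc r) b (p ◂ a)) M ≈ 0#)
        combination-nonzero b b≉0 with zero? (b ∘ suc)
        ... | yes b′≈0 = e ∘ (d ↑ʳ_) , λ h → b≉0 λ { zero → b₀≈0 h ; (suc i) → b′≈0 i }
          where
          b₀≈0 : fun (combination (suc r) b (p ◂ a)) (e ∘ (d ↑ʳ_)) ≈ 0# → b zero ≈ 0#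
          b₀≈0 h = trans (sym (trans (*-congˡ p-at-e) (*-identityʳ (b zero))))
            (+-≈0 h (Σ-≈0 r (λ i → trans (*-congʳ (b′≈0 i)) (zeroˡ _))))
        ... | no b′≉0 with zero? (λ j → Σ r (λ i → b (suc i) * w i j))
        ...   | yes bw≈0 = contradiction (w-indep (b ∘ suc) bw≈0) b′≉0
        ...   | no bw≉0 with j , bwj≉0 ← Fin.¬∀⟶∃¬ (length reps) (λ j → Σ r (λ i → b (suc i) * w i j) ≈ 0#) (λ j → _ ≟ 0#) bw≉0 =
          rep j , λ h → bwj≉0 (trans (Σ-cong r (λ i → *-congˡ {b (suc i)} (w≈ i j)))
            (+-≈0 (trans (+-comm _ _) h) (trans (*-congˡ {b zero} (schubert⇒p≈0 {rep j} (schubert j))) (zeroʳ (b zero)))))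

      supportSize-lower : r ≤ δ → sumℕ₁ r (λ i → q ^ (δ ∸ i)) ≤ supportSize 𝔽 w
      supportSize-lower r≤δ = ℕ.≤-trans
        (geometric-lower r (weightOf w) (sectionSupport p a) (section≡weight*Γ a w w≈) r≤δ
          (section-lower p a B Np≡B (λ b b≉0 → DΓ≤N d ℓ₀ (combination (suc r) b (p ◂ a)) {proj₁ (combination-nonzero b b≉0)} (proj₂ (combination-nonzero b b≉0)))))
        (ℕ.≤-reflexive (≡.sym (supportSize≡weightOf w)))

    -- The tuples of the section are frames over the representatives. This carries a relation
    -- between codewords over to tuples of basis vectors, which need not be among the
    -- representatives.
    vanishes-on-section : ∀ {r} (a : Fin r → Form ℓ m) M → fun p M ≈ 0# × ¬ (∀ i → fun (a i) M ≈ 0#) →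
                          ∀ (g : Form ℓ m) → (∀ j → fun g (rep j) ≈ 0#) → fun g M ≈ 0#
    vanishes-on-section a M M∈section g g≈0 = conclude (section⇒frame a (λ i j → fun (a i) (rep j)) (λ _ _ → refl) M M∈section)
      where
      conclude : (∃ λ (x : Fin (length reps) × Mat ℓ ℓ) →
                   (¬ (∀ i → fun (a i) (rep (proj₁ x)) ≈ 0#) × ¬ (det 𝔽 ℓ (proj₂ x) ≈ 0#)) × (∀ i → (proj₂ x ⊡ rep (proj₁ x)) i ≋ M i)) →
                 fun g M ≈ 0#
      conclude ((j , A) , (_ , detA≉0) , AR≈M) = trans (cong g {M} {A ⊡ rep j} (λ i t → sym (AR≈M i t))) (times-zero g {A} detA≉0 (rep j) (g≈0 j))

    module _ {r} (𝓕 : Family d ℓ₀ r) where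
      open Family 𝓕
      private
        a : Fin r → Form ℓ m
        a i = minorForm (tuple (suc i))

      word : Fin r → V (length reps)
      word i j = fun (a i) (rep j)

      word-codeword : ∀ i → IsCodeword 𝔽 reps (word i)
      word-codeword i = indicator (Vec.tabulate (tuple (suc i))) ,
        λ j → sym (evalFunctional-indicator (tuple (suc i)) (increasing (suc i)) (rep j))

      p≈minor : ∀ M → fun p M ≈ fun (minorForm (tuple zero)) M
      p≈minor M = det-cong ℓ (λ i s → reflexive (≡.cong (M i) (≡.sym (tuple-zero s))))

      -- The relation is evaluated at the basis vectors of the tuple of the k-th word, where its
      -- minor is 1 while p and the minors of the other words vanish. This tuple lies in the
      -- section, so a relation between the words holds there too.
      word-indep : LinIndep 𝔽 word
      word-indep x h k = trans (sym x*a≈x) (trans (sym (Σ-single r (λ i → x i * fun (a i) M) k others)) g≈0)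
        where
        M : Mat ℓ m
        M = e ∘ tuple (suc k)
        aₖ≈1 : fun (a k) M ≈ 1#
        aₖ≈1 = minor-at-e-same (tuple (suc k)) (increasing (suc k))
        x*a≈x : x k * fun (a k) M ≈ x k
        x*a≈x = trans (*-congˡ aₖ≈1) (*-identityʳ (x k))
        others : ∀ i → i ≢ k → x i * fun (a i) M ≈ 0#
        others i i≢k = trans (*-congˡ (minor-at-e-other (tuple (suc i)) (tuple (suc k)) (separated (i≢k ∘ Fin.suc-injective)))) (zeroʳ (x i))
        g : Form ℓ m
        g = combination r x a
        M∈section : fun p M ≈ 0# × ¬ (∀ i → fun (a i) M ≈ 0#)
        M∈section = trans (p≈minor M) (minor-at-e-other (tuple zero) (tuple (suc k)) (separated (λ ()))) ,
          λ a≈0 → 0≉1 (trans (sym (a≈0 k)) aₖ≈1)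
        g≈0 : fun g M ≈ 0#
        g≈0 = vanishes-on-section a M M∈section g h

      word-weight : r ≤ δ → supportSize 𝔽 word ≡ sumℕ₁ r (λ i → q ^ (δ ∸ i))
      word-weight r≤δ = ℕ.≤-antisym
        (ℕ.≤-trans (ℕ.≤-reflexive (supportSize≡weightOf word))
          (geometric-upper r (weightOf word) (sectionSupport p a) (section≡weight*Γ a word (λ _ _ → refl)) r≤δ
            (section-upper p a B Np≡B bound)))
        (supportSize-lower word word-codeword word-indep r≤δ)
        where
        minors : Fin (suc r) → Form ℓ m
        minors y = minorForm (tuple y)
        bound : ∀ b → ¬ (b ≋ (λ _ → 0#)) → N (combination (suc r) b (p ◂ a)) ≤ B
        bound b b≉0 = ℕ.≤-trans
          (ℕ.≤-reflexive (N-cong (combination (suc r) b (p ◂ a)) (combination (suc r) b minors)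
            (combination-cong b {p ◂ a} {minors} (λ { zero M → p≈minor M ; (suc i) M → refl }))))
          (N-upper-kernel (combination (suc r) b minors) (proj₁ (radical b b≉0)) (proj₂ (radical b b≉0)))

    family : ∀ r → r ≤ ℓ ⊔ d → Family d ℓ₀ r
    family r r≤ with ℕ.⊔-sel ℓ d
    ... | inj₁ ⊔≡ℓ = OmittedColumn.family d₀ ℓ₀ r (ℕ.≤-trans r≤ (ℕ.≤-reflexive ⊔≡ℓ))
    ... | inj₂ ⊔≡d = SharedColumns.family d ℓ₀ r (ℕ.≤-trans r≤ (ℕ.≤-reflexive ⊔≡d))

    higherWeight : ∀ r → r ≤ ℓ ⊔ d → IsHigherWeight 𝔽 (IsCodeword 𝔽 reps) r (sumℕ₁ r (λ i → q ^ (δ ∸ i)))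
    higherWeight r r≤ = (word 𝓕 , word-codeword 𝓕 , word-indep 𝓕 , word-weight 𝓕 r≤δ) ,
      λ w codewords w-indep → supportSize-lower w codewords w-indep r≤δ
      where
      𝓕 = family r r≤
      r≤δ : r ≤ δ
      r≤δ = ℕ.≤-trans r≤ (ℕ.⊔-lub (ℕ.m≤m*n ℓ d) (ℕ.m≤n*m d ℓ))

  -- `D` is a variable tied to `m ∸ ℓ` by an equation: once m is replaced by `suc d₀ + suc ℓ₀`, the
  -- difference does not reduce to `suc d₀`, but matching on the equation substitutes it.
  higherWeights-divisor : ∀ ℓ m D → 1 ≤ ℓ → ℓ < m → m ∸ ℓ ≡ D →
    (reps : List (Mat ℓ m)) → EnumeratesSchubert 𝔽 (etaDiv ℓ m) reps →
    ∀ r → r ≤ ℓ ⊔ D → IsHigherWeight 𝔽 (IsCodeword 𝔽 reps) r (sumℕ₁ r (λ i → q ^ (ℓ ℕ.* D ∸ i)))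
  higherWeights-divisor (suc ℓ₀) m D _ ℓ<m m∸ℓ≡D reps enumerates with d₀ , eq ← ℕ.m≤n⇒∃[o]m+o≡n ℓ<m
    with ≡.refl ← ≡.trans (≡.cong suc (ℕ.+-comm d₀ (suc ℓ₀))) eq
    with ≡.refl ← ≡.trans (≡.sym m∸ℓ≡D) (ℕ.m+n∸n≡m (suc d₀) (suc ℓ₀)) = HigherWeights.higherWeight d₀ ℓ₀ reps enumerates

-- The exponent of the minimum distance

deltaOf-shift : ∀ n D (α : Fin n → ℕ) → (∀ k → α k ≡ D ℕ.+ suc (toℕ k)) → deltaOf n α ≡ n ℕ.* D
deltaOf-shift zero    D α h = ≡.refl
-- `deltaOf` lowers the remaining entries by one at each step, which restores the pattern D + (k +
-- 1) for the shifted index.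
deltaOf-shift (suc n) D α h = ≡.cong₂ ℕ._+_ (≡.cong (_∸ 1) (≡.trans (h zero) (ℕ.+-comm D 1)))
  (deltaOf-shift n D (λ k → α (suc k) ∸ 1) (λ k → ≡.cong (_∸ 1) (≡.trans (h (suc k)) (ℕ.+-suc D (suc (toℕ k))))))

-- Every entry of η but the first contributes m - ℓ; the first is one short of the pattern and
-- accounts for the - 1. The hypothesis keeps its subtraction from being truncated.
deltaOf-etaDiv : ∀ ℓ₀ m → 1 ≤ m ∸ suc ℓ₀ → deltaOf (suc ℓ₀) (etaDiv (suc ℓ₀) m) ≡ suc ℓ₀ ℕ.* (m ∸ suc ℓ₀) ∸ 1
deltaOf-etaDiv ℓ₀ m 1≤D = ≡.trans
  (≡.cong (m ∸ suc ℓ₀ ∸ 1 ℕ.+_) (deltaOf-shift ℓ₀ (m ∸ suc ℓ₀) _ (λ k → ≡.cong (_∸ 1) (ℕ.+-suc (m ∸ suc ℓ₀) (suc (toℕ k))))))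
  (≡.sym (ℕ.+-∸-comm (ℓ₀ ℕ.* (m ∸ suc ℓ₀)) 1≤D))

open import Data.Nat using (_*_)

theorem4p1 : ∀ {c ℓ'} (𝔽 : FiniteField c ℓ') (ℓ m : ℕ) → 1 < ℓ → ℓ < m →
    (reps : List (Matrix 𝔽 ℓ m)) → EnumeratesSchubert 𝔽 (etaDiv ℓ m) reps →
    (∀ r → 1 ≤ r → r ≤ ℓ ⊔ (m ∸ ℓ) →
    IsHigherWeight 𝔽 (IsCodeword 𝔽 reps) r
    (sumℕ₁ r (λ i → FiniteField.q 𝔽 ^ ((ℓ * (m ∸ ℓ)) ∸ i))))
    × (deltaOf ℓ (etaDiv ℓ m) ≡ (ℓ * (m ∸ ℓ)) ∸ 1)
theorem4p1 𝔽 (suc ℓ₀) m 1<ℓ ℓ<m reps enumerates =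
  (λ r _ → Codes.higherWeights-divisor 𝔽 (suc ℓ₀) m (m ∸ suc ℓ₀) (ℕ.<⇒≤ 1<ℓ) ℓ<m ≡.refl reps enumerates r) ,
  deltaOf-etaDiv ℓ₀ m (ℕ.m<n⇒0<n∸m ℓ<m)
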